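{- Let $p$ be a prime, $n\geq 0$, $C_{p^n}$ cyclic of order $p^n$ with generator $c$, and for $i\ge0$ let $\zeta_{p^i}$ be a primitive $p^i$th root of unity. Consider the absolute Wedderburn embedding \[ \omega_{\mathbb{Z},p^n}\colon\mathbb{Z}C_{p^n}\to\prod_{i\in[0,n]}\mathbb{Z}[\zeta_{p^i}],\qquad c\mapsto(\zeta_{p^i})_{i\in[0,n]}. \] Every element of $\prod_{i\in[0,n]}\mathbb{Z}[\zeta_{p^i}]$ is uniquely of the form $\bigl(\sum_{j\in[0,\phi(p^i)-1]}x_{i,j}\zeta_{p^i}^j\bigr)_{i\in[0,n]}$ with $x_{i,j}\in\mathbb{Z}$. Such an element lies in the image of $\omega_{\mathbb{Z},p^n}$ if and only if for all $l\in[1,n]$ and all $j\in[0,\phi(p^{n-l})-1]$, \[ x_{n-l,j}\equiv\sum_{i\in[0,l-1]}p^{\,l-1-i}\sum_{k\in[1,p-1]}\Bigl(x_{n-i,\;j-p^{n-l}+kp^{n-1-i}}-(1-\delta_{l,n})\,x_{n-i,\;[j]_{p^{n-l-1}}-p^{n-l-1}+kp^{n-1-i}}\Bigr)\pmod{p^l}. \] Moreover, the elementary divisors of $\omega_{\mathbb{Z},p^n}$ over $\mathbb{Z}$ are $p^i$ with multiplicity $\phi(p^{n-i})$, for $i\in[0,n]$.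
   Context: $\phi$ is Euler's function; $\delta$ is the Kronecker delta; for $k\ge1$ and $j\in\mathbb{Z}$, $[j]_k\in[0,k-1]$ denotes the residue with $[j]_k\equiv j \pmod k$ (the term with $1-\delta_{l,n}$ is absent when $l=n$). All indices occurring in the congruence lie in the allowed ranges $[0,\phi(p^{n-i})-1]$. $[a,b]=\{x\in\mathbb{Z}:a\le x\le b\}$. -}

module Defs where

open import Level using (Level; _⊔_)
open import Algebra.Bundles using (Group; CommutativeRing)
open import Algebra.Bundles.Raw using (RawGroup; RawRing)
import Algebra.Definitions.RawMonoid as RawMonoidDefs
import Algebra.Definitions.RawSemiring as RawSemiringDefs
open import Algebra.Properties.CommutativeMonoid.Sum using (sum-cong-≗)
open import Data.Bool.Base using (if_then_else_)
open import Data.Fin.Base using (Fin; toℕ; fromℕ<)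
import Data.Fin.Properties as Fin
open import Data.Integer.Base as ℤ using (ℤ; +_; -[1+_]; 0ℤ; 1ℤ)
open import Data.Integer.Divisibility using () renaming (_∣_ to _∣ℤ_)
open import Data.Integer.Properties using (+-0-commutativeMonoid)
open import Data.List.Base
  using (List; length; lookup; filter; map; upTo; concatMap; replicate)
open import Data.List.Relation.Unary.Linked using (Linked)
open import Data.Nat.Base as ℕ using (ℕ; suc; _∸_; _^_; _≤_; _<_; NonZero)
open import Data.Nat.Coprimality using (coprime?)
open import Data.Nat.DivMod using (_%_)
open import Data.Nat.Divisibility using (_∣_)
open import Data.Nat.Properties using (_≟_; _<?_; m^n≢0)
open import Data.Product using (Σ; ∃; ∃!; _×_; _,_; proj₁; proj₂)
open import Function.Bundles using (Func; Inverse; _⟨$⟩_)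
open import Relation.Binary.PropositionalEquality as ≡ using (_≡_; _≗_)
open import Relation.Nullary using (¬_; does; yes; no)

private variable
  a b c g ℓ ℓ₁ ℓ₂ : Level

φ : ℕ → ℕ
φ m = length (filter (λ k → coprime? k m) (map suc (upTo m)))

δ : ℕ → ℕ → ℤ
δ i j = if does (i ≟ j) then 1ℤ else 0ℤ

open RawMonoidDefs ℤ.+-0-rawMonoid using () renaming (sum to sumℤ)

-- Summation over the integer interval [lo , hi].
∑[_,_] : ℕ → ℕ → (ℕ → ℤ) → ℤ
∑[ lo , hi ] f = sumℤ {suc hi ∸ lo} (λ k → f (lo ℕ.+ toℕ k))

_≡_[mod_] : ℤ → ℤ → ℕ → Set
x ≡ y [mod m ] = + m ∣ℤ x ℤ.- y

module FreeModule (M : RawGroup a ℓ) where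
  open RawGroup M
  open RawMonoidDefs rawMonoid using (sum) renaming (_×_ to _×ₙ_)

  infixr 8 _·_
  _·_ : ℤ → Carrier → Carrier
  (+ k)      · x = k ×ₙ x
  (-[1+ k ]) · x = (suc k ×ₙ x) ⁻¹

  combination : ∀ {r} → (Fin r → ℤ) → (Fin r → Carrier) → Carrier
  combination s e = sum (λ k → s k · e k)

  IsBasis : ∀ {r} → (Fin r → Carrier) → Set (a ⊔ ℓ)
  IsBasis e = ∀ x → ∃! _≗_ (λ s → x ≈ combination s e)

-- The elementary divisors of a ℤ-linear map f between free ℤ-modules of the
-- same finite rank: f is diagonal for suitable bases, and each diagonal entry
-- divides the next one.
ElementaryDivisors : (M : RawGroup a ℓ₁) (N : RawGroup b ℓ₂) →
                     (RawGroup.Carrier M → RawGroup.Carrier N) → List ℕ →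
                     Set (a ⊔ ℓ₁ ⊔ b ⊔ ℓ₂)
ElementaryDivisors M N f ds =
  Linked _∣_ ds ×
  ∃ λ (e : Fin (length ds) → M.Carrier) →
  ∃ λ (e′ : Fin (length ds) → N.Carrier) →
    FreeModule.IsBasis M e × FreeModule.IsBasis N e′ ×
    (∀ k → f (e k) N.≈ (+ lookup ds k) N.· e′ k)
  where
  module M = RawGroup M
  module N where
    open RawGroup N public
    open FreeModule N public

module _ (G : Group g ℓ) where
  open Group G
  open RawMonoidDefs rawMonoid using () renaming (_×_ to _times_)

  power : Carrier → ℕ → Carrier
  power x k = k times x

  Generates : Carrier → Set (g ⊔ ℓ)
  Generates x = ∀ y → ∃ λ k → power x k ≈ y

  HasOrder : ℕ → Set (g ⊔ ℓ)
  HasOrder m = Inverse setoid (≡.setoid (Fin m))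

-- The integral group ring of a finite group: an element is its family of
-- coefficients, multiplication is convolution.
module GroupRing (G : Group g ℓ) {m : ℕ} (order : HasOrder G m) where
  open Group G
  open Inverse order using () renaming (to to index; to-cong to index-cong; from to element)

  ℤG : Set (g ⊔ ℓ)
  ℤG = Func setoid (≡.setoid ℤ)

  private
    constant : ℤ → ℤG
    constant k = record { to = λ _ → k ; cong = λ _ → ≡.refl }

  [_] : Carrier → ℤG
  [ x ] = record
    { to   = λ y → if does (index x Fin.≟ index y) then 1ℤ else 0ℤ
    ; cong = λ y≈z → ≡.cong (λ k → if does (index x Fin.≟ k) then 1ℤ else 0ℤ) (index-cong y≈z)
    }

  rawRing : RawRing (g ⊔ ℓ) g
  rawRing = record
    { Carrier = ℤG
    ; _≈_     = λ u v → ∀ x → u ⟨$⟩ x ≡ v ⟨$⟩ x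
    ; _+_     = λ u v → record
      { to   = λ x → (u ⟨$⟩ x) ℤ.+ (v ⟨$⟩ x)
      ; cong = λ x≈y → ≡.cong₂ ℤ._+_ (Func.cong u x≈y) (Func.cong v x≈y)
      }
    ; _*_     = λ u v → record
      { to   = λ x → sumℤ (λ k → (u ⟨$⟩ element k) ℤ.* (v ⟨$⟩ (element k ⁻¹ ∙ x)))
      ; cong = λ x≈y → sum-cong-≗ +-0-commutativeMonoid
                 (λ k → ≡.cong ((u ⟨$⟩ element k) ℤ.*_) (Func.cong v (∙-congˡ x≈y)))
      }
    ; -_      = λ u → record
      { to   = λ x → ℤ.- (u ⟨$⟩ x)
      ; cong = λ x≈y → ≡.cong ℤ.-_ (Func.cong u x≈y)
      }
    ; 0#      = constant 0ℤ
    ; 1#      = [ ε ]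
    }

module _ (R : CommutativeRing c ℓ) where
  open CommutativeRing R
  private
    module Additive = RawMonoidDefs +-rawMonoid
    module Power = RawSemiringDefs (RawRing.rawSemiring rawRing)

  CharacteristicZero : Set ℓ
  CharacteristicZero = ∀ k → 1 ≤ k → ¬ (k Additive.× 1# ≈ 0#)

  IsPrimitiveRootOfUnity : ℕ → Carrier → Set ℓ
  IsPrimitiveRootOfUnity m z =
    (z Power.^ m ≈ 1#) × (∀ k → 1 ≤ k → k < m → ¬ (z Power.^ k ≈ 1#))

  -- ℤ[ z ] is the smallest subring of R containing z.
  data _∈ℤ[_] : Carrier → Carrier → Set (c ⊔ ℓ) where
    generator : ∀ {z} → z ∈ℤ[ z ]
    zero∈     : ∀ {z} → 0# ∈ℤ[ z ]
    one∈      : ∀ {z} → 1# ∈ℤ[ z ]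
    +∈        : ∀ {z x y} → x ∈ℤ[ z ] → y ∈ℤ[ z ] → (x + y) ∈ℤ[ z ]
    *∈        : ∀ {z x y} → x ∈ℤ[ z ] → y ∈ℤ[ z ] → (x * y) ∈ℤ[ z ]
    -∈        : ∀ {z x} → x ∈ℤ[ z ] → (- x) ∈ℤ[ z ]
    ≈∈        : ∀ {z x y} → x ≈ y → x ∈ℤ[ z ] → y ∈ℤ[ z ]

  ℤ[_] : Carrier → RawRing (c ⊔ ℓ) ℓ
  ℤ[ z ] = record
    { Carrier = Σ Carrier (_∈ℤ[ z ])
    ; _≈_     = λ x y → proj₁ x ≈ proj₁ y
    ; _+_     = λ x y → proj₁ x + proj₁ y , +∈ (proj₂ x) (proj₂ y)
    ; _*_     = λ x y → proj₁ x * proj₁ y , *∈ (proj₂ x) (proj₂ y)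
    ; -_      = λ x → - proj₁ x , -∈ (proj₂ x)
    ; 0#      = 0# , zero∈
    ; 1#      = 1# , one∈
    }

∏ : ∀ {m} → (Fin m → RawRing a ℓ) → RawRing a ℓ
∏ R = record
  { Carrier = ∀ i → RawRing.Carrier (R i)
  ; _≈_     = λ x y → ∀ i → RawRing._≈_ (R i) (x i) (y i)
  ; _+_     = λ x y i → RawRing._+_ (R i) (x i) (y i)
  ; _*_     = λ x y i → RawRing._*_ (R i) (x i) (y i)
  ; -_      = λ x i → RawRing.-_ (R i) (x i)
  ; 0#      = λ i → RawRing.0# (R i)
  ; 1#      = λ i → RawRing.1# (R i)
  }

module Coefficients (p n : ℕ) .{{_ : NonZero p}} where

  -- The families x i j with i ∈ [0 , n] and j ∈ [0 , φ(pⁱ) - 1].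
  Family : Set
  Family = (i : Fin (suc n)) → Fin (φ (p ^ toℕ i)) → ℤ

  _≐_ : Family → Family → Set
  x ≐ y = ∀ i → x i ≗ y i

  -- The entry of x at a pair of natural numbers. The value 0 outside the index
  -- range is never used in Congruences.
  entry : Family → ℕ → ℕ → ℤ
  entry x i j with i <? suc n
  ... | no _ = 0ℤ
  ... | yes i≤n with j <? φ (p ^ toℕ (fromℕ< i≤n))
  ...   | no _ = 0ℤ
  ...   | yes j<φ = x (fromℕ< i≤n) (fromℕ< j<φ)

  [_]mod-p^_ : ℕ → ℕ → ℕ
  [ j ]mod-p^ k = _%_ j (p ^ k) {{m^n≢0 p k}}

  -- In each index the subtraction comes last, so that ∸ never truncates:
  -- k ≥ 1 and i ≤ l - 1 give k p^(n-1-i) ≥ p^(n-l). For l = n the exponent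
  -- n ∸ l ∸ 1 is meaningless, but the factor 1 - δ l n vanishes.
  Congruences : Family → Set
  Congruences x =
    ∀ l → 1 ≤ l → l ≤ n → ∀ j → j < φ (p ^ (n ∸ l)) →
    entry x (n ∸ l) j
      ≡ ∑[ 0 , l ∸ 1 ] (λ i →
          + (p ^ (l ∸ 1 ∸ i)) ℤ.*
          ∑[ 1 , p ∸ 1 ] (λ k →
            entry x (n ∸ i) ((j ℕ.+ k ℕ.* p ^ (n ∸ 1 ∸ i)) ∸ p ^ (n ∸ l))
            ℤ.- (1ℤ ℤ.- δ l n) ℤ.*
              entry x (n ∸ i)
                (([ j ]mod-p^ (n ∸ l ∸ 1) ℕ.+ k ℕ.* p ^ (n ∸ 1 ∸ i)) ∸ p ^ (n ∸ l ∸ 1))))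
      [mod p ^ l ]

module Wedderburn
  (p n : ℕ) .{{_ : NonZero p}}
  (C : Group g ℓ) (order : HasOrder C (p ^ n)) (c₀ : Group.Carrier C)
  (K : CommutativeRing c ℓ₁) (ζ : Fin (suc n) → CommutativeRing.Carrier K)
  where

  open Coefficients p n
  open GroupRing C order public using (ℤG; [_]) renaming (rawRing to ℤC)

  ∏ℤ[ζ] : RawRing (c ⊔ ℓ₁) ℓ₁
  ∏ℤ[ζ] = ∏ (λ i → ℤ[_] K (ζ i))

  module ℤC where
    open RawRing ℤC public
  module ∏ℤ[ζ] where
    open RawRing ∏ℤ[ζ] public

  private
    module Component (i : Fin (suc n)) where
      open RawRing (ℤ[_] K (ζ i)) public
      open FreeModule +-rawGroup public
      open RawSemiringDefs rawSemiring public using () renaming (_^_ to pow)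

  ζ-tuple : ∏ℤ[ζ].Carrier
  ζ-tuple i = ζ i , generator

  -- The ℤ-linear extension of c₀ᵏ ↦ (ζᵢᵏ)ᵢ; the elements of C are the c₀ᵏ with
  -- k ∈ [0 , pⁿ - 1] when c₀ generates C.
  ω : ℤG → ∏ℤ[ζ].Carrier
  ω u i = combination {p ^ n}
            (λ k → u ⟨$⟩ power C c₀ (toℕ k))
            (λ k → pow (ζ-tuple i) (toℕ k))
    where open Component i

  fromCoefficients : Family → ∏ℤ[ζ].Carrier
  fromCoefficients x i = combination (x i) (λ j → pow (ζ-tuple i) (toℕ j))
    where open Component i

  InImage : ∏ℤ[ζ].Carrier → Set (g ⊔ ℓ ⊔ ℓ₁)
  InImage y = ∃ λ u → ω u ∏ℤ[ζ].≈ y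

-- pⁱ with multiplicity φ(pⁿ⁻ⁱ), for i = 0, …, n.
prescribedDivisors : ℕ → ℕ → List ℕ
prescribedDivisors p n = concatMap (λ i → replicate (φ (p ^ (n ∸ i))) (p ^ i)) (upTo (suc n))

module Submission where

-- Let ζ be a primitive pᵐ-th root of unity and π = ζ - 1. In ℤ[ζ] the power π^φ(pᵐ) divides p by the binomial
-- theorem, and π is not a unit by Nakayama's lemma. Dividing repeatedly by π, one finds that a ℤ-linear relation
-- between 1, …, ζ^(φ(pᵐ)-1) has all coefficients divisible by p, and by descent it is trivial.
--
-- For c ≤ n and j < φ(pⁿ⁻ᶜ) the map ω sends e_{c,j} = Σ_k c₀^(j + k pⁿ⁻ᶜ) to pᶜ e′_{c,j}, where e′_{c,j} = (ζᵢʲ) in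
-- the components i ≤ n - c and 0 in the others. Both families are unitriangular with respect to the standard bases,
-- hence bases; this gives injectivity and the elementary divisors, and the image consists of the elements whose
-- coordinate at e′_{c,j} is divisible by pᶜ for all c and j.
--
-- It remains to see that this coordinate is x_{n-l,j} minus the right-hand side of the congruence, for l = c. The double
-- sums R_l(t) in the congruences satisfy R_{l+1}(t) = Σ_{k<p-1} x_{m+1}(t + k pᵐ) + p R_l(t + (p-1) pᵐ) for l + m + 1 = n.
-- Consequently, the polynomial Σ_t (x_{m+1}(t) + R_l(top t)) Tᵗ, with top t the largest residue modulo pᵐ⁺¹ that is
-- congruent to t modulo pᵐ, agrees with x_{m+1} at ζ_{m+1} and becomes R_{l+1} modulo T^(pᵐ) - 1. Telescoping over the
-- levels expresses the family x in terms of the e′_{c,j}.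

open import Defs
open import Algebra.Apartness.Bundles using (HeytingField; HeytingCommutativeRing)
open import Algebra.Bundles using (CommutativeMonoid; CommutativeRing; Group)
open import Algebra.Bundles.Raw using (RawGroup; RawRing)
import Algebra.Definitions.RawMonoid as RawMonoidDefs
import Algebra.Definitions.RawSemiring as RawSemiringDefs
open import Algebra.Morphism.Structures using (module RingMorphisms)
open import Data.Bool.Base using (if_then_else_; true; false)
open import Data.Fin.Base as Fin using (Fin; toℕ; fromℕ<; zero; suc)
open import Data.Fin.Permutation using (Permutation; permutation)
import Data.Fin.Properties as Fin
open import Data.Integer.Base as ℤ using (ℤ; +_; -[1+_]; 0ℤ; 1ℤ; ∣_∣; _⊖_)
open import Data.Integer.Divisibility.Signed as ℤ∣ using (divides) renaming (_∣_ to _∣±_)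
import Data.Integer.Properties as ℤ
open import Data.Integer.Solver using (module +-*-Solver)
open import Data.List.Base using (List; _∷_; _++_; applyUpTo; concatMap; filter; length; map; replicate; upTo)
open import Data.List.Properties using (length-applyUpTo; lookup-applyUpTo; map-upTo)
open import Data.List.Relation.Unary.Linked using (Linked)
import Data.List.Relation.Unary.Linked.Properties as Linked
open import Data.Maybe.Base as Maybe using (Maybe)
open import Data.Nat.Base as ℕ using (ℕ; zero; suc; _∸_; _≤_; _<_; z≤n; s≤s; NonZero)
open import Data.Nat.Combinatorics using (nCk+nC[k+1]≡[n+1]C[k+1]; nC1≡n; nCn≡1)
open import Data.Nat.Coprimality using (Coprime; coprime?; coprime-divisor; coprime-Bézout)
open import Data.Nat.Divisibility as ℕ∣ using (_∣_; divides; m∣m*n)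
open import Data.Nat.DivMod
  using (_%_; _/_; m%n<n; m≡m%n+[m/n]*n; m<n⇒m%n≡m; [m+kn]%n≡m%n; m∣n⇒o%n%m≡o%m)
open import Data.Nat.GCD using (module Bézout)
open import Data.Nat.Primality using (Prime; prime⇒nonZero; prime⇒nonTrivial; prime⇒irreducible; euclidsLemma)
import Data.Nat.Properties as ℕ
open import Data.Product using (∃; ∃!; _×_; _,_; proj₁; proj₂; map₁; map₂)
import Data.Sign.Base as Sign
open import Data.Sum using (inj₁; inj₂)
open import Function using (_∘_)
open import Function.Bundles using (Equivalence; Func; Inverse; _⇔_; _⟨$⟩_; mk⇔)
open import Level using (Level)
open import Relation.Binary.Definitions using (tri<; tri≈; tri>)
open import Relation.Binary.PropositionalEquality as ≡ using (_≡_; cong; cong₂)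
open import Relation.Nullary using (¬_; contradiction; does; no; yes)
open import Relation.Nullary.Decidable using (dec⇒maybe; dec-false; dec-true; does-⇔)
open import Relation.Unary using (Decidable)

open +-*-Solver using () renaming
  (solve to ℤ-solve; con to ℤ-con; _:+_ to _ℤ:+_; _:*_ to _ℤ:*_; _:-_ to _ℤ:-_; :-_ to ℤ:-_; _:=_ to _ℤ:=_)

-- The ring is only a Heyting field of characteristic zero, so irreducibility of the cyclotomic
-- polynomials enters as a statement on linear independence, drawn from divisibility by powers of π
-- alone. Freeness of ℤ[ζ] cannot be presupposed on the way: Nakayama's lemma is applied to the
-- possibly dependent generators 1, ..., ζ^(pᵐ-1).
--
-- The elements e_{c,j} are translates of the sum over the subgroup of order pᶜ. A character that is
-- trivial on this subgroup sends that sum to pᶜ, any other one sends it to 0; hence the shape of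
-- e′_{c,j}.
--
-- The correction is placed at top t for two reasons. It depends only on t modulo pᵐ, so a
-- polynomial with coefficients g (top t) is a multiple of the cyclotomic polynomial of level m + 1
-- and vanishes at ζ_{m+1}. And top fixes the residues t ≥ φ(pᵐ⁺¹), so that x_{m+1}(t) + R_l(top t)
-- - R_l(t) is supported on the standard exponents.

module NatSum {a ℓ} (M : CommutativeMonoid a ℓ) where

  open CommutativeMonoid M
  open import Algebra.Properties.CommutativeMonoid.Sum M using (sum)
  open import Algebra.Properties.CommutativeSemigroup commutativeSemigroup using (interchange)
  open import Relation.Binary.Reasoning.Setoid setoid

  -- Indices are natural numbers instead of elements of `Fin N`, so that a range can be cut, sorted
  -- by residue classes or replaced by one of equal length without casts.
  Σ< : ℕ → (ℕ → Carrier) → Carrier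
  Σ< zero    f = ε
  Σ< (suc N) f = f 0 ∙ Σ< N (λ k → f (suc k))

  sum≡Σ< : ∀ N (f : ℕ → Carrier) → sum {N} (λ k → f (toℕ k)) ≡ Σ< N f
  sum≡Σ< zero    f = ≡.refl
  sum≡Σ< (suc N) f = ≡.cong (f 0 ∙_) (sum≡Σ< N (λ k → f (suc k)))

  Σ<-cong : ∀ N {f g : ℕ → Carrier} → (∀ k → k < N → f k ≈ g k) → Σ< N f ≈ Σ< N g
  Σ<-cong zero    f≈g = refl
  Σ<-cong (suc N) f≈g = ∙-cong (f≈g 0 (s≤s z≤n)) (Σ<-cong N (λ k k<N → f≈g (suc k) (s≤s k<N)))

  Σ<-cong′ : ∀ N {f g : ℕ → Carrier} → (∀ k → f k ≈ g k) → Σ< N f ≈ Σ< N g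
  Σ<-cong′ N f≈g = Σ<-cong N (λ k _ → f≈g k)

  Σ<-zero : ∀ N {f : ℕ → Carrier} → (∀ k → k < N → f k ≈ ε) → Σ< N f ≈ ε
  Σ<-zero zero    f≈ε = refl
  Σ<-zero (suc N) f≈ε = trans (∙-cong (f≈ε 0 (s≤s z≤n)) (Σ<-zero N (λ k k<N → f≈ε (suc k) (s≤s k<N)))) (identityˡ ε)

  Σ<-distrib : ∀ N (f g : ℕ → Carrier) → Σ< N (λ k → f k ∙ g k) ≈ Σ< N f ∙ Σ< N g
  Σ<-distrib zero    f g = sym (identityˡ ε)
  Σ<-distrib (suc N) f g = trans (∙-congˡ (Σ<-distrib N (λ k → f (suc k)) (λ k → g (suc k))))
                                 (interchange (f 0) (g 0) _ _)

  Σ<-swap : ∀ N P (f : ℕ → ℕ → Carrier) →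
            Σ< N (λ i → Σ< P (f i)) ≈ Σ< P (λ j → Σ< N (λ i → f i j))
  Σ<-swap zero    P f = sym (Σ<-zero P (λ _ _ → refl))
  Σ<-swap (suc N) P f = trans (∙-congˡ (Σ<-swap N P (λ i → f (suc i))))
                              (sym (Σ<-distrib P (f 0) _))

  Σ<-split : ∀ N P (f : ℕ → Carrier) →
             Σ< (N ℕ.+ P) f ≈ Σ< N f ∙ Σ< P (λ k → f (N ℕ.+ k))
  Σ<-split zero    P f = sym (identityˡ _)
  Σ<-split (suc N) P f = trans (∙-congˡ (Σ<-split N P (λ k → f (suc k)))) (sym (assoc _ _ _))

  Σ<-last : ∀ N (f : ℕ → Carrier) → Σ< (suc N) f ≈ Σ< N f ∙ f N
  Σ<-last N f = begin
    Σ< (suc N) f                            ≡⟨ ≡.cong (λ k → Σ< k f) (ℕ.+-comm 1 N) ⟩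
    Σ< (N ℕ.+ 1) f                          ≈⟨ Σ<-split N 1 f ⟩
    Σ< N f ∙ (f (N ℕ.+ 0) ∙ ε)              ≈⟨ ∙-congˡ (identityʳ _) ⟩
    Σ< N f ∙ f (N ℕ.+ 0)                    ≡⟨ ≡.cong (λ k → Σ< N f ∙ f k) (ℕ.+-identityʳ N) ⟩
    Σ< N f ∙ f N                            ∎

  -- Division with remainder by b on the indices. Followed by `Σ<-swap` it sorts a sum by residue
  -- classes modulo b.
  Σ<-block : ∀ a b (f : ℕ → Carrier) →
             Σ< (a ℕ.* b) f ≈ Σ< a (λ k → Σ< b (λ s → f (s ℕ.+ k ℕ.* b)))
  Σ<-block zero    b f = refl
  Σ<-block (suc a) b f = begin
    Σ< (b ℕ.+ a ℕ.* b) f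
      ≈⟨ Σ<-split b (a ℕ.* b) f ⟩
    Σ< b f ∙ Σ< (a ℕ.* b) (λ k → f (b ℕ.+ k))
      ≈⟨ ∙-cong (Σ<-cong′ b (λ s → reflexive (≡.cong f (≡.sym (ℕ.+-identityʳ s)))))
                (Σ<-block a b (λ k → f (b ℕ.+ k))) ⟩
    Σ< b (λ s → f (s ℕ.+ 0)) ∙ Σ< a (λ k → Σ< b (λ s → f (b ℕ.+ (s ℕ.+ k ℕ.* b))))
      ≈⟨ ∙-congˡ (Σ<-cong′ a (λ k → Σ<-cong′ b (λ s → reflexive (≡.cong f (shift s (k ℕ.* b)))))) ⟩
    Σ< b (λ s → f (s ℕ.+ 0)) ∙ Σ< a (λ k → Σ< b (λ s → f (s ℕ.+ (b ℕ.+ k ℕ.* b)))) ∎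
    where
    shift : ∀ s t → b ℕ.+ (s ℕ.+ t) ≡ s ℕ.+ (b ℕ.+ t)
    shift s t = ≡.trans (≡.sym (ℕ.+-assoc b s t))
      (≡.trans (≡.cong (ℕ._+ t) (ℕ.+-comm b s)) (ℕ.+-assoc s b t))

  Σ<-single : ∀ N j (f : ℕ → Carrier) → j < N → (∀ k → k < N → ¬ k ≡ j → f k ≈ ε) → Σ< N f ≈ f j
  Σ<-single (suc N) zero f _ f≈ε =
    trans (∙-congˡ (Σ<-zero N (λ k k<N → f≈ε (suc k) (s≤s k<N) λ()))) (identityʳ _)
  Σ<-single (suc N) (suc j) f (s≤s j<N) f≈ε =
    trans (∙-cong (f≈ε 0 (s≤s z≤n) λ())
                  (Σ<-single N j (λ k → f (suc k)) j<N
                     (λ k k<N k≢j → f≈ε (suc k) (s≤s k<N) (λ eq → k≢j (ℕ.suc-injective eq)))))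
          (identityˡ _)

private module ℤΣ = NatSum ℤ.+-0-commutativeMonoid

open ℤΣ using () renaming
  (Σ< to Σℤ; Σ<-cong to Σℤ-cong; Σ<-cong′ to Σℤ-cong′; Σ<-last to Σℤ-last; Σ<-distrib to Σℤ-distrib; Σ<-zero to Σℤ-zero; Σ<-single to Σℤ-single)

-- Integer multiples and polynomial values in a commutative ring

module IntegerEmbedding {c ℓ} (R : CommutativeRing c ℓ) where

  open CommutativeRing R hiding (zero)
  open import Algebra.Properties.Semiring.Mult semiring using (×-homo-+; ×1-homo-*) renaming (_×_ to _×ₙ_)
  open import Algebra.Properties.Ring ring
    using (-‿distribˡ-*; -‿distribʳ-*; -0#≈0#; -‿involutive; -‿+-comm)
  open import Algebra.Solver.Ring.AlmostCommutativeRing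
    using (AlmostCommutativeRing; fromCommutativeRing; _-Raw-AlmostCommutative⟶_)
  open import Relation.Binary.Reasoning.Setoid setoid

  -- The clauses are those of the integer multiples in `FreeModule`, taken at `1#`; in particular
  -- `CharacteristicZero` speaks of its values literally.
  ι : ℤ → Carrier
  ι (+ k)      = k ×ₙ 1#
  ι (-[1+ k ]) = - (suc k ×ₙ 1#)

  ι-neg : ∀ x → ι (ℤ.- x) ≈ - ι x
  ι-neg (+ zero)    = sym -0#≈0#
  ι-neg (+ suc k)   = refl
  ι-neg (-[1+ k ])  = sym (-‿involutive _)

  ι-⊖ : ∀ m n → ι (m ⊖ n) ≈ ι (+ m) - ι (+ n)
  ι-⊖ m zero = sym (trans (+-congˡ -0#≈0#) (+-identityʳ _))
  ι-⊖ zero (suc n) = sym (+-identityˡ _)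
  ι-⊖ (suc m) (suc n) = begin
    ι (suc m ⊖ suc n)                ≡⟨ ≡.cong ι (ℤ.[1+m]⊖[1+n]≡m⊖n m n) ⟩
    ι (m ⊖ n)                        ≈⟨ ι-⊖ m n ⟩
    m ×ₙ 1# - n ×ₙ 1#                  ≈⟨ +-congʳ (+-identityˡ _) ⟨
    0# + m ×ₙ 1# - n ×ₙ 1#             ≈⟨ +-congʳ (+-congʳ (-‿inverseʳ 1#)) ⟨
    1# - 1# + m ×ₙ 1# - n ×ₙ 1#        ≈⟨ +-congʳ (trans (+-assoc _ _ _) (trans (+-congˡ (+-comm _ _)) (sym (+-assoc _ _ _)))) ⟩
    1# + m ×ₙ 1# - 1# - n ×ₙ 1#        ≈⟨ +-assoc _ _ _ ⟩
    1# + m ×ₙ 1# + (- 1# - n ×ₙ 1#)    ≈⟨ +-congˡ (-‿+-comm _ _) ⟩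
    1# + m ×ₙ 1# - (1# + n ×ₙ 1#)      ∎

  ι-+ : ∀ x y → ι (x ℤ.+ y) ≈ ι x + ι y
  ι-+ (+ m)      (+ n)      = ×-homo-+ 1# m n
  ι-+ (+ m)      (-[1+ n ]) = ι-⊖ m (suc n)
  ι-+ (-[1+ m ]) (+ n)      = trans (ι-⊖ n (suc m)) (+-comm _ _)
  ι-+ (-[1+ m ]) (-[1+ n ]) = begin
    - (suc (suc (m ℕ.+ n)) ×ₙ 1#)        ≡⟨ ≡.cong (λ k → - (suc k ×ₙ 1#)) (ℕ.+-suc m n) ⟨
    - ((suc m ℕ.+ suc n) ×ₙ 1#)          ≈⟨ -‿cong (×-homo-+ 1# (suc m) (suc n)) ⟩
    - (suc m ×ₙ 1# + suc n ×ₙ 1#)         ≈⟨ -‿+-comm _ _ ⟨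
    - (suc m ×ₙ 1#) - (suc n ×ₙ 1#)       ∎

  private
    ι-◃+ : ∀ m n → ι (Sign.+ ℤ.◃ (m ℕ.* n)) ≈ ι (+ m) * ι (+ n)
    ι-◃+ m n = trans (reflexive (≡.cong ι (ℤ.+◃n≡+n (m ℕ.* n)))) (×1-homo-* m n)

    ι-◃- : ∀ m n → ι (Sign.- ℤ.◃ (m ℕ.* n)) ≈ - (ι (+ m) * ι (+ n))
    ι-◃- m n = trans (reflexive (≡.cong ι (ℤ.-◃n≡-n (m ℕ.* n))))
                 (trans (ι-neg (+ (m ℕ.* n))) (-‿cong (×1-homo-* m n)))

  ι-* : ∀ x y → ι (x ℤ.* y) ≈ ι x * ι y
  ι-* (+ m)      (+ n)      = ι-◃+ m n
  ι-* (+ m)      (-[1+ n ]) = trans (ι-◃- m (suc n)) (-‿distribʳ-* _ _)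
  ι-* (-[1+ m ]) (+ n)      = trans (ι-◃- (suc m) n) (-‿distribˡ-* _ _)
  ι-* (-[1+ m ]) (-[1+ n ]) = begin
    ι (Sign.+ ℤ.◃ (suc m ℕ.* suc n))      ≈⟨ ι-◃+ (suc m) (suc n) ⟩
    ι (+ suc m) * ι (+ suc n)             ≈⟨ -‿involutive _ ⟨
    - - (ι (+ suc m) * ι (+ suc n))       ≈⟨ -‿cong (-‿distribˡ-* _ _) ⟩
    - (- ι (+ suc m) * ι (+ suc n))       ≈⟨ -‿distribʳ-* _ _ ⟩
    - ι (+ suc m) * - ι (+ suc n)         ∎

  ι-1 : ι 1ℤ ≈ 1#
  ι-1 = +-identityʳ 1#

  private
    ACR : AlmostCommutativeRing _ _
    ACR = fromCommutativeRing R

    ι-morphism : ℤ.+-*-rawRing -Raw-AlmostCommutative⟶ ACR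
    ι-morphism = record
      { ⟦_⟧ = ι ; +-homo = ι-+ ; *-homo = ι-* ; -‿homo = ι-neg ; 0-homo = refl ; 1-homo = ι-1 }

    -- The solver compares integer coefficients only, since equality in R is not assumed decidable.
    -- Its constant 1 denotes `1# + 0#`, which is why `1#` is passed to it as a variable below.
    ι-≟ : ∀ x y → Maybe (ι x ≈ ι y)
    ι-≟ x y = Maybe.map (λ x≡y → reflexive (≡.cong ι x≡y)) (dec⇒maybe (x ℤ.≟ y))

  open import Algebra.Solver.Ring ℤ.+-*-rawRing ACR ι-morphism ι-≟ public
    using (solve; _:=_; _:+_; _:*_; _:-_; :-_; con)

  ι-≡ : ∀ {x y} → x ≡ y → ι x ≈ ι y
  ι-≡ x≡y = reflexive (≡.cong ι x≡y)

  open NatSum +-commutativeMonoid public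
  open import Algebra.Properties.Semiring.Sum semiring using (sum)
  open import Algebra.Properties.Semiring.Exp semiring using (_^_; ^-congˡ)

  Σ<-*ˡ : ∀ N x (f : ℕ → Carrier) → x * Σ< N f ≈ Σ< N (λ k → x * f k)
  Σ<-*ˡ zero    x f = zeroʳ x
  Σ<-*ˡ (suc N) x f = trans (distribˡ _ _ _) (+-congˡ (Σ<-*ˡ N x (λ k → f (suc k))))

  Σ<-*ʳ : ∀ N x (f : ℕ → Carrier) → Σ< N f * x ≈ Σ< N (λ k → f k * x)
  Σ<-*ʳ N x f = trans (*-comm _ x) (trans (Σ<-*ˡ N x f) (Σ<-cong′ N (λ k → *-comm x (f k))))

  ι-Σ< : ∀ N (f : ℕ → ℤ) → ι (Σℤ N f) ≈ Σ< N (λ k → ι (f k))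
  ι-Σ< zero    f = refl
  ι-Σ< (suc N) f = trans (ι-+ (f 0) (Σℤ N (λ k → f (suc k)))) (+-congˡ (ι-Σ< N (λ k → f (suc k))))

  -- The length is kept apart from the coefficient function, so that the same coefficients can be
  -- evaluated up to φ(pᵐ) or up to pᵐ.
  ev : ℕ → (ℕ → ℤ) → Carrier → Carrier
  ev N f z = Σ< N (λ t → ι (f t) * z ^ t)

  ev-cong : ∀ N {f g} z → (∀ t → t < N → f t ≡ g t) → ev N f z ≈ ev N g z
  ev-cong N z f≡g = Σ<-cong N (λ t t<N → *-congʳ (ι-≡ (f≡g t t<N)))

  1^ : ∀ N → 1# ^ N ≈ 1#
  1^ zero    = refl
  1^ (suc N) = trans (*-identityˡ _) (1^ N)

  geometric : ∀ N x → (x - 1#) * Σ< N (x ^_) ≈ x ^ N - 1#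
  geometric zero    x = trans (zeroʳ _) (sym (-‿inverseʳ 1#))
  geometric (suc N) x = begin
    (x - 1#) * (1# + Σ< N (λ k → x * x ^ k))  ≈⟨ *-congˡ (+-congˡ (Σ<-*ˡ N x (x ^_))) ⟨
    (x - 1#) * (1# + x * Σ< N (x ^_))
      ≈⟨ solve 3 (λ x e s → (x :- e) :* (e :+ x :* s) := (x :* e :- e :* e) :+ x :* ((x :- e) :* s)) refl x 1# (Σ< N (x ^_)) ⟩
    (x * 1# - 1# * 1#) + x * ((x - 1#) * Σ< N (x ^_))
      ≈⟨ +-cong (+-congˡ (-‿cong (*-identityˡ 1#))) (*-congˡ (geometric N x)) ⟩
    (x * 1# - 1#) + x * (x ^ N - 1#)
      ≈⟨ solve 3 (λ x e y → (x :* e :- e) :+ x :* (y :- e) := x :* y :- e) refl x 1# (x ^ N) ⟩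
    x * x ^ N - 1# ∎

  geometric-1 : ∀ N {x} → x ≈ 1# → Σ< N (x ^_) ≈ ι (+ N)
  geometric-1 N {x} x≈1 = trans
    (Σ<-cong′ N (λ k → trans (^-congˡ k x≈1) (1^ k)))
    (count N)
    where
    count : ∀ N → Σ< N (λ _ → 1#) ≈ ι (+ N)
    count zero    = refl
    count (suc N) = +-congˡ (count N)

  module _ {b ℓ′} (M : RawGroup b ℓ′) (h : RawGroup.Carrier M → Carrier) where

    open RawGroup M using (_∙_; ε; _⁻¹)
    open FreeModule M using (_·_; combination)
    open RawMonoidDefs (RawGroup.rawMonoid M) using () renaming (_×_ to _×ᴳ_)

    module _ (h-∙ : ∀ x y → h (x ∙ y) ≈ h x + h y) (h-ε : h ε ≈ 0#)
             (h-⁻¹ : ∀ x → h (x ⁻¹) ≈ - h x) where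

      h-· : ∀ k x → h (k · x) ≈ ι k * h x
      h-· (+ k)      x = h-× k
        where
        h-× : ∀ k → h (k ×ᴳ x) ≈ ι (+ k) * h x
        h-× zero    = trans h-ε (sym (zeroˡ _))
        h-× (suc k) = begin
          h (x ∙ k ×ᴳ x)               ≈⟨ h-∙ _ _ ⟩
          h x + h (k ×ᴳ x)             ≈⟨ +-cong (sym (*-identityˡ _)) (h-× k) ⟩
          1# * h x + k ×ₙ 1# * h x      ≈⟨ distribʳ _ _ _ ⟨
          (1# + k ×ₙ 1#) * h x          ∎
      h-· (-[1+ k ]) x = trans (h-⁻¹ _) (trans (-‿cong (h-· (+ suc k) x)) (-‿distribˡ-* _ _))

      -- Applied to the projections from the ℤ[ζᵢ] and from their product, and, with ℤ for R, to the
      -- coefficient maps of the group ring: combinations in all these modules become sums in a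
      -- commutative ring.
      h-combination : ∀ {r} (s : Fin r → ℤ) (e : Fin r → RawGroup.Carrier M) →
                      h (combination s e) ≈ sum (λ k → ι (s k) * h (e k))
      h-combination {zero}  s e = h-ε
      h-combination {suc r} s e = trans (h-∙ _ _)
        (+-cong (h-· (s zero) (e zero)) (h-combination (λ k → s (suc k)) (λ k → e (suc k))))

-- Euler's function and binomial coefficients at a prime

module PrimeArithmetic {p : ℕ} (p-prime : Prime p) where

  open import Data.Nat.Base using (_+_; _*_; _^_)
  open import Data.Nat.Combinatorics using (_C_)
  open ℕ∣ using (∣1⇒≡1; ∣-trans; ∣m∣n⇒∣m+n; ∣m+n∣m⇒∣n; ∣-reflexive; ∣⇒≤; n∣m*n)
  open ≡ using (refl; sym; trans; subst; module ≡-Reasoning)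

  private
    module ℕΣ = NatSum ℕ.+-0-commutativeMonoid

    Σ<-const : ∀ N c → ℕΣ.Σ< N (λ _ → c) ≡ N * c
    Σ<-const zero    c = refl
    Σ<-const (suc N) c = cong (c ℕ.+_) (Σ<-const N c)

    length-filter-applyUpTo : ∀ {P : ℕ → Set} (P? : Decidable P) f N →
      length (filter P? (applyUpTo f N)) ≡ ℕΣ.Σ< N (λ k → if does (P? (f k)) then 1 else 0)
    length-filter-applyUpTo P? f zero = refl
    length-filter-applyUpTo P? f (suc N) with does (P? (f 0))
    ... | true  = cong suc (length-filter-applyUpTo P? (f ∘ suc) N)
    ... | false = length-filter-applyUpTo P? (f ∘ suc) N

  prime>1 : 1 < p
  prime>1 = ℕ.nonTrivial⇒n>1 p {{prime⇒nonTrivial p-prime}}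

  prime∤1 : ¬ p ∣ 1
  prime∤1 p∣1 = ℕ.<⇒≢ prime>1 (sym (∣1⇒≡1 p∣1))

  ∤⇒coprime : ∀ {a} → ¬ p ∣ a → Coprime p a
  ∤⇒coprime p∤a {i} (i∣p , i∣a) with prime⇒irreducible p-prime i∣p
  ... | inj₁ i≡1 = i≡1
  ... | inj₂ refl = contradiction i∣a p∤a

  private
    ∤⇒coprime^ : ∀ k {a} → ¬ p ∣ a → Coprime a (p ^ k)
    ∤⇒coprime^ zero    p∤a (_ , i∣1) = ∣1⇒≡1 i∣1
    ∤⇒coprime^ (suc k) {a} p∤a {i} (i∣a , i∣p^) = ∤⇒coprime^ k p∤a (i∣a , coprime-divisor i⊥p i∣p^)
      where
      i⊥p : Coprime i p
      i⊥p (d∣i , d∣p) = ∤⇒coprime p∤a (d∣p , ∣-trans d∣i i∣a)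

    coprime^⇒∤ : ∀ k {a} → Coprime a (p ^ suc k) → ¬ p ∣ a
    coprime^⇒∤ k cop p∣a = ℕ.<⇒≢ prime>1 (sym (cop (p∣a , m∣m*n (p ^ k))))

    -- `φ` counts among 1, ..., m, so the summation index is one less than the number tested, and
    -- the only multiple of p in a block of length p sits at s = p - 1.
    indicator : ∀ k s r → s < p →
      (if does (coprime? (suc (s + r * p)) (p ^ suc k)) then 1 else 0)
        ≡ (if does (suc s ℕ.<? p) then 1 else 0)
    indicator k s r s<p = cong (λ b → if b then 1 else 0) (does-⇔ (mk⇔ to from) (coprime? _ _) (suc s ℕ.<? p))
      where
      to : Coprime (suc s + r * p) (p ^ suc k) → suc s < p
      to cop with suc s ℕ.<? p
      ... | yes s<p′ = s<p′
      ... | no s≮p  = contradiction (∣m∣n⇒∣m+n (∣-reflexive (ℕ.≤-antisym (ℕ.≮⇒≥ s≮p) s<p)) (n∣m*n r))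
                                    (coprime^⇒∤ k cop)
      from : suc s < p → Coprime (suc s + r * p) (p ^ suc k)
      from s<p′ = ∤⇒coprime^ (suc k) λ p∣ →
        ℕ.<⇒≱ s<p′ (∣⇒≤ (∣m+n∣m⇒∣n (subst (p ∣_) (ℕ.+-comm (suc s) (r * p)) p∣) (n∣m*n r)))

    count : ∀ q → ℕΣ.Σ< (suc q) (λ s → if does (suc s ℕ.<? suc q) then 1 else 0) ≡ q
    count q = begin
      ℕΣ.Σ< (suc q) (λ s → if does (suc s ℕ.<? suc q) then 1 else 0)
        ≡⟨ ℕΣ.Σ<-last q (λ s → if does (suc s ℕ.<? suc q) then 1 else 0) ⟩
      ℕΣ.Σ< q (λ s → if does (suc s ℕ.<? suc q) then 1 else 0) + (if does (suc q ℕ.<? suc q) then 1 else 0)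
        ≡⟨ cong₂ _+_ (ℕΣ.Σ<-cong q one) last ⟩
      ℕΣ.Σ< q (λ _ → 1) + 0
        ≡⟨ ℕ.+-identityʳ _ ⟩
      ℕΣ.Σ< q (λ _ → 1)
        ≡⟨ trans (Σ<-const q 1) (ℕ.*-identityʳ q) ⟩
      q ∎
      where
      open ≡-Reasoning
      one : ∀ s → s < q → (if does (suc s ℕ.<? suc q) then 1 else 0) ≡ 1
      one s s<q = cong (λ b → if b then 1 else 0) (dec-true (suc s ℕ.<? suc q) (s≤s s<q))
      last : (if does (suc q ℕ.<? suc q) then 1 else 0) ≡ 0
      last = cong (λ b → if b then 1 else 0) (dec-false (suc q ℕ.<? suc q) (ℕ.n≮n (suc q)))

  φ-prime-power : ∀ k → φ (p ^ suc k) ≡ (p ∸ 1) * p ^ k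
  φ-prime-power k = begin
    φ (p ^ suc k)
      ≡⟨ cong (length ∘ filter (λ a → coprime? a (p ^ suc k))) (map-upTo suc (p ^ suc k)) ⟩
    length (filter (λ a → coprime? a (p ^ suc k)) (applyUpTo suc (p ^ suc k)))
      ≡⟨ length-filter-applyUpTo (λ a → coprime? a (p ^ suc k)) suc (p ^ suc k) ⟩
    ℕΣ.Σ< (p ^ suc k) ind
      ≡⟨ cong (λ N → ℕΣ.Σ< N ind) (ℕ.*-comm p (p ^ k)) ⟩
    ℕΣ.Σ< (p ^ k * p) ind
      ≡⟨ ℕΣ.Σ<-block (p ^ k) p ind ⟩
    ℕΣ.Σ< (p ^ k) (λ r → ℕΣ.Σ< p (λ s → ind (s + r * p)))
      ≡⟨ ℕΣ.Σ<-cong′ (p ^ k) (λ r → trans (ℕΣ.Σ<-cong p (λ s s<p → indicator k s r s<p)) (block p prime>1)) ⟩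
    ℕΣ.Σ< (p ^ k) (λ _ → p ∸ 1)
      ≡⟨ Σ<-const (p ^ k) (p ∸ 1) ⟩
    p ^ k * (p ∸ 1)
      ≡⟨ ℕ.*-comm (p ^ k) (p ∸ 1) ⟩
    (p ∸ 1) * p ^ k ∎
    where
    open ≡-Reasoning
    ind : ℕ → ℕ
    ind a = if does (coprime? (suc a) (p ^ suc k)) then 1 else 0
    block : ∀ q → 1 < q → ℕΣ.Σ< q (λ s → if does (suc s ℕ.<? q) then 1 else 0) ≡ q ∸ 1
    block (suc q) _ = count q

  private
    absorption : ∀ n k → suc k * (suc n C suc k) ≡ suc n * (n C k)
    absorption zero    zero    = refl
    absorption zero    (suc k) = ℕ.*-zeroʳ (suc (suc k))
    absorption (suc n) zero    = trans (ℕ.*-identityˡ _) (trans (nC1≡n (suc (suc n))) (sym (ℕ.*-identityʳ _)))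
    absorption (suc n) (suc k) = begin
      suc (suc k) * (suc (suc n) C suc (suc k))
        ≡⟨ cong (suc (suc k) *_) (nCk+nC[k+1]≡[n+1]C[k+1] (suc n) (suc k)) ⟨
      suc (suc k) * (a + suc n C suc (suc k))
        ≡⟨ ℕ.*-distribˡ-+ (suc (suc k)) a _ ⟩
      (a + suc k * a) + suc (suc k) * (suc n C suc (suc k))
        ≡⟨ cong₂ (λ x y → (a + x) + y) (absorption n k) (absorption n (suc k)) ⟩
      (a + suc n * (n C k)) + suc n * (n C suc k)
        ≡⟨ ℕ.+-assoc a _ _ ⟩
      a + (suc n * (n C k) + suc n * (n C suc k))
        ≡⟨ cong (a ℕ.+_) (ℕ.*-distribˡ-+ (suc n) (n C k) (n C suc k)) ⟨
      a + suc n * (n C k + n C suc k)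
        ≡⟨ cong (λ x → a + suc n * x) (nCk+nC[k+1]≡[n+1]C[k+1] n k) ⟩
      a + suc n * a ∎
      where
      open ≡-Reasoning
      a = suc n C suc k

  -- By absorption p divides (k + 1) times the binomial coefficient, and it cannot divide k + 1.
  prime∣C : ∀ k → suc k < p → p ∣ p C suc k
  prime∣C k k<p with euclidsLemma (suc k) (p C suc k) p-prime (divides (ℕ.pred p C k) (absorption′ p prime>1))
    where
    absorption′ : ∀ q → 1 < q → suc k * (q C suc k) ≡ (ℕ.pred q C k) * q
    absorption′ (suc q) _ = trans (absorption q k) (ℕ.*-comm (suc q) _)
  ... | inj₁ p∣k = contradiction (∣⇒≤ p∣k) (ℕ.<⇒≱ k<p)
  ... | inj₂ p∣C = p∣C

δ-refl : ∀ t → δ t t ≡ 1ℤ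
δ-refl t = ≡.cong (λ b → if b then 1ℤ else 0ℤ) (dec-true (t ℕ.≟ t) ≡.refl)

δ-≢ : ∀ {t k} → ¬ t ≡ k → δ t k ≡ 0ℤ
δ-≢ {t} {k} t≢k = ≡.cong (λ b → if b then 1ℤ else 0ℤ) (dec-false (t ℕ.≟ k) t≢k)

-- Divisibility and finite generation in ℤ[z]

module CyclotomicIntegers {c ℓ} (R : CommutativeRing c ℓ) where

  open CommutativeRing R hiding (zero)
  open IntegerEmbedding R
  open import Algebra.Properties.Semiring.Exp semiring using (_^_; ^-homo-*; ^-congʳ)
  open import Algebra.Properties.Semiring.Mult semiring using () renaming (_×_ to _×ₙ_)
  open import Relation.Binary.Reasoning.Setoid setoid

  module _ (z : Carrier) where

    S : Carrier → Set _
    S x = _∈ℤ[_] R x z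

    ι∈ : ∀ k → S (ι k)
    ι∈ (+ k)      = ×∈ k
      where
      ×∈ : ∀ k → S (k ×ₙ 1#)
      ×∈ zero    = zero∈
      ×∈ (suc k) = +∈ one∈ (×∈ k)
    ι∈ (-[1+ k ]) = -∈ (ι∈ (+ suc k))

    ^∈ : ∀ {x} k → S x → S (x ^ k)
    ^∈ zero    x∈ = one∈
    ^∈ (suc k) x∈ = *∈ x∈ (^∈ k x∈)

    infix 4 _∣S_
    -- The cofactor has to lie in ℤ[z]: over the field in which everything takes place, divisibility
    -- without this restriction would carry no information.
    _∣S_ : Carrier → Carrier → Set _
    a ∣S b = ∃ λ w → S w × b ≈ a * w

    ∣S-resp : ∀ {a b b′} → b ≈ b′ → a ∣S b → a ∣S b′
    ∣S-resp b≈b′ (w , w∈ , b≈aw) = w , w∈ , trans (sym b≈b′) b≈aw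

    ∣S-respˡ : ∀ {a a′ b} → a ≈ a′ → a ∣S b → a′ ∣S b
    ∣S-respˡ a≈a′ (w , w∈ , b≈aw) = w , w∈ , trans b≈aw (*-congʳ a≈a′)

    ∣S-trans : ∀ {a b d} → a ∣S b → b ∣S d → a ∣S d
    ∣S-trans (w , w∈ , b≈aw) (v , v∈ , d≈bv) =
      w * v , *∈ w∈ v∈ , trans d≈bv (trans (*-congʳ b≈aw) (*-assoc _ _ _))

    ∣S-+ : ∀ {a x y} → a ∣S x → a ∣S y → a ∣S (x + y)
    ∣S-+ (w , w∈ , eq) (v , v∈ , eq′) = w + v , +∈ w∈ v∈ , trans (+-cong eq eq′) (sym (distribˡ _ _ _))

    ∣S-*ʳ : ∀ {a x y} → a ∣S x → S y → a ∣S (x * y)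
    ∣S-*ʳ a∣x y∈ = ∣S-trans a∣x (_ , y∈ , refl)

    ∣S-neg : ∀ {a x} → a ∣S x → a ∣S (- x)
    ∣S-neg (w , w∈ , eq) = - w , -∈ w∈ ,
      trans (-‿cong eq) (solve 2 (λ a w → :- (a :* w) := a :* (:- w)) refl _ w)

    ∣S-0 : ∀ {a} → a ∣S 0#
    ∣S-0 = 0# , zero∈ , sym (zeroʳ _)

    ∣S-Σ< : ∀ {a} N {f : ℕ → Carrier} → (∀ k → k < N → a ∣S f k) → a ∣S Σ< N f
    ∣S-Σ< zero    a∣f = ∣S-0
    ∣S-Σ< (suc N) a∣f = ∣S-+ (a∣f 0 (s≤s z≤n)) (∣S-Σ< N (λ k k<N → a∣f (suc k) (s≤s k<N)))

    ∣S-^ : ∀ {a b} k → a ∣S b → (a ^ k) ∣S (b ^ k)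
    ∣S-^ zero    a∣b = 1# , one∈ , sym (*-identityʳ _)
    ∣S-^ {a} {b} (suc k) (w , w∈ , b≈aw) with ∣S-^ k (w , w∈ , b≈aw)
    ... | v , v∈ , eq = w * v , *∈ w∈ v∈ , trans (*-cong b≈aw eq)
      (solve 4 (λ a w x v → (a :* w) :* (x :* v) := (a :* x) :* (w :* v)) refl a w (a ^ k) v)

    ^-∣S : ∀ {a} k l → S a → k ≤ l → (a ^ k) ∣S (a ^ l)
    ^-∣S {a} k l a∈ k≤l = a ^ (l ∸ k) , ^∈ (l ∸ k) a∈ ,
      trans (^-congʳ a (≡.sym (ℕ.m+[n∸m]≡n k≤l))) (^-homo-* a k (l ∸ k))

    -- a ≡ 0 modulo (a c , b) can be fed into itself to give a ≡ 0 modulo (a cᵏ , b).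
    ∣S-bootstrap : ∀ {a b c} → S a → (∃ λ w → S w × b ∣S (a - a * c * w)) → ∀ k → b ≈ c ^ k → S c →
                   c ^ k ∣S a
    ∣S-bootstrap {a} {b} {c} a∈ (w , w∈ , v , v∈ , eq) k b≈ c∈ with iter k
      where
      iter : ∀ k → ∃ λ w → S w × b ∣S (a - a * c ^ k * w)
      iter zero = 1# , one∈ , 0# , zero∈ ,
        trans (+-congˡ (-‿cong (trans (*-identityʳ _) (*-identityʳ _)))) (trans (-‿inverseʳ a) (sym (zeroʳ b)))
      iter (suc k) with iter k
      ... | u , u∈ , v′ , v′∈ , eq′ = w * u , *∈ w∈ u∈ , v * c ^ k * u + v′ ,
        +∈ (*∈ (*∈ v∈ (^∈ k c∈)) u∈) v′∈ ,
        (begin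
          a - a * (c * c ^ k) * (w * u)
            ≈⟨ solve 5 (λ a c x w u → a :- a :* (c :* x) :* (w :* u)
                 := (a :- a :* c :* w) :* (x :* u) :+ (a :- a :* x :* u)) refl a c (c ^ k) w u ⟩
          (a - a * c * w) * (c ^ k * u) + (a - a * c ^ k * u)
            ≈⟨ +-cong (*-congʳ eq) eq′ ⟩
          b * v * (c ^ k * u) + b * v′
            ≈⟨ solve 5 (λ b v x u v′ → b :* v :* (x :* u) :+ b :* v′ := b :* (v :* x :* u :+ v′)) refl b v (c ^ k) u v′ ⟩
          b * (v * c ^ k * u + v′) ∎)
    ... | u , u∈ , v′ , v′∈ , eq′ = a * u + v′ , +∈ (*∈ a∈ u∈) v′∈ , (begin
      a                                   ≈⟨ solve 2 (λ a y → a := y :+ (a :- y)) refl a (a * c ^ k * u) ⟩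
      a * c ^ k * u + (a - a * c ^ k * u) ≈⟨ +-congˡ (trans eq′ (*-congʳ b≈)) ⟩
      a * c ^ k * u + c ^ k * v′          ≈⟨ solve 4 (λ a x u v → a :* x :* u :+ x :* v := x :* (a :* u :+ v)) refl a (c ^ k) u v′ ⟩
      c ^ k * (a * u + v′) ∎)

    module Span (N : ℕ) where

      Span : Carrier → Set _
      Span x = ∃ λ (f : ℕ → ℤ) → x ≈ Σ< N (λ t → ι (f t) * z ^ t)

      span-≈ : ∀ {x y} → x ≈ y → Span x → Span y
      span-≈ x≈y (f , eq) = f , trans (sym x≈y) eq

      span-+ : ∀ {x y} → Span x → Span y → Span (x + y)
      span-+ (f , eq) (g , eq′) = (λ t → f t ℤ.+ g t) ,
        trans (+-cong eq eq′) (trans (sym (Σ<-distrib N _ _))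
          (Σ<-cong′ N (λ t → trans (sym (distribʳ (z ^ t) _ _)) (*-congʳ (sym (ι-+ (f t) (g t)))))))

      span-ι : ∀ {x} k → Span x → Span (ι k * x)
      span-ι k (f , eq) = (λ t → k ℤ.* f t) ,
        trans (*-congˡ eq) (trans (Σ<-*ˡ N (ι k) _)
          (Σ<-cong′ N (λ t → trans (sym (*-assoc _ _ _)) (*-congʳ (sym (ι-* k (f t)))))))

      span-0 : Span 0#
      span-0 = (λ _ → 0ℤ) , sym (Σ<-zero N (λ k _ → zeroˡ _))

      span-Σ< : ∀ P {g : ℕ → Carrier} → (∀ t → t < P → Span (g t)) → Span (Σ< P g)
      span-Σ< zero    _ = span-0
      span-Σ< (suc P) h = span-+ (h 0 (s≤s z≤n)) (span-Σ< P (λ t t<P → h (suc t) (s≤s t<P)))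

      span-^ : ∀ t → t < N → Span (z ^ t)
      span-^ t t<N = δ t , sym (trans
        (Σ<-single N t _ t<N (λ k _ k≢t → trans (*-congʳ (ι-≡ (δ-≢ (λ t≡k → k≢t (≡.sym t≡k))))) (zeroˡ _)))
        (trans (*-congʳ (trans (ι-≡ (δ-refl t)) ι-1)) (*-identityˡ _)))

      module _ (0<N : 0 < N) (zᴺ : Span (z ^ N)) where

        span-z* : ∀ {x} → Span x → Span (z * x)
        span-z* {x} (f , eq) = span-≈ (sym (begin
          z * x                                 ≈⟨ *-congˡ eq ⟩
          z * Σ< N (λ t → ι (f t) * z ^ t)      ≈⟨ Σ<-*ˡ N z _ ⟩
          Σ< N (λ t → z * (ι (f t) * z ^ t))
            ≈⟨ Σ<-cong′ N (λ t → solve 3 (λ z a b → z :* (a :* b) := a :* (z :* b)) refl z (ι (f t)) (z ^ t)) ⟩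
          Σ< N (λ t → ι (f t) * (z * z ^ t))    ∎))
          (span-Σ< N (λ t t<N → span-ι (f t) (next t t<N)))
          where
          next : ∀ t → t < N → Span (z ^ suc t)
          next t t<N with ℕ.m≤n⇒m<n∨m≡n t<N
          ... | inj₁ t+1<N = span-^ (suc t) t+1<N
          ... | inj₂ ≡.refl = zᴺ

        span-z^* : ∀ t {x} → Span x → Span (z ^ t * x)
        span-z^* zero    sx = span-≈ (sym (*-identityˡ _)) sx
        span-z^* (suc t) sx = span-≈ (sym (*-assoc _ _ _)) (span-z* (span-z^* t sx))

        span-* : ∀ {x y} → Span x → Span y → Span (x * y)
        span-* {x} {y} (f , eq) sy = span-≈ (sym (begin
          x * y                                ≈⟨ *-congʳ eq ⟩
          Σ< N (λ t → ι (f t) * z ^ t) * y     ≈⟨ Σ<-*ʳ N y _ ⟩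
          Σ< N (λ t → ι (f t) * z ^ t * y)     ≈⟨ Σ<-cong′ N (λ t → *-assoc _ _ _) ⟩
          Σ< N (λ t → ι (f t) * (z ^ t * y))   ∎))
          (span-Σ< N (λ t _ → span-ι (f t) (span-z^* t sy)))

        span-1 : Span 1#
        span-1 = span-^ 0 0<N

        -- With zᴺ in the span, the span is stable under multiplication by z, hence under products;
        -- it is then a subring containing z.
        spans : ∀ {x} → S x → Span x
        spans generator   = span-≈ (*-identityʳ z) (span-z* span-1)
        spans zero∈       = span-0
        spans one∈        = span-1
        spans (+∈ x∈ y∈)  = span-+ (spans x∈) (spans y∈)
        spans (*∈ x∈ y∈)  = span-* (spans x∈) (spans y∈)
        spans (-∈ {x = x} x∈) = span-≈
          (trans (*-congʳ (trans (ι-neg 1ℤ) (-‿cong ι-1)))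
             (trans (solve 2 (λ e x → (:- e) :* x := :- (e :* x)) refl 1# x) (-‿cong (*-identityˡ x))))
          (span-ι (ℤ.- 1ℤ) (spans x∈))
        spans (≈∈ x≈y x∈) = span-≈ x≈y (spans x∈)

-- Binomial expansions modulo p and Nakayama's lemma

module PrimePowerRoots {c ℓ} (R : CommutativeRing c ℓ) {p : ℕ} (p-prime : Prime p) where

  open CommutativeRing R hiding (zero)
  open PrimeArithmetic p-prime
  open import Data.Nat.Combinatorics using (_C_)
  open IntegerEmbedding R
  open CyclotomicIntegers R
  open import Algebra.Properties.Semiring.Exp semiring using (_^_; ^-assocʳ; ^-congˡ; ^-congʳ)
  open import Algebra.Properties.Semiring.Mult semiring
    using () renaming (_×_ to _×ₙ_; ×-assoc-* to ×ₙ-assoc-*)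
  open import Algebra.Properties.CommutativeSemiring.Binomial commutativeSemiring
    using () renaming (theorem to binomial-theorem)
  open import Relation.Binary.Reasoning.Setoid setoid

  P : Carrier
  P = ι (+ p)

  ×ₙ≈ι* : ∀ k x → k ×ₙ x ≈ ι (+ k) * x
  ×ₙ≈ι* k x = sym (trans (×ₙ-assoc-* k 1# x) (*-identityʳ′ k))
    where
    *-identityʳ′ : ∀ k → k ×ₙ (1# * x) ≈ k ×ₙ x
    *-identityʳ′ zero    = refl
    *-identityʳ′ (suc k) = +-cong (*-identityˡ x) (*-identityʳ′ k)

  module _ (z : Carrier) where

    private
      _∣ᶻ_ : Carrier → Carrier → Set _
      _∣ᶻ_ = _∣S_ z

    -- The length r + 3 lets the first two terms split off by computation. `freshman` reaches this
    -- form by matching on a copy q of the fixed prime, with r = p - 2.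
    Σ<-outer-terms : ∀ {X a b c} r (t : ℕ → Carrier) → t 0 ≈ a → t 1 ≈ b → t (suc (suc r)) ≈ c →
      (∀ k → suc (suc k) < suc (suc r) → X ∣ᶻ t (suc (suc k))) →
      ∃ λ w → S z w × Σ< (suc (suc (suc r))) t ≈ a + b + X * w + c
    Σ<-outer-terms {X} {a} {b} {c} r t t₀ t₁ tₗ X∣t
      with ∣S-Σ< z r {λ k → t (suc (suc k))} (λ k k<r → X∣t k (s≤s (s≤s k<r)))
    ... | w , w∈ , eq = w , w∈ ,
      trans (+-cong t₀ (+-cong t₁ (trans (Σ<-last r (λ k → t (suc (suc k)))) (+-cong eq tₗ))))
        (solve 4 (λ a b c d → a :+ (b :+ (c :+ d)) := a :+ b :+ c :+ d) refl a b (X * w) c)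

    binomial-term : Carrier → ℕ → Carrier
    binomial-term x k = (p C k) ×ₙ (x ^ k * 1# ^ (p ∸ k))

    binomial-term≈ : ∀ x k → binomial-term x k ≈ ι (+ (p C k)) * x ^ k
    binomial-term≈ x k = trans (×ₙ≈ι* (p C k) _) (*-congˡ (trans (*-congˡ (1^ (p ∸ k))) (*-identityʳ _)))

    -- The terms with 2 ≤ k < p have binomials divisible by p and powers divisible by x². The linear
    -- term is kept apart because, after division by x, it becomes P itself.
    Freshman : Carrier → Set _
    Freshman x = ∃ λ w → S z w × (1# + x) ^ p ≈ 1# + P * x + P * x * x * w + x ^ p

    freshman : ∀ {x} → S z x → Freshman x
    freshman {x} x∈ = map₂ (map₂ (trans expand)) (outer p ≡.refl prime>1)
      where
      term = binomial-term x
      term≈ = binomial-term≈ x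

      expand : (1# + x) ^ p ≈ Σ< (suc p) term
      expand = trans (^-congˡ p (+-comm 1# x))
        (trans (binomial-theorem p x 1#) (reflexive (sum≡Σ< (suc p) term)))

      middle : ∀ k → suc (suc k) < p → (P * x * x) ∣ᶻ term (suc (suc k))
      middle k k<p with prime∣C (suc k) k<p
      ... | ℕ∣.divides q eq = ι (+ q) * x ^ k , *∈ (ι∈ z (+ q)) (^∈ z k x∈) , (begin
        term (suc (suc k))                      ≈⟨ term≈ (suc (suc k)) ⟩
        ι (+ (p C suc (suc k))) * x ^ suc (suc k)
          ≈⟨ *-congʳ (trans (ι-≡ (≡.trans (≡.cong +_ eq) (ℤ.pos-* q p))) (ι-* (+ q) (+ p))) ⟩
        ι (+ q) * P * (x * (x * x ^ k))
          ≈⟨ solve 4 (λ q p x y → q :* p :* (x :* (x :* y)) := p :* x :* x :* (q :* y)) refl (ι (+ q)) P x (x ^ k) ⟩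
        P * x * x * (ι (+ q) * x ^ k) ∎)

      term₀ : term 0 ≈ 1#
      term₀ = trans (term≈ 0) (trans (*-identityʳ _) ι-1)

      term₁ : term 1 ≈ P * x
      term₁ = trans (term≈ 1) (*-cong (ι-≡ (≡.cong +_ (nC1≡n p))) (*-identityʳ x))

      termₚ : term p ≈ x ^ p
      termₚ = trans (term≈ p) (trans (*-congʳ (trans (ι-≡ (≡.cong +_ (nCn≡1 p))) ι-1)) (*-identityˡ _))

      outer : ∀ q → q ≡ p → 1 < q → ∃ λ w → S z w × Σ< (suc p) term ≈ 1# + P * x + P * x * x * w + x ^ p
      outer (suc zero) _ (s≤s ())
      outer (suc (suc r)) q≡p _ =
        ≡.subst (λ q → ∃ λ w → S z w × Σ< (suc q) term ≈ 1# + P * x + P * x * x * w + x ^ p) q≡p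
          (Σ<-outer-terms r term term₀ term₁ (trans (reflexive (≡.cong term q≡p)) termₚ)
            (λ k k<q → middle k (ℕ.≤-trans k<q (ℕ.≤-reflexive q≡p))))

    ^-perturb : ∀ {a b} k → S z a → S z b → ∃ λ w → S z w × (a + b) ^ k ≈ a ^ k + b * w
    ^-perturb zero a∈ b∈ = 0# , zero∈ , sym (trans (+-congˡ (zeroʳ _)) (+-identityʳ _))
    ^-perturb {a} {b} (suc k) a∈ b∈ with ^-perturb k a∈ b∈
    ... | w , w∈ , eq = a * w + a ^ k + b * w , +∈ (+∈ (*∈ a∈ w∈) (^∈ z k a∈)) (*∈ b∈ w∈) ,
      trans (*-congˡ eq)
        (solve 4 (λ a b x w → (a :+ b) :* (x :+ b :* w) := a :* x :+ b :* (a :* w :+ x :+ b :* w)) refl a b (a ^ k) w)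

    -- The factor x in the error term matters: for p = 2 an error term P * w would be too weak in π^q∣ν.
    IteratedFreshman : ℕ → Carrier → Set _
    IteratedFreshman k x = ∃ λ w → S z w × (1# + x) ^ (p ℕ.^ k) ≈ 1# + x ^ (p ℕ.^ k) + P * x * w

    iterated-freshman : ∀ {x} k → S z x → IteratedFreshman k x
    iterated-freshman {x} zero x∈ = 0# , zero∈ , (begin
      (1# + x) * 1#               ≈⟨ *-identityʳ _ ⟩
      1# + x                      ≈⟨ +-congˡ (*-identityʳ x) ⟨
      1# + x * 1#                 ≈⟨ +-identityʳ _ ⟨
      1# + x * 1# + 0#            ≈⟨ +-congˡ (zeroʳ _) ⟨
      1# + x * 1# + P * x * 0#    ∎)
    iterated-freshman {x} (suc k) x∈
      with iterated-freshman k x∈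
    ... | w , w∈ , eq = result
      where
      Q = p ℕ.^ k
      Q≢0 : ℕ.NonZero Q
      Q≢0 = ℕ.m^n≢0 p k {{ℕ.>-nonZero (ℕ.<-trans (s≤s z≤n) prime>1)}}
      -- Since p^k is positive, x divides y, with quotient y′. Taking this x out of P y and P y²
      -- preserves the factor x in the error term.
      y′ y : Carrier
      y′ = x ^ ℕ.pred Q + P * w
      y  = x ^ Q + P * x * w
      y∈ : S z y
      y∈ = +∈ (^∈ z Q x∈) (*∈ (*∈ (ι∈ z (+ p)) x∈) w∈)
      y′∈ : S z y′
      y′∈ = +∈ (^∈ z (ℕ.pred Q) x∈) (*∈ (ι∈ z (+ p)) w∈)
      y≈ : y ≈ x * y′
      y≈ = trans (+-congʳ (^-congʳ x (≡.sym (ℕ.suc-pred Q {{Q≢0}}))))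
        (solve 4 (λ x a p w → x :* a :+ p :* x :* w := x :* (a :+ p :* w)) refl x (x ^ ℕ.pred Q) P w)

      result : ∃ λ w → S z w × (1# + x) ^ (p ℕ.* Q) ≈ 1# + x ^ (p ℕ.* Q) + P * x * w
      result with freshman y∈ | ^-perturb {x ^ Q} {P * x * w} p (^∈ z (Q) x∈) (*∈ (*∈ (ι∈ z (+ p)) x∈) w∈)
      ... | v , v∈ , eq₁ | u , u∈ , eq₂ = y′ + y′ * y * v + w * u ,
        +∈ (+∈ y′∈ (*∈ (*∈ y′∈ y∈) v∈)) (*∈ w∈ u∈) , (begin
        (1# + x) ^ (p ℕ.* Q)              ≡⟨ ≡.cong ((1# + x) ^_) (ℕ.*-comm p (Q)) ⟩
        (1# + x) ^ (Q ℕ.* p)              ≈⟨ ^-assocʳ (1# + x) (Q) p ⟨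
        ((1# + x) ^ Q) ^ p                ≈⟨ ^-congˡ p (trans eq (+-assoc _ _ _)) ⟩
        (1# + y) ^ p                          ≈⟨ eq₁ ⟩
        1# + P * y + P * y * y * v + y ^ p
          ≈⟨ +-cong (+-cong (+-congˡ (*-congˡ y≈)) (*-congʳ (*-congʳ (*-congˡ y≈)))) eq₂ ⟩
        1# + P * (x * y′) + P * (x * y′) * y * v + ((x ^ Q) ^ p + P * x * w * u)
          ≈⟨ solve 9 (λ e p x y′ y v X w u → e :+ p :* (x :* y′) :+ p :* (x :* y′) :* y :* v :+ (X :+ p :* x :* w :* u)
               := e :+ X :+ p :* x :* (y′ :+ y′ :* y :* v :+ w :* u)) refl 1# P x y′ y v ((x ^ Q) ^ p) w u ⟩
        1# + (x ^ Q) ^ p + P * x * (y′ + y′ * y * v + w * u)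
          ≈⟨ +-congʳ (+-congˡ (trans (^-assocʳ x (Q) p) (^-congʳ x (ℕ.*-comm (Q) p)))) ⟩
        1# + x ^ (p ℕ.* Q) + P * x * (y′ + y′ * y * v + w * u) ∎)

  -- Eliminating one generator at a time avoids determinants.
  nakayama : ∀ N (e : ℕ → Carrier) (B : ℕ → ℕ → ℤ) →
             (∀ i → i < N → e i ≈ P * Σ< N (λ j → ι (B i j) * e j)) →
             ∃ λ d → ∀ i → i < N → ι (1ℤ ℤ.+ + p ℤ.* d) * e i ≈ 0#
  nakayama zero    e B rel = 0ℤ , λ _ ()
  nakayama (suc N) e B rel = extend (nakayama N e′ B′ rel′)
    where
    b = B 0 0
    e′ : ℕ → Carrier
    e′ i = e (suc i)
    s : ℕ → Carrier
    s i = Σ< N (λ j → ι (B i (suc j)) * e′ j)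
    -- Relation 0 reads (1 - P b) e₀ = P s₀, so multiplying relation i + 1 by 1 - P b eliminates e₀.
    -- Moving P b e_{i+1} to the right restores the coefficient 1 of e_{i+1} on the left; this is
    -- the summand with δ.
    B′ : ℕ → ℕ → ℤ
    B′ i j = b ℤ.* δ i j ℤ.+ + p ℤ.* B (suc i) 0 ℤ.* B 0 (suc j) ℤ.+ (1ℤ ℤ.- + p ℤ.* b) ℤ.* B (suc i) (suc j)

    ι-1-pb : ι (1ℤ ℤ.- + p ℤ.* b) ≈ 1# - P * ι b
    ι-1-pb = trans (ι-+ 1ℤ (ℤ.- (+ p ℤ.* b))) (+-cong ι-1 (trans (ι-neg (+ p ℤ.* b)) (-‿cong (ι-* (+ p) b))))

    head-rel : (1# - P * ι b) * e 0 ≈ P * s 0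
    head-rel = begin
      (1# - P * ι b) * e 0          ≈⟨ solve 4 (λ u p b e → (u :- p :* b) :* e := u :* e :- p :* (b :* e)) refl 1# P (ι b) (e 0) ⟩
      1# * e 0 - P * (ι b * e 0)    ≈⟨ +-congʳ (trans (*-identityˡ _) (rel 0 (s≤s z≤n))) ⟩
      P * (ι b * e 0 + s 0) - P * (ι b * e 0)
        ≈⟨ solve 3 (λ p x s → p :* (x :+ s) :- p :* x := p :* s) refl P (ι b * e 0) (s 0) ⟩
      P * s 0 ∎

    Σδ : ∀ i → i < N → Σ< N (λ j → ι (δ i j) * e′ j) ≈ e′ i
    Σδ i i<N = trans
      (Σ<-single N i _ i<N (λ k _ k≢i → trans (*-congʳ (ι-≡ (δ-≢ (λ i≡k → k≢i (≡.sym i≡k))))) (zeroˡ _)))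
      (trans (*-congʳ (trans (ι-≡ (δ-refl i)) ι-1)) (*-identityˡ _))

    ΣB′ : ∀ i → i < N → Σ< N (λ j → ι (B′ i j) * e′ j)
                          ≈ ι b * e′ i + P * ι (B (suc i) 0) * s 0 + (1# - P * ι b) * s (suc i)
    ΣB′ i i<N = begin
      Σ< N (λ j → ι (B′ i j) * e′ j)
        ≈⟨ Σ<-cong′ N (λ j → trans (*-congʳ (split j))
             (solve 7 (λ b d p c f g e → (b :* d :+ p :* c :* f :+ g) :* e := b :* (d :* e) :+ p :* c :* (f :* e) :+ g :* e) refl
                (ι b) (ι (δ i j)) P (ι (B (suc i) 0)) (ι (B 0 (suc j))) ((1# - P * ι b) * ι (B (suc i) (suc j))) (e′ j))) ⟩
      Σ< N (λ j → ι b * (ι (δ i j) * e′ j) + P * ι (B (suc i) 0) * (ι (B 0 (suc j)) * e′ j)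
                  + (1# - P * ι b) * ι (B (suc i) (suc j)) * e′ j)
        ≈⟨ trans (Σ<-distrib N _ _) (+-congʳ (Σ<-distrib N _ _)) ⟩
      Σ< N (λ j → ι b * (ι (δ i j) * e′ j)) + Σ< N (λ j → P * ι (B (suc i) 0) * (ι (B 0 (suc j)) * e′ j))
        + Σ< N (λ j → (1# - P * ι b) * ι (B (suc i) (suc j)) * e′ j)
        ≈⟨ +-cong (+-cong (sym (Σ<-*ˡ N _ _)) (sym (Σ<-*ˡ N _ _)))
                  (trans (Σ<-cong′ N (λ j → *-assoc _ _ _)) (sym (Σ<-*ˡ N _ _))) ⟩
      ι b * Σ< N (λ j → ι (δ i j) * e′ j) + P * ι (B (suc i) 0) * s 0 + (1# - P * ι b) * s (suc i)
        ≈⟨ +-congʳ (+-congʳ (*-congˡ (Σδ i i<N))) ⟩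
      ι b * e′ i + P * ι (B (suc i) 0) * s 0 + (1# - P * ι b) * s (suc i) ∎
      where
      split : ∀ j → ι (B′ i j) ≈ ι b * ι (δ i j) + P * ι (B (suc i) 0) * ι (B 0 (suc j))
                                 + (1# - P * ι b) * ι (B (suc i) (suc j))
      split j = trans (ι-+ (b ℤ.* δ i j ℤ.+ + p ℤ.* B (suc i) 0 ℤ.* B 0 (suc j)) (k ℤ.* B (suc i) (suc j))) (+-cong
        (trans (ι-+ (b ℤ.* δ i j) (+ p ℤ.* B (suc i) 0 ℤ.* B 0 (suc j))) (+-cong (ι-* b (δ i j))
           (trans (ι-* (+ p ℤ.* B (suc i) 0) (B 0 (suc j))) (*-congʳ (ι-* (+ p) (B (suc i) 0))))))
        (trans (ι-* k (B (suc i) (suc j))) (*-congʳ ι-1-pb)))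
        where k = 1ℤ ℤ.- + p ℤ.* b

    rel′ : ∀ i → i < N → e′ i ≈ P * Σ< N (λ j → ι (B′ i j) * e′ j)
    rel′ i i<N = sym (begin
      P * Σ< N (λ j → ι (B′ i j) * e′ j)
        ≈⟨ *-congˡ (ΣB′ i i<N) ⟩
      P * (ι b * e′ i + P * c₀ * s 0 + (1# - P * ι b) * s (suc i))
        ≈⟨ solve 7 (λ p b e c s u t → p :* (b :* e :+ p :* c :* s :+ (u :- p :* b) :* t)
                    := p :* b :* e :+ p :* c :* (p :* s) :+ (u :- p :* b) :* (p :* t)) refl
             P (ι b) (e′ i) c₀ (s 0) 1# (s (suc i)) ⟩
      P * ι b * e′ i + P * c₀ * (P * s 0) + (1# - P * ι b) * (P * s (suc i))
        ≈⟨ +-congʳ (+-congˡ (*-congˡ head-rel)) ⟨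
      P * ι b * e′ i + P * c₀ * ((1# - P * ι b) * e 0) + (1# - P * ι b) * (P * s (suc i))
        ≈⟨ solve 7 (λ p b e c f u t → p :* b :* e :+ p :* c :* ((u :- p :* b) :* f) :+ (u :- p :* b) :* (p :* t)
                    := p :* b :* e :+ (u :- p :* b) :* (p :* (c :* f :+ t))) refl
             P (ι b) (e′ i) c₀ (e 0) 1# (s (suc i)) ⟩
      P * ι b * e′ i + (1# - P * ι b) * (P * (c₀ * e 0 + s (suc i)))
        ≈⟨ +-congˡ (*-congˡ (rel (suc i) (s≤s i<N))) ⟨
      P * ι b * e′ i + (1# - P * ι b) * e′ i
        ≈⟨ solve 3 (λ x e u → x :* e :+ (u :- x) :* e := u :* e) refl (P * ι b) (e′ i) 1# ⟩
      1# * e′ i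
        ≈⟨ *-identityˡ _ ⟩
      e′ i ∎)
      where c₀ = ι (B (suc i) 0)

    extend : (∃ λ d → ∀ i → i < N → ι (1ℤ ℤ.+ + p ℤ.* d) * e′ i ≈ 0#) →
             ∃ λ d → ∀ i → i < suc N → ι (1ℤ ℤ.+ + p ℤ.* d) * e i ≈ 0#
    extend (d , kills) = d′ , λ
      { zero    _         → trans (*-congʳ ι-d′) (begin
          D * (1# - P * ι b) * e 0           ≈⟨ *-assoc _ _ _ ⟩
          D * ((1# - P * ι b) * e 0)         ≈⟨ *-congˡ head-rel ⟩
          D * (P * s 0)                      ≈⟨ solve 3 (λ d p s → d :* (p :* s) := p :* (d :* s)) refl D P (s 0) ⟩
          P * (D * s 0)                      ≈⟨ *-congˡ (Σ<-*ˡ N D _) ⟩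
          P * Σ< N (λ j → D * (ι (B 0 (suc j)) * e′ j))
            ≈⟨ *-congˡ (Σ<-zero N (λ j j<N →
                 trans (solve 3 (λ d c e → d :* (c :* e) := c :* (d :* e)) refl D (ι (B 0 (suc j))) (e′ j))
                       (trans (*-congˡ (kills j j<N)) (zeroʳ _)))) ⟩
          P * 0#                             ≈⟨ zeroʳ P ⟩
          0# ∎)
      ; (suc i) (s≤s i<N) → trans (*-congʳ ι-d′)
          (trans (solve 3 (λ d u e → d :* u :* e := u :* (d :* e)) refl D (1# - P * ι b) (e′ i))
                 (trans (*-congˡ (kills i i<N)) (zeroʳ _))) }
      where
      D = ι (1ℤ ℤ.+ + p ℤ.* d)
      d′ = d ℤ.- b ℤ.- + p ℤ.* d ℤ.* b
      expand : ∀ p d b → 1ℤ ℤ.+ p ℤ.* (d ℤ.- b ℤ.- p ℤ.* d ℤ.* b) ≡ (1ℤ ℤ.+ p ℤ.* d) ℤ.* (1ℤ ℤ.- p ℤ.* b)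
      expand = ℤ-solve 3 (λ p d b → ℤ-con 1ℤ ℤ:+ p ℤ:* (d ℤ:- b ℤ:- p ℤ:* d ℤ:* b) ℤ:= (ℤ-con 1ℤ ℤ:+ p ℤ:* d) ℤ:* (ℤ-con 1ℤ ℤ:- p ℤ:* b)) ≡.refl
      ι-d′ : ι (1ℤ ℤ.+ + p ℤ.* d′) ≈ D * (1# - P * ι b)
      ι-d′ = trans (ι-≡ {1ℤ ℤ.+ + p ℤ.* d′} {(1ℤ ℤ.+ + p ℤ.* d) ℤ.* (1ℤ ℤ.- + p ℤ.* b)} (expand (+ p) d b)) (trans (ι-* (1ℤ ℤ.+ + p ℤ.* d) (1ℤ ℤ.- + p ℤ.* b)) (*-congˡ ι-1-pb))

-- Σ f_t zᵗ - Σ f_t = (z - 1) Σ g_t zᵗ where g_t is the sum of the f_s with s > t: the suffix sums of the tail of f.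
suffix-sum : ℕ → (ℕ → ℤ) → ℕ → ℤ
suffix-sum N f t = Σℤ (N ∸ t) (λ s → f (t ℕ.+ s))

-- Linear independence of the powers of a root of unity of prime power order

module Cyclotomic {c ℓ} (R : CommutativeRing c ℓ) (char0 : CharacteristicZero R)
  (domain : ∀ {a x} → ¬ CommutativeRing._≈_ R a (CommutativeRing.0# R) →
            CommutativeRing._≈_ R (CommutativeRing._*_ R a x) (CommutativeRing.0# R) →
            CommutativeRing._≈_ R x (CommutativeRing.0# R))
  {p : ℕ} (p-prime : Prime p) where

  open CommutativeRing R hiding (zero)
  open PrimeArithmetic p-prime
  open IntegerEmbedding R
  open CyclotomicIntegers R
  open PrimePowerRoots R p-prime
  open import Algebra.Properties.Semiring.Exp semiring using (_^_; ^-assocʳ; ^-congˡ; ^-congʳ)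
  open import Algebra.Properties.Ring ring using (-‿involutive; -0#≈0#)
  open import Relation.Binary.Reasoning.Setoid setoid

  private
    0<p : 0 < p
    0<p = ℕ.<-trans (s≤s z≤n) prime>1

    instance
      p-nonZero : ℕ.NonZero p
      p-nonZero = ℕ.>-nonZero 0<p

    suc-p₁ : suc (p ∸ 1) ≡ p
    suc-p₁ = ℕ.suc-pred p

  ι-injective₀ : ∀ {x} → ι x ≈ 0# → x ≡ 0ℤ
  ι-injective₀ {+ zero}    _ = ≡.refl
  ι-injective₀ {+ suc k}   eq = contradiction eq (char0 (suc k) (s≤s z≤n))
  ι-injective₀ { -[1+ k ]} eq = contradiction (trans (sym (-‿involutive _)) (trans (-‿cong eq) -0#≈0#))
                                  (char0 (suc k) (s≤s z≤n))

  ι≉0 : ∀ k → 0 < k → ¬ ι (+ k) ≈ 0#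
  ι≉0 k 0<k = char0 k 0<k

  ev-suc : ∀ N f z → ev (suc N) f z ≈ ι (f 0) + z * ev N (λ t → f (suc t)) z
  ev-suc N f z = +-cong (*-identityʳ _)
    (trans (Σ<-cong′ N (λ t → solve 3 (λ a z b → a :* (z :* b) := z :* (a :* b)) refl _ z (z ^ t)))
           (sym (Σ<-*ˡ N z _)))

  -- With f = f₀ + z g and z = 1 + (z - 1), the induction hypothesis for g enters twice, once for g
  -- and once for (z - 1) g.
  synthetic-division : ∀ N f z →
    ev (suc N) f z ≈ ι (Σℤ (suc N) f) + (z - 1#) * ev N (suffix-sum N (λ t → f (suc t))) z
  synthetic-division zero f z = begin
    ι (f 0) * 1# + 0#               ≈⟨ +-cong (*-identityʳ _) (sym (zeroʳ _)) ⟩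
    ι (f 0) + (z - 1#) * 0#         ≈⟨ +-congʳ (ι-≡ (≡.sym (ℤ.+-identityʳ (f 0)))) ⟩
    ι (f 0 ℤ.+ 0ℤ) + (z - 1#) * 0#  ∎
  synthetic-division (suc N) f z = begin
    ev (suc (suc N)) f z
      ≈⟨ ev-suc (suc N) f z ⟩
    ι (f 0) + z * ev (suc N) g z
      ≈⟨ solve 4 (λ a z e u → a :+ z :* e := a :+ u :* e :+ (z :- u) :* e) refl _ z _ 1# ⟩
    ι (f 0) + 1# * ev (suc N) g z + (z - 1#) * ev (suc N) g z
      ≈⟨ +-cong (+-congˡ (trans (*-identityˡ _) (synthetic-division N g z))) (*-congˡ (synthetic-division N g z)) ⟩
    ι (f 0) + (s + (z - 1#) * E) + (z - 1#) * (s + (z - 1#) * E)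
      ≈⟨ solve 5 (λ a s z u E → a :+ (s :+ (z :- u) :* E) :+ (z :- u) :* (s :+ (z :- u) :* E)
            := (a :+ s) :+ (z :- u) :* (s :+ (z :- u) :* E :+ E)) refl (ι (f 0)) s z 1# E ⟩
    (ι (f 0) + s) + (z - 1#) * (s + (z - 1#) * E + E)
      ≈⟨ +-cong (sym (ι-+ (f 0) _)) (*-congˡ (begin
           s + (z - 1#) * E + E    ≈⟨ solve 4 (λ s z u E → s :+ (z :- u) :* E :+ E := s :+ (z :* E :- u :* E :+ E)) refl s z 1# E ⟩
           s + (z * E - 1# * E + E) ≈⟨ +-congˡ (+-congʳ (+-congˡ (-‿cong (*-identityˡ E)))) ⟩
           s + (z * E - E + E)     ≈⟨ +-congˡ (solve 2 (λ a E → a :- E :+ E := a) refl (z * E) E) ⟩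
           s + z * E               ≈⟨ ev-suc N (suffix-sum (suc N) g) z ⟨
           ev (suc N) (suffix-sum (suc N) g) z ∎)) ⟩
    ι (Σℤ (suc (suc N)) f) + (z - 1#) * ev (suc N) (suffix-sum (suc N) g) z ∎
    where
    g = λ t → f (suc t)
    s = ι (Σℤ (suc N) g)
    E = ev N (suffix-sum N (λ t → g (suc t))) z

  -- A coefficient is a difference of consecutive suffix sums. The total is a separate hypothesis
  -- because the quotient in `synthetic-division` contains only the later suffix sums.
  ∣-suffix-sums : ∀ {d} N f → d ∣± Σℤ N f → (∀ t → suc t < N → d ∣± suffix-sum N f (suc t)) →
                  ∀ t → t < N → d ∣± f t
  ∣-suffix-sums (suc N) f d∣Σ d∣s (suc t) (s≤s t<N) =
    ∣-suffix-sums N (λ t → f (suc t)) (d∣tail N t<N d∣s) (λ t t<N → d∣s (suc t) (s≤s t<N)) t t<N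
    where
    d∣tail : ∀ {d} N → t < N → (∀ t → suc t < suc N → d ∣± suffix-sum (suc N) f (suc t)) →
             d ∣± Σℤ N (λ t → f (suc t))
    d∣tail (suc N) _ d∣s = d∣s 0 (s≤s (s≤s z≤n))
  ∣-suffix-sums {d} (suc zero) f d∣Σ d∣s zero _ = ≡.subst (d ∣±_) (ℤ.+-identityʳ (f 0)) d∣Σ
  ∣-suffix-sums (suc (suc N)) f d∣Σ d∣s zero _ =
    ℤ∣.∣m+n∣n⇒∣m d∣Σ (d∣s 0 (s≤s (s≤s z≤n)))

  1+pd≉0 : ∀ d → ¬ ι (1ℤ ℤ.+ + p ℤ.* d) ≈ 0#
  1+pd≉0 d eq = prime∤1 (ℤ∣.∣⇒∣ᵤ (divides (ℤ.- d) 1≡-dp))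
    where
    rearrange : ∀ d p → 1ℤ ≡ (1ℤ ℤ.+ p ℤ.* d) ℤ.+ ℤ.- d ℤ.* p
    rearrange = ℤ-solve 2 (λ d p → ℤ-con 1ℤ ℤ:= (ℤ-con 1ℤ ℤ:+ p ℤ:* d) ℤ:+ (ℤ:- d) ℤ:* p) ≡.refl
    1≡-dp : 1ℤ ≡ ℤ.- d ℤ.* + p
    1≡-dp = ≡.trans (rearrange d (+ p)) (≡.trans (≡.cong (ℤ._+ ℤ.- d ℤ.* + p) (ι-injective₀ {1ℤ ℤ.+ + p ℤ.* d} eq)) (ℤ.+-identityˡ (ℤ.- d ℤ.* + p)))

  module _ (z : Carrier) where

    private
      _∣ᶻ_ : Carrier → Carrier → Set _
      _∣ᶻ_ = _∣S_ z

    -- If P w = 1, then zⁱ = P (w zⁱ), and w zⁱ is again a combination of 1, ..., z^(N-1).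
    -- Nakayama's lemma yields an integer 1 + p d that annihilates 1, against characteristic zero.
    p-nonunit : ∀ m → z ^ (p ℕ.^ m) ≈ 1# → ¬ P ∣ᶻ 1#
    p-nonunit m zᴺ≈1 (w , w∈ , 1≈Pw) = absurd relations
      where
      N = p ℕ.^ m
      0<N : 0 < N
      0<N = ℕ.m^n>0 p m
      open Span z N
      zᴺ : Span (z ^ N)
      zᴺ = span-≈ (sym zᴺ≈1) (span-^ 0 0<N)
      wzⁱ : ∀ i → Span (w * z ^ i)
      wzⁱ i = spans 0<N zᴺ (*∈ w∈ (^∈ z i generator))
      Relations : Set _
      Relations = ∃ λ d → ∀ i → i < N → ι (1ℤ ℤ.+ + p ℤ.* d) * z ^ i ≈ 0#
      relations : Relations
      relations = nakayama N (z ^_) (λ i → proj₁ (wzⁱ i)) (λ i _ → begin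
        z ^ i               ≈⟨ *-identityˡ _ ⟨
        1# * z ^ i          ≈⟨ *-congʳ 1≈Pw ⟩
        P * w * z ^ i       ≈⟨ *-assoc _ _ _ ⟩
        P * (w * z ^ i)     ≈⟨ *-congˡ (proj₂ (wzⁱ i)) ⟩
        P * Σ< N (λ j → ι (proj₁ (wzⁱ i) j) * z ^ j) ∎)
      absurd : ¬ Relations
      absurd (d , kills) = 1+pd≉0 d (trans (sym (*-identityʳ _)) (kills 0 0<N))

    module _ (k : ℕ) (zᴺ≈1 : z ^ (p ℕ.^ suc k) ≈ 1#) (z^q≉1 : ¬ z ^ (p ℕ.^ k) ≈ 1#) where

      private
        q = p ℕ.^ k
        p₁ = p ∸ 1
        π = z - 1#
        η = z ^ q
        ν = η - 1#

        π∈ : S z π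
        π∈ = +∈ generator (-∈ one∈)
        P∈ : S z P
        P∈ = ι∈ z (+ p)
        ν∈ : S z ν
        ν∈ = +∈ (^∈ z q generator) (-∈ one∈)

        x≈1+[x-1] : ∀ x → x ≈ 1# + (x - 1#)
        x≈1+[x-1] x = solve 2 (λ x e → x := e :+ (x :- e)) refl x 1#

        ηᵖ≈1 : η ^ p ≈ 1#
        ηᵖ≈1 = trans (^-assocʳ z q p) (trans (^-congʳ z (ℕ.*-comm q p)) zᴺ≈1)

        ν≉0 : ¬ ν ≈ 0#
        ν≉0 ν≈0 = z^q≉1 (trans (x≈1+[x-1] η) (trans (+-congˡ ν≈0) (+-identityʳ _)))

        π≉0 : ¬ π ≈ 0#
        π≉0 π≈0 = z^q≉1 (trans (^-congˡ q (trans (x≈1+[x-1] z) (trans (+-congˡ π≈0) (+-identityʳ _)))) (1^ q))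

      cyclotomic-relation : Σ< p (η ^_) ≈ 0#
      cyclotomic-relation = domain ν≉0 (trans (geometric p η) (trans (+-congʳ ηᵖ≈1) (-‿inverseʳ 1#)))

      private
        -- This serves only to carry non-invertibility from P over to π, for which the exponent is
        -- immaterial. The sharp exponent is needed in the opposite divisibility `π^D∣P`.
        P∣π^N : P ∣ᶻ (π ^ (p ℕ.^ suc k))
        P∣π^N = from (iterated-freshman z (suc k) π∈)
          where
          N = p ℕ.^ suc k
          from : IteratedFreshman z (suc k) π → P ∣ᶻ (π ^ N)
          from (w , w∈ , eq) = - (π * w) , -∈ (*∈ π∈ w∈) , (begin
            π ^ N                              ≈⟨ solve 3 (λ x e y → x := (e :+ x :+ y) :- (e :+ y)) refl (π ^ N) 1# (P * π * w) ⟩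
            (1# + π ^ N + P * π * w) - (1# + P * π * w)
              ≈⟨ +-congʳ (trans (sym eq) (trans (^-congˡ N (sym (x≈1+[x-1] z))) zᴺ≈1)) ⟩
            1# - (1# + P * π * w)
              ≈⟨ solve 4 (λ e p x w → e :- (e :+ p :* x :* w) := p :* (:- (x :* w))) refl 1# P π w ⟩
            P * - (π * w) ∎)

      π-nonunit : ¬ π ∣ᶻ 1#
      π-nonunit π∣1 = p-nonunit (suc k) zᴺ≈1
        (∣S-trans z P∣π^N (∣S-resp z (1^ (p ℕ.^ suc k)) (∣S-^ z (p ℕ.^ suc k) π∣1)))

      private
        -- Expanding (1 + ν)ᵖ = 1 and cancelling one factor ν leaves P + P ν w + ν^(p-1) = 0, which
        -- has the shape required by `∣S-bootstrap`.
        P≈Pν+ν^p₁ : ∃ λ w → S z w × (ν ^ p₁) ∣ᶻ (P - P * ν * w)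
        P≈Pν+ν^p₁ = from (freshman z ν∈)
          where
          module _ (w : Carrier) (eq : (1# + ν) ^ p ≈ 1# + P * ν + P * ν * ν * w + ν ^ p) where

            ν*≈0 : ν * (P + P * ν * w + ν ^ p₁) ≈ 0#
            ν*≈0 = begin
              ν * (P + P * ν * w + ν ^ p₁)
                ≈⟨ solve 5 (λ v p w y e → v :* (p :+ p :* v :* w :+ y)
                      := (e :+ p :* v :+ p :* v :* v :* w :+ v :* y) :- e) refl ν P w (ν ^ p₁) 1# ⟩
              (1# + P * ν + P * ν * ν * w + ν * ν ^ p₁) - 1#
                ≈⟨ +-congʳ (+-congˡ (^-congʳ ν suc-p₁)) ⟩
              (1# + P * ν + P * ν * ν * w + ν ^ p) - 1#
                ≈⟨ +-congʳ (trans (sym eq) (trans (^-congˡ p (sym (x≈1+[x-1] η))) ηᵖ≈1)) ⟩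
              1# - 1#
                ≈⟨ -‿inverseʳ 1# ⟩
              0# ∎

            remainder : P - P * ν * - w ≈ ν ^ p₁ * - 1#
            remainder = begin
              P - P * ν * - w
                ≈⟨ solve 4 (λ p v w y → p :- p :* v :* (:- w) := (p :+ p :* v :* w :+ y) :- y) refl P ν w (ν ^ p₁) ⟩
              (P + P * ν * w + ν ^ p₁) - ν ^ p₁
                ≈⟨ +-cong (domain ν≉0 ν*≈0) (-‿cong (sym (*-identityʳ _))) ⟩
              0# - ν ^ p₁ * 1#
                ≈⟨ +-identityˡ _ ⟩
              - (ν ^ p₁ * 1#)
                ≈⟨ solve 2 (λ x e → :- (x :* e) := x :* (:- e)) refl (ν ^ p₁) 1# ⟩
              ν ^ p₁ * - 1# ∎

          from : Freshman z ν → ∃ λ w → S z w × (ν ^ p₁) ∣ᶻ (P - P * ν * w)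
          from (w , w∈ , eq) = - w , -∈ w∈ , - 1# , -∈ one∈ , remainder w eq

        ν^p₁∣P : (ν ^ p₁) ∣ᶻ P
        ν^p₁∣P = ∣S-bootstrap z P∈ P≈Pν+ν^p₁ p₁ refl ν∈

        ν∣P : ν ∣ᶻ P
        ν∣P = ∣S-trans z (∣S-respˡ z (*-identityʳ ν) (^-∣S z 1 p₁ ν∈ (ℕ.∸-monoˡ-≤ 1 prime>1))) ν^p₁∣P

        -- The expansion of (1 + π)^q gives ν = π^q + P π w. Since ν divides P, the error term is a
        -- multiple of ν π, so `∣S-bootstrap` applies a second time.
        ν≈νπ+π^q : ∃ λ w → S z w × (π ^ q) ∣ᶻ (ν - ν * π * w)
        ν≈νπ+π^q = from (iterated-freshman z k π∈) ν∣P
          where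
          from : IteratedFreshman z k π → ν ∣ᶻ P → ∃ λ w → S z w × (π ^ q) ∣ᶻ (ν - ν * π * w)
          from (w , w∈ , eq) (t , t∈ , P≈νt) = t * w , *∈ t∈ w∈ , 1# , one∈ , (begin
            η - 1# - ν * π * (t * w)
              ≈⟨ +-congʳ (+-congʳ (trans (^-congˡ q (x≈1+[x-1] z)) eq)) ⟩
            1# + π ^ q + P * π * w - 1# - ν * π * (t * w)
              ≈⟨ +-congʳ (+-congʳ (+-congˡ (*-congʳ (*-congʳ P≈νt)))) ⟩
            1# + π ^ q + ν * t * π * w - 1# - ν * π * (t * w)
              ≈⟨ solve 6 (λ e y v t x w → e :+ y :+ v :* t :* x :* w :- e :- v :* x :* (t :* w) := y) refl 1# (π ^ q) ν t π w ⟩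
            π ^ q
              ≈⟨ *-identityʳ _ ⟨
            π ^ q * 1# ∎)

        π^q∣ν : (π ^ q) ∣ᶻ ν
        π^q∣ν = ∣S-bootstrap z ν∈ ν≈νπ+π^q q refl π∈

      π^D∣P : (π ^ (p₁ ℕ.* q)) ∣ᶻ P
      π^D∣P = ∣S-trans z (∣S-respˡ z (trans (^-assocʳ π q p₁) (^-congʳ π (ℕ.*-comm q p₁))) (∣S-^ z p₁ π^q∣ν)) ν^p₁∣P

      private
        D = p₁ ℕ.* q

        0<D : 0 < D
        0<D = ℕ.*-mono-≤ (ℕ.∸-monoˡ-≤ 1 prime>1) (ℕ.m^n>0 p k)

        π∣P : π ∣ᶻ P
        π∣P = ∣S-trans z (∣S-respˡ z (*-identityʳ π) (^-∣S z 1 D π∈ 0<D)) π^D∣P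

        π∣ι∣∣ : ∀ s → π ∣ᶻ ι s → π ∣ᶻ ι (+ ∣ s ∣)
        π∣ι∣∣ (+ _)      π∣s = π∣s
        π∣ι∣∣ (-[1+ k ]) π∣s = ∣S-resp z (-‿involutive _) (∣S-neg z π∣s)

        -- If p did not divide s, Bézout would write 1 as a combination of p and s, both divisible
        -- by the non-unit π.
        π∣ι⇒p∣ : ∀ s → π ∣ᶻ ι s → p ℕ∣.∣ ∣ s ∣
        π∣ι⇒p∣ s π∣s with p ℕ∣.∣? ∣ s ∣
        ... | yes p∣s = p∣s
        ... | no p∤s = contradiction (π∣1 (coprime-Bézout (∤⇒coprime p∤s))) π-nonunit
          where
          a = ∣ s ∣
          π∣* : ∀ x {y} → π ∣ᶻ ι (+ y) → π ∣ᶻ ι (+ (x ℕ.* y))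
          π∣* x {y} π∣y = ∣S-resp z
            (trans (*-comm _ _) (trans (sym (ι-* (+ x) (+ y))) (ι-≡ (≡.sym (ℤ.pos-* x y)))))
            (∣S-*ʳ z π∣y (ι∈ z (+ x)))
          difference : ∀ x y → 1 ℕ.+ x ≡ y → ι (+ y) - ι (+ x) ≈ 1#
          difference x y eq = trans (+-congʳ (trans (ι-≡ (≡.cong +_ (≡.sym eq))) (trans (ι-+ 1ℤ (+ x)) (+-congʳ ι-1))))
            (solve 2 (λ e x → e :+ x :- x := e) refl 1# (ι (+ x)))
          π∣1 : Bézout.Identity 1 p a → π ∣ᶻ 1#
          π∣1 (Bézout.+- x y eq) = ∣S-resp z (difference (y ℕ.* a) (x ℕ.* p) eq)
            (∣S-+ z (π∣* x π∣P) (∣S-neg z (π∣* y (π∣ι∣∣ s π∣s))))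
          π∣1 (Bézout.-+ x y eq) = ∣S-resp z (difference (x ℕ.* p) (y ℕ.* a) eq)
            (∣S-+ z (π∣* y (π∣ι∣∣ s π∣s)) (∣S-neg z (π∣* x π∣P)))

        -- Division by z - 1 leaves the coefficient sum s as remainder, so π divides s and therefore
        -- p does. As N ≤ D, the divisor π^D of p makes s divisible by the full power of π;
        -- cancelling one π, the quotient is divisible by the next lower power and induction applies
        -- to it.
        p∣coefficients : ∀ N → N ≤ D → ∀ f → (π ^ N) ∣ᶻ ev N f z → ∀ t → t < N → + p ∣± f t
        p∣coefficients (suc N) N<D f (w , w∈ , eq) t t<N =
          ∣-suffix-sums (suc N) f p∣s (λ t t<N → p∣coefficients N (ℕ.<⇒≤ N<D) g π^N∣g t (ℕ.s≤s⁻¹ t<N)) t t<N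
          where
          g = suffix-sum N (λ t → f (suc t))
          s = Σℤ (suc N) f
          ιs≈ : ι s ≈ π * (π ^ N * w - ev N g z)
          ιs≈ = begin
            ι s                                     ≈⟨ solve 2 (λ s y → s := s :+ y :- y) refl (ι s) (π * ev N g z) ⟩
            ι s + π * ev N g z - π * ev N g z       ≈⟨ +-congʳ (trans (sym (synthetic-division N f z)) eq) ⟩
            π * π ^ N * w - π * ev N g z            ≈⟨ solve 4 (λ x y w g → x :* y :* w :- x :* g := x :* (y :* w :- g)) refl π (π ^ N) w (ev N g z) ⟩
            π * (π ^ N * w - ev N g z) ∎
          ev∈ : ∀ N f → S z (ev N f z)
          ev∈ N f = Σ∈ N (λ t → *∈ (ι∈ z (f t)) (^∈ z t generator))
            where
            Σ∈ : ∀ N {h : ℕ → Carrier} → (∀ t → S z (h t)) → S z (Σ< N h)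
            Σ∈ zero    _  = zero∈
            Σ∈ (suc N) h∈ = +∈ (h∈ 0) (Σ∈ N (λ t → h∈ (suc t)))
          p∣s : + p ∣± s
          p∣s = ℤ∣.∣ᵤ⇒∣ (π∣ι⇒p∣ s (_ , +∈ (*∈ (^∈ z N π∈) w∈) (-∈ (ev∈ N g)) , ιs≈))
          π^N+1∣ : ∀ {s} → + p ∣± s → (π ^ suc N) ∣ᶻ ι s
          π^N+1∣ (divides r s≡rp) = ∣S-resp z (trans (*-comm _ _) (trans (sym (ι-* r (+ p))) (ι-≡ (≡.sym s≡rp))))
            (∣S-*ʳ z (∣S-trans z (^-∣S z (suc N) D π∈ N<D) π^D∣P) (ι∈ z r))
          cancel-π : ∀ v → ι s ≈ π ^ suc N * v → ev N g z ≈ π ^ N * (w - v)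
          cancel-π v eq′ = begin
            ev N g z                      ≈⟨ solve 2 (λ g y → g := y :- (y :- g)) refl _ (π ^ N * (w - v)) ⟩
            π ^ N * (w - v) - (π ^ N * (w - v) - ev N g z) ≈⟨ +-congˡ (trans (-‿cong (domain π≉0 zero-product)) -0#≈0#) ⟩
            π ^ N * (w - v) + 0#          ≈⟨ +-identityʳ _ ⟩
            π ^ N * (w - v) ∎
            where
            zero-product : π * (π ^ N * (w - v) - ev N g z) ≈ 0#
            zero-product = begin
              π * (π ^ N * (w - v) - ev N g z)
                ≈⟨ solve 5 (λ x y w v g → x :* (y :* (w :- v) :- g) := x :* (y :* w :- g) :- x :* y :* v) refl π (π ^ N) w v (ev N g z) ⟩
              π * (π ^ N * w - ev N g z) - π * π ^ N * v
                ≈⟨ +-cong ιs≈ (-‿cong eq′) ⟨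
              ι s - ι s
                ≈⟨ -‿inverseʳ _ ⟩
              0# ∎
          from : (π ^ suc N) ∣ᶻ ι s → (π ^ N) ∣ᶻ ev N g z
          from (v , v∈ , eq′) = w - v , +∈ w∈ (-∈ v∈) , cancel-π v eq′
          π^N∣g : (π ^ N) ∣ᶻ ev N g z
          π^N∣g = from (π^N+1∣ p∣s)

        -- Infinite descent: a relation with all coefficients divisible by p may be divided by p.
        vanishing : ∀ bound f → ev D f z ≈ 0# → (∀ t → t < D → ∣ f t ∣ ≤ bound) → ∀ t → t < D → f t ≡ 0ℤ
        vanishing zero f _ f≤ t t<D = ℤ.∣i∣≡0⇒i≡0 (ℕ.n≤0⇒n≡0 (f≤ t t<D))
        vanishing (suc bound) f ev≈0 f≤ t t<D =
          ≡.trans (f≡pg t t<D) (≡.trans (≡.cong (ℤ._* + p) (vanishing bound g evg≈0 g≤ t t<D)) ≡.refl)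
          where
          p∣f : ∀ t → t < D → + p ∣± f t
          p∣f = p∣coefficients D ℕ.≤-refl f (∣S-resp z (sym ev≈0) (∣S-0 z))
          g : ℕ → ℤ
          g t with t ℕ.<? D
          ... | yes t<D = ℤ∣.quotient (p∣f t t<D)
          ... | no _    = 0ℤ
          f≡pg : ∀ t → t < D → f t ≡ g t ℤ.* + p
          f≡pg t t<D with t ℕ.<? D
          ... | yes t<D′ = ℤ∣._∣_.equality (p∣f t t<D′)
          ... | no t≮D = contradiction t<D t≮D
          evg≈0 : ev D g z ≈ 0#
          evg≈0 = domain (ι≉0 p 0<p) (begin
            P * ev D g z                    ≈⟨ Σ<-*ˡ D P _ ⟩
            Σ< D (λ t → P * (ι (g t) * z ^ t))
              ≈⟨ Σ<-cong D (λ t t<D → trans (solve 3 (λ p g x → p :* (g :* x) := (g :* p) :* x) refl P (ι (g t)) (z ^ t))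
                   (*-congʳ (trans (sym (ι-* (g t) (+ p))) (ι-≡ (≡.sym (f≡pg t t<D)))))) ⟩
            ev D f z                        ≈⟨ ev≈0 ⟩
            0# ∎)
          g≤ : ∀ t → t < D → ∣ g t ∣ ≤ bound
          g≤ t t<D = halve ∣ g t ∣ (≡.subst (_≤ suc bound) (≡.trans (≡.cong ∣_∣ (f≡pg t t<D)) (ℤ.∣i*j∣≡∣i∣*∣j∣ (g t) (+ p))) (f≤ t t<D))
            where
            halve : ∀ a → a ℕ.* p ≤ suc bound → a ≤ bound
            halve zero    _  = z≤n
            halve (suc a) le = ℕ.s≤s⁻¹ (ℕ.≤-trans (ℕ.m<m*n (suc a) p prime>1) le)

      independent-suc : ∀ f → ev D f z ≈ 0# → ∀ t → t < D → f t ≡ 0ℤ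
      independent-suc f ev≈0 = vanishing (bound D) f ev≈0 (≤bound D)
        where
        bound : ℕ → ℕ
        bound zero    = 0
        bound (suc N) = ∣ f N ∣ ℕ.⊔ bound N
        ≤bound : ∀ N t → t < N → ∣ f t ∣ ≤ bound N
        ≤bound (suc N) t t<N+1 with ℕ.m≤n⇒m<n∨m≡n (ℕ.s≤s⁻¹ t<N+1)
        ... | inj₁ t<N = ℕ.≤-trans (≤bound N t t<N) (ℕ.m≤n⊔m ∣ f N ∣ (bound N))
        ... | inj₂ ≡.refl = ℕ.m≤m⊔n ∣ f t ∣ (bound N)

      -- The relation 1 + η + ... + η^(p-1) = 0 expresses z^D = η^(p-1) by the powers η^t with t < p
      -- - 1, whose exponents q t in z stay below D.
      spanning-suc : ∀ {x} → S z x → Span.Span z D x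
      spanning-suc = spans 0<D (span-≈ z^D≈ (span-ι (ℤ.- 1ℤ) (span-Σ< p₁ (λ t t<p₁ → span-≈ (sym (^-assocʳ z q t))
                       (span-^ (q ℕ.* t) (ℕ.≤-trans (ℕ.*-monoʳ-< q {{ℕ.m^n≢0 p k}} t<p₁) (ℕ.≤-reflexive (ℕ.*-comm q p₁))))))))
        where
        open Span z D
        z^D≈ : ι (ℤ.- 1ℤ) * Σ< p₁ (η ^_) ≈ z ^ D
        z^D≈ = begin
          ι (ℤ.- 1ℤ) * Σ< p₁ (η ^_)     ≈⟨ *-congʳ (trans (ι-neg 1ℤ) (-‿cong ι-1)) ⟩
          - 1# * Σ< p₁ (η ^_)           ≈⟨ solve 3 (λ e s x → (:- e) :* s := x :- ((e :* s) :+ x)) refl 1# (Σ< p₁ (η ^_)) (η ^ p₁) ⟩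
          η ^ p₁ - (1# * Σ< p₁ (η ^_) + η ^ p₁)
            ≈⟨ +-congˡ (-‿cong (+-congʳ (*-identityˡ _))) ⟩
          η ^ p₁ - (Σ< p₁ (η ^_) + η ^ p₁)
            ≈⟨ +-congˡ (-‿cong (begin
                 Σ< p₁ (η ^_) + η ^ p₁   ≈⟨ Σ<-last p₁ (η ^_) ⟨
                 Σ< (suc p₁) (η ^_)      ≡⟨ ≡.cong (λ N → Σ< N (η ^_)) suc-p₁ ⟩
                 Σ< p (η ^_)             ≈⟨ cyclotomic-relation ⟩
                 0#                      ∎)) ⟩
          η ^ p₁ - 0#                   ≈⟨ trans (+-congˡ -0#≈0#) (+-identityʳ _) ⟩
          η ^ p₁                        ≈⟨ trans (^-assocʳ z q p₁) (^-congʳ z (ℕ.*-comm q p₁)) ⟩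
          z ^ D ∎

  module _ (m : ℕ) (z : Carrier) (z-primitive : IsPrimitiveRootOfUnity R (p ℕ.^ m) z) where

    powers-independent : ∀ f → ev (φ (p ℕ.^ m)) f z ≈ 0# → ∀ t → t < φ (p ℕ.^ m) → f t ≡ 0ℤ
    powers-independent = by-level m z-primitive
      where
      by-level : ∀ m → IsPrimitiveRootOfUnity R (p ℕ.^ m) z →
                 ∀ f → ev (φ (p ℕ.^ m)) f z ≈ 0# → ∀ t → t < φ (p ℕ.^ m) → f t ≡ 0ℤ
      -- At level 0 there is a single constant coefficient, and characteristic zero suffices.
      by-level zero _ f ev≈0 zero _ = ι-injective₀ (trans (sym (trans (+-identityʳ _) (*-identityʳ _))) ev≈0)
      by-level zero _ f ev≈0 (suc t) (s≤s ())
      by-level (suc k) (zᴺ≈1 , z^≉1) = ≡.subst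
        (λ D → ∀ f → ev D f z ≈ 0# → ∀ t → t < D → f t ≡ 0ℤ) (≡.sym (φ-prime-power k))
        (independent-suc z k zᴺ≈1 (z^≉1 (p ℕ.^ k) (ℕ.m^n>0 p k) (ℕ.^-monoʳ-< p prime>1 (ℕ.n<1+n k))))

    powers-span : ∀ {x} → S z x → ∃ λ f → x ≈ ev (φ (p ℕ.^ m)) f z
    powers-span = by-level m z-primitive
      where
      by-level : ∀ m → IsPrimitiveRootOfUnity R (p ℕ.^ m) z → ∀ {x} → S z x → ∃ λ f → x ≈ ev (φ (p ℕ.^ m)) f z
      by-level zero (z^1≈1 , _) = Span.spans z 1 (s≤s z≤n) (Span.span-≈ z 1 (sym z^1≈1) (Span.span-^ z 1 0 (s≤s z≤n)))
      by-level (suc k) (zᴺ≈1 , z^≉1) {x} x∈ = ≡.subst (λ D → ∃ λ f → x ≈ ev D f z) (≡.sym (φ-prime-power k))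
        (spanning-suc z k zᴺ≈1 (z^≉1 (p ℕ.^ k) (ℕ.m^n>0 p k) (ℕ.^-monoʳ-< p prime>1 (ℕ.n<1+n k))) x∈)

Σℤ-*ˡ : ∀ N c (f : ℕ → ℤ) → c ℤ.* Σℤ N f ≡ Σℤ N (λ k → c ℤ.* f k)
Σℤ-*ˡ = IntegerEmbedding.Σ<-*ˡ ℤ.+-*-commutativeRing

-- The double sums of the congruences and their recursion

module PrimeLevels {p : ℕ} (p-prime : Prime p) where

  open PrimeArithmetic p-prime

  0<p : 0 < p
  0<p = ℕ.<-trans (s≤s z≤n) prime>1

  p-nonZero : ℕ.NonZero p
  p-nonZero = ℕ.>-nonZero 0<p

  0<p^ : ∀ m → 0 < p ℕ.^ m
  0<p^ m = ℕ.m^n>0 p {{p-nonZero}} m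

  -- A form of φ(pᵐ) that reduces for m = 0 and for successors, whereas `φ` is defined by counting.
  D : ℕ → ℕ
  D zero    = 1
  D (suc m) = (p ∸ 1) ℕ.* p ℕ.^ m

  φ≡D : ∀ m → φ (p ℕ.^ m) ≡ D m
  φ≡D zero    = ≡.refl
  φ≡D (suc m) = φ-prime-power m

  suc[p∸1] : suc (p ∸ 1) ≡ p
  suc[p∸1] = ℕ.suc-pred p {{p-nonZero}}

  D+p^ : ∀ m → D (suc m) ℕ.+ p ℕ.^ m ≡ p ℕ.^ suc m
  D+p^ m = ≡.trans (ℕ.+-comm (D (suc m)) (p ℕ.^ m)) (cong (ℕ._* p ℕ.^ m) suc[p∸1])

  D≤p^ : ∀ m → D m ≤ p ℕ.^ m
  D≤p^ zero    = ℕ.≤-refl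
  D≤p^ (suc m) = ℕ.m+n≤o⇒m≤o (D (suc m)) (ℕ.≤-reflexive (D+p^ m))

  [_]mod : ℕ → ℕ → ℕ
  [ s ]mod m = _%_ s (p ℕ.^ m) {{ℕ.m^n≢0 p m {{p-nonZero}}}}

  -- The largest residue modulo p^(m+1) that is congruent to s modulo p^m.
  top : ℕ → ℕ → ℕ
  top m s = [ s ]mod m ℕ.+ D (suc m)

  mod-< : ∀ {m s} → s < p ℕ.^ m → [ s ]mod m ≡ s
  mod-< {m} = m<n⇒m%n≡m {{ℕ.m^n≢0 p m {{p-nonZero}}}}

  mod-+k* : ∀ m s k → s < p ℕ.^ m → [ s ℕ.+ k ℕ.* p ℕ.^ m ]mod m ≡ s
  mod-+k* m s k s< = ≡.trans ([m+kn]%n≡m%n s k (p ℕ.^ m) {{ℕ.m^n≢0 p m {{p-nonZero}}}}) (mod-< {m} s<)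

  top-+k* : ∀ m s k → s < p ℕ.^ m → top m (s ℕ.+ k ℕ.* p ℕ.^ m) ≡ s ℕ.+ D (suc m)
  top-+k* m s k s< = cong (ℕ._+ D (suc m)) (mod-+k* m s k s<)

  top-fixed : ∀ m s → D (suc m) ≤ s → s < p ℕ.^ suc m → top m s ≡ s
  top-fixed m s D≤s s<p^ = ≡.trans (cong (top m) (≡.sym eq)) (≡.trans (top-+k* m (s ∸ D (suc m)) (p ∸ 1) small) eq)
    where
    eq : s ∸ D (suc m) ℕ.+ D (suc m) ≡ s
    eq = ℕ.m∸n+n≡m D≤s
    small : s ∸ D (suc m) < p ℕ.^ m
    small = ℕ.+-cancelʳ-< (D (suc m)) _ _ (ℕ.≤-trans (s≤s (ℕ.≤-reflexive eq))
      (ℕ.≤-trans s<p^ (ℕ.≤-reflexive (≡.trans (≡.sym (D+p^ m)) (ℕ.+-comm (D (suc m)) _)))))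

  -- Adding D (m + 1) = p^(m+1) - p^m to both sides of a truncated subtraction is harmless. This
  -- links the sums for l + 1 to those for l, and the two kinds of index in the congruences to each
  -- other.
  shift-index : ∀ m t K → (t ℕ.+ K) ∸ p ℕ.^ m ≡ (t ℕ.+ D (suc m) ℕ.+ K) ∸ p ℕ.^ suc m
  shift-index m t K = begin
    (t ℕ.+ K) ∸ p ℕ.^ m
      ≡⟨ ℕ.[m+n]∸[m+o]≡n∸o (D (suc m)) (t ℕ.+ K) (p ℕ.^ m) ⟨
    (D (suc m) ℕ.+ (t ℕ.+ K)) ∸ (D (suc m) ℕ.+ p ℕ.^ m)
      ≡⟨ cong₂ _∸_ (≡.trans (≡.sym (ℕ.+-assoc (D (suc m)) t K)) (cong (ℕ._+ K) (ℕ.+-comm (D (suc m)) t))) (D+p^ m) ⟩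
    (t ℕ.+ D (suc m) ℕ.+ K) ∸ p ℕ.^ suc m ∎
    where open ≡.≡-Reasoning

  module Folding (n : ℕ) (x : ℕ → ℕ → ℤ) where

    -- R l t is the first double sum in the congruence for l, at j = t; the second one is R l (top m j) with m = n - l - 1.
    inner : ℕ → ℕ → ℕ → ℤ
    inner l t i = Σℤ (p ∸ 1) (λ k → x (n ∸ i) ((t ℕ.+ suc k ℕ.* p ℕ.^ (n ∸ 1 ∸ i)) ∸ p ℕ.^ (n ∸ l)))

    R : ℕ → ℕ → ℤ
    R l t = Σℤ l (λ i → + (p ℕ.^ (l ∸ 1 ∸ i)) ℤ.* inner l t i)

    -- The last index i = l has weight p⁰ and contributes the plain sum over x_{m+1}. Each i < l
    -- gains one factor p and has its indices rewritten by `shift-index`.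
    R-suc : ∀ l m → l ℕ.+ suc m ≡ n → ∀ t →
            R (suc l) t ≡ Σℤ (p ∸ 1) (λ k → x (suc m) (t ℕ.+ k ℕ.* p ℕ.^ m)) ℤ.+ + p ℤ.* R l (t ℕ.+ D (suc m))
    R-suc l m ≡.refl t = begin
      R (suc l) t
        ≡⟨ Σℤ-last l (λ i → + (p ℕ.^ (l ∸ i)) ℤ.* inner (suc l) t i) ⟩
      Σℤ l (λ i → + (p ℕ.^ (l ∸ i)) ℤ.* inner (suc l) t i) ℤ.+ + (p ℕ.^ (l ∸ l)) ℤ.* inner (suc l) t l
        ≡⟨ cong₂ ℤ._+_ (Σℤ-cong l lower) (≡.trans (cong (λ e → + (p ℕ.^ e) ℤ.* inner (suc l) t l) (ℕ.n∸n≡0 l))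
                                             (≡.trans (ℤ.*-identityˡ _) last)) ⟩
      Σℤ l (λ i → + p ℤ.* (+ (p ℕ.^ (l ∸ 1 ∸ i)) ℤ.* inner l (t ℕ.+ D (suc m)) i)) ℤ.+ Σℤ (p ∸ 1) (λ k → x (suc m) (t ℕ.+ k ℕ.* p ℕ.^ m))
        ≡⟨ cong (ℤ._+ _) (≡.sym (Σℤ-*ˡ l (+ p) _)) ⟩
      + p ℤ.* R l (t ℕ.+ D (suc m)) ℤ.+ Σℤ (p ∸ 1) (λ k → x (suc m) (t ℕ.+ k ℕ.* p ℕ.^ m))
        ≡⟨ ℤ.+-comm (+ p ℤ.* R l (t ℕ.+ D (suc m))) _ ⟩
      Σℤ (p ∸ 1) (λ k → x (suc m) (t ℕ.+ k ℕ.* p ℕ.^ m)) ℤ.+ + p ℤ.* R l (t ℕ.+ D (suc m)) ∎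
      where
      open ≡.≡-Reasoning
      N = l ℕ.+ suc m
      n∸l : N ∸ l ≡ suc m
      n∸l = ℕ.m+n∸m≡n l (suc m)
      n∸1+l : N ∸ suc l ≡ m
      n∸1+l = ≡.trans (cong (_∸ suc l) (ℕ.+-suc l m)) (ℕ.m+n∸m≡n l m)
      n∸1∸l : N ∸ 1 ∸ l ≡ m
      n∸1∸l = ≡.trans (ℕ.∸-+-assoc N 1 l) n∸1+l
      last : inner (suc l) t l ≡ Σℤ (p ∸ 1) (λ k → x (suc m) (t ℕ.+ k ℕ.* p ℕ.^ m))
      last = Σℤ-cong′ (p ∸ 1) (λ k → cong₂ x n∸l (begin
        (t ℕ.+ suc k ℕ.* p ℕ.^ (N ∸ 1 ∸ l)) ∸ p ℕ.^ (N ∸ suc l)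
          ≡⟨ cong₂ (λ a b → (t ℕ.+ suc k ℕ.* p ℕ.^ a) ∸ p ℕ.^ b) n∸1∸l n∸1+l ⟩
        (t ℕ.+ (p ℕ.^ m ℕ.+ k ℕ.* p ℕ.^ m)) ∸ p ℕ.^ m
          ≡⟨ cong (λ a → (t ℕ.+ a) ∸ p ℕ.^ m) (ℕ.+-comm (p ℕ.^ m) _) ⟩
        (t ℕ.+ (k ℕ.* p ℕ.^ m ℕ.+ p ℕ.^ m)) ∸ p ℕ.^ m
          ≡⟨ cong (_∸ p ℕ.^ m) (ℕ.+-assoc t _ (p ℕ.^ m)) ⟨
        (t ℕ.+ k ℕ.* p ℕ.^ m ℕ.+ p ℕ.^ m) ∸ p ℕ.^ m
          ≡⟨ ℕ.m+n∸n≡m _ (p ℕ.^ m) ⟩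
        t ℕ.+ k ℕ.* p ℕ.^ m ∎))
      shift : ∀ K → (t ℕ.+ K) ∸ p ℕ.^ (N ∸ suc l) ≡ (t ℕ.+ D (suc m) ℕ.+ K) ∸ p ℕ.^ (N ∸ l)
      shift K = ≡.trans (cong (λ a → (t ℕ.+ K) ∸ p ℕ.^ a) n∸1+l)
        (≡.trans (shift-index m t K) (cong (λ a → (t ℕ.+ D (suc m) ℕ.+ K) ∸ p ℕ.^ a) (≡.sym n∸l)))
      lower : ∀ i → i < l → + (p ℕ.^ (l ∸ i)) ℤ.* inner (suc l) t i
                              ≡ + p ℤ.* (+ (p ℕ.^ (l ∸ 1 ∸ i)) ℤ.* inner l (t ℕ.+ D (suc m)) i)
      lower i i<l = begin
        + (p ℕ.^ (l ∸ i)) ℤ.* inner (suc l) t i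
          ≡⟨ cong₂ (λ a b → + (p ℕ.^ a) ℤ.* b) exponent
               (Σℤ-cong′ (p ∸ 1) (λ k → cong (x (N ∸ i)) (shift (suc k ℕ.* p ℕ.^ (N ∸ 1 ∸ i))))) ⟩
        + (p ℕ.* p ℕ.^ (l ∸ 1 ∸ i)) ℤ.* inner l (t ℕ.+ D (suc m)) i
          ≡⟨ cong (ℤ._* inner l (t ℕ.+ D (suc m)) i) (ℤ.pos-* p (p ℕ.^ (l ∸ 1 ∸ i))) ⟩
        + p ℤ.* + (p ℕ.^ (l ∸ 1 ∸ i)) ℤ.* inner l (t ℕ.+ D (suc m)) i
          ≡⟨ ℤ.*-assoc (+ p) (+ (p ℕ.^ (l ∸ 1 ∸ i))) _ ⟩
        + p ℤ.* (+ (p ℕ.^ (l ∸ 1 ∸ i)) ℤ.* inner l (t ℕ.+ D (suc m)) i) ∎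
        where
        exponent : l ∸ i ≡ suc (l ∸ 1 ∸ i)
        exponent = ≡.trans (≡.sym (ℕ.suc-pred (l ∸ i) {{ℕ.>-nonZero (ℕ.m<n⇒0<n∸m i<l)}}))
          (cong suc (≡.trans (ℕ.pred[m∸n]≡m∸[1+n] l i) (≡.sym (ℕ.∸-+-assoc l 1 i))))

    module _ (x-vanishes : ∀ m j → D m ≤ j → x m j ≡ 0ℤ) where

      -- The term k = p - 1 may be added to the sum over x, because its index is at least D (m + 1).
      -- The factor p in front of R_l becomes p equal summands, as top takes the same value on the
      -- whole residue class.
      fold : ∀ l m → l ℕ.+ suc m ≡ n → ∀ s → s < p ℕ.^ m →
             R (suc l) s ≡ Σℤ p (λ k → x (suc m) (s ℕ.+ k ℕ.* p ℕ.^ m) ℤ.+ R l (top m (s ℕ.+ k ℕ.* p ℕ.^ m)))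
      fold l m eq s s< = begin
        R (suc l) s
          ≡⟨ R-suc l m eq s ⟩
        Σℤ (p ∸ 1) X ℤ.+ + p ℤ.* r
          ≡⟨ cong₂ ℤ._+_ (≡.sym extend) (≡.sym (const p)) ⟩
        Σℤ p X ℤ.+ Σℤ p (λ _ → r)
          ≡⟨ Σℤ-distrib p X (λ _ → r) ⟨
        Σℤ p (λ k → X k ℤ.+ r)
          ≡⟨ Σℤ-cong′ p (λ k → cong (λ t → X k ℤ.+ R l t) (≡.sym (top-+k* m s k s<))) ⟩
        Σℤ p (λ k → X k ℤ.+ R l (top m (s ℕ.+ k ℕ.* p ℕ.^ m))) ∎
        where
        open ≡.≡-Reasoning
        X : ℕ → ℤ
        X k = x (suc m) (s ℕ.+ k ℕ.* p ℕ.^ m)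
        r = R l (s ℕ.+ D (suc m))
        extend : Σℤ p X ≡ Σℤ (p ∸ 1) X
        extend = begin
          Σℤ p X                        ≡⟨ cong (λ N → Σℤ N X) suc[p∸1] ⟨
          Σℤ (suc (p ∸ 1)) X            ≡⟨ Σℤ-last (p ∸ 1) X ⟩
          Σℤ (p ∸ 1) X ℤ.+ X (p ∸ 1)    ≡⟨ cong (λ a → Σℤ (p ∸ 1) X ℤ.+ a) (x-vanishes (suc m) _ (ℕ.m≤n+m (D (suc m)) s)) ⟩
          Σℤ (p ∸ 1) X ℤ.+ 0ℤ           ≡⟨ ℤ.+-identityʳ _ ⟩
          Σℤ (p ∸ 1) X                  ∎
        const : ∀ N → Σℤ N (λ _ → r) ≡ + N ℤ.* r
        const zero    = ≡.sym (ℤ.*-zeroˡ r)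
        const (suc N) = ≡.trans (cong (λ a → r ℤ.+ a) (const N)) (≡.sym (ℤ.suc-* (+ N) r))

    -- The coordinates of the family x in the basis (m , j) ↦ (ζᵢʲ for i ≤ m, 0 for i > m).
    G : ℕ → ℕ → ℤ
    G zero    j = x 0 j ℤ.- R n j
    G (suc m) j = x (suc m) j ℤ.- (R (n ∸ suc m) j ℤ.- R (n ∸ suc m) (top m j))

    G+R≡V : ∀ l m → l ℕ.+ suc m ≡ n → ∀ s → G (suc m) s ℤ.+ R l s ≡ x (suc m) s ℤ.+ R l (top m s)
    G+R≡V l m eq s = ≡.trans (cong (λ k → G′ k ℤ.+ R l s) (n∸ l m eq)) (cancel (x (suc m) s) (R l s) (R l (top m s)))
      where
      n∸ : ∀ l m → l ℕ.+ suc m ≡ n → n ∸ suc m ≡ l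
      n∸ l m ≡.refl = ℕ.m+n∸n≡m l (suc m)
      G′ : ℕ → ℤ
      G′ k = x (suc m) s ℤ.- (R k s ℤ.- R k (top m s))
      cancel : ∀ x r t → x ℤ.- (r ℤ.- t) ℤ.+ r ≡ x ℤ.+ t
      cancel = ℤ-solve 3 (λ x r t → x ℤ:- (r ℤ:- t) ℤ:+ r ℤ:= x ℤ:+ t) ≡.refl

    -- Residues in the last block are their own top, so the two correction terms cancel. Hence the
    -- standard exponents below D suffice for `G`.
    G-vanishes : (∀ m j → D m ≤ j → x m j ≡ 0ℤ) → ∀ m j → D (suc m) ≤ j → j < p ℕ.^ suc m → G (suc m) j ≡ 0ℤ
    G-vanishes x-vanishes m j D≤j j< = begin
      x (suc m) j ℤ.- (r j ℤ.- r (top m j))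
        ≡⟨ cong₂ (λ a b → a ℤ.- (r j ℤ.- r b)) (x-vanishes (suc m) j D≤j) (top-fixed m j D≤j j<) ⟩
      0ℤ ℤ.- (r j ℤ.- r j)
        ≡⟨ cong (λ a → 0ℤ ℤ.- a) (ℤ.+-inverseʳ (r j)) ⟩
      0ℤ ∎
      where
      open ≡.≡-Reasoning
      r = R (n ∸ suc m)

-- Values of the folded polynomials at roots of unity

module Evaluation {c ℓ} (K : CommutativeRing c ℓ) {p : ℕ} (p-prime : Prime p) where

  open PrimeLevels p-prime
  open CommutativeRing K hiding (zero)
  open IntegerEmbedding K
  open import Algebra.Properties.Semiring.Exp semiring
    using (_^_; ^-homo-*; ^-assocʳ; ^-congˡ; ^-congʳ)
  open import Relation.Binary.Reasoning.Setoid setoid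

  ev-0 : ∀ N {f} z → (∀ t → t < N → f t ≡ 0ℤ) → ev N f z ≈ 0#
  ev-0 N z f≡0 = Σ<-zero N (λ t t<N → trans (*-congʳ (ι-≡ (f≡0 t t<N))) (zeroˡ _))

  ev-extend : ∀ N P f z → (∀ t → N ≤ t → t < N ℕ.+ P → f t ≡ 0ℤ) → ev (N ℕ.+ P) f z ≈ ev N f z
  ev-extend N P f z f≡0 = trans (Σ<-split N P _) (trans (+-congˡ (Σ<-zero P (λ t t<P →
    trans (*-congʳ (ι-≡ (f≡0 (N ℕ.+ t) (ℕ.m≤m+n N t) (ℕ.+-monoʳ-< N t<P)))) (zeroˡ _)))) (+-identityʳ _))

  ev-+ : ∀ N f g z → ev N (λ t → f t ℤ.+ g t) z ≈ ev N f z + ev N g z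
  ev-+ N f g z = trans (Σ<-cong′ N (λ t → trans (*-congʳ (ι-+ (f t) (g t))) (distribʳ _ _ _))) (Σ<-distrib N _ _)

  ^-+k* : ∀ z s k Q → z ^ (s ℕ.+ k ℕ.* Q) ≈ z ^ s * (z ^ Q) ^ k
  ^-+k* z s k Q = trans (^-homo-* z s (k ℕ.* Q))
    (*-congˡ (trans (^-congʳ z (ℕ.*-comm k Q)) (sym (^-assocʳ z Q k))))

  ev-blocks : ∀ a Q f z → ev (a ℕ.* Q) f z ≈ Σ< Q (λ s → Σ< a (λ k → ι (f (s ℕ.+ k ℕ.* Q)) * (z ^ Q) ^ k) * z ^ s)
  ev-blocks a Q f z = begin
    ev (a ℕ.* Q) f z
      ≈⟨ Σ<-block a Q _ ⟩
    Σ< a (λ k → Σ< Q (λ s → ι (f (s ℕ.+ k ℕ.* Q)) * z ^ (s ℕ.+ k ℕ.* Q)))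
      ≈⟨ Σ<-swap a Q _ ⟩
    Σ< Q (λ s → Σ< a (λ k → ι (f (s ℕ.+ k ℕ.* Q)) * z ^ (s ℕ.+ k ℕ.* Q)))
      ≈⟨ Σ<-cong′ Q (λ s → trans (Σ<-cong′ a (λ k → trans (*-congˡ (^-+k* z s k Q))
            (solve 3 (λ f x y → f :* (x :* y) := (f :* y) :* x) refl (ι (f (s ℕ.+ k ℕ.* Q))) (z ^ s) ((z ^ Q) ^ k))))
            (sym (Σ<-*ʳ a (z ^ s) _))) ⟩
    Σ< Q (λ s → Σ< a (λ k → ι (f (s ℕ.+ k ℕ.* Q)) * (z ^ Q) ^ k) * z ^ s) ∎

  -- This is reduction modulo T^Q - 1.
  ev-fold : ∀ a Q f z → z ^ Q ≈ 1# → ev (a ℕ.* Q) f z ≈ ev Q (λ s → Σℤ a (λ k → f (s ℕ.+ k ℕ.* Q))) z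
  ev-fold a Q f z z^Q≈1 = trans (ev-blocks a Q f z) (Σ<-cong′ Q (λ s → *-congʳ (trans
    (Σ<-cong′ a (λ k → trans (*-congˡ (trans (^-congˡ k z^Q≈1) (1^ k))) (*-identityʳ _)))
    (sym (ι-Σ< a _)))))

  -- Coefficients that are constant on residue classes modulo pᵐ make the polynomial a multiple of
  -- Σ_k T^(k pᵐ), the cyclotomic polynomial of level m + 1.
  ev-top : ∀ m g z → Σ< p ((z ^ (p ℕ.^ m)) ^_) ≈ 0# → ev (p ℕ.^ suc m) (λ s → g (top m s)) z ≈ 0#
  ev-top m g z Ση≈0 = trans (ev-blocks p Q (λ s → g (top m s)) z) (Σ<-zero Q (λ s s<Q → trans (*-congʳ (begin
    Σ< p (λ k → ι (g (top m (s ℕ.+ k ℕ.* Q))) * η ^ k)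
      ≈⟨ Σ<-cong′ p (λ k → *-congʳ (ι-≡ (cong g (top-+k* m s k s<Q)))) ⟩
    Σ< p (λ k → ι (g (s ℕ.+ D (suc m))) * η ^ k)
      ≈⟨ Σ<-*ˡ p _ (η ^_) ⟨
    ι (g (s ℕ.+ D (suc m))) * Σ< p (η ^_)
      ≈⟨ trans (*-congˡ Ση≈0) (zeroʳ _) ⟩
    0# ∎)) (zeroˡ _)))
    where
    Q = p ℕ.^ m
    η = z ^ Q

  -- The equation `suc k ≡ m` makes the second condition empty at level 0, so that all levels can be
  -- treated alike.
  CyclotomicAt : ℕ → Carrier → Set _
  CyclotomicAt m z = z ^ (p ℕ.^ m) ≈ 1# × (∀ k → suc k ≡ m → Σ< p ((z ^ (p ℕ.^ k)) ^_) ≈ 0#)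

  module _ (n : ℕ) (x : ℕ → ℕ → ℤ) (x-vanishes : ∀ m j → D m ≤ j → x m j ≡ 0ℤ) where

    open Folding n x

    evG : ℕ → Carrier → Carrier
    evG m z = ev (D m) (G m) z

    private
      V : ℕ → ℕ → ℕ → ℤ
      V l m s = x (suc m) s ℤ.+ R l (top m s)

      ev-D : ∀ m f z → (∀ t → D (suc m) ≤ t → t < p ℕ.^ suc m → f t ≡ 0ℤ) → ev (p ℕ.^ suc m) f z ≈ ev (D (suc m)) f z
      ev-D m f z f≡0 = trans (reflexive (cong (λ N → ev N f z) (≡.sym (D+p^ m))))
        (ev-extend (D (suc m)) (p ℕ.^ m) f z
          (λ t D≤t t< → f≡0 t D≤t (ℕ.≤-trans t< (ℕ.≤-reflexive (D+p^ m)))))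

      ev-V : ∀ l m → l ℕ.+ suc m ≡ n → ∀ z → ev (p ℕ.^ suc m) (V l m) z ≈ evG (suc m) z + ev (p ℕ.^ suc m) (R l) z
      ev-V l m eq z = begin
        ev (p ℕ.^ suc m) (V l m) z
          ≈⟨ ev-cong (p ℕ.^ suc m) z (λ s _ → ≡.sym (G+R≡V l m eq s)) ⟩
        ev (p ℕ.^ suc m) (λ s → G (suc m) s ℤ.+ R l s) z
          ≈⟨ ev-+ (p ℕ.^ suc m) (G (suc m)) (R l) z ⟩
        ev (p ℕ.^ suc m) (G (suc m)) z + ev (p ℕ.^ suc m) (R l) z
          ≈⟨ +-congʳ (ev-D m (G (suc m)) z (G-vanishes x-vanishes m)) ⟩
        evG (suc m) z + ev (p ℕ.^ suc m) (R l) z ∎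

      fold-step : ∀ l m → l ℕ.+ suc m ≡ n → ∀ z → z ^ (p ℕ.^ m) ≈ 1# →
                  ev (p ℕ.^ m) (R (suc l)) z ≈ evG (suc m) z + ev (p ℕ.^ suc m) (R l) z
      fold-step l m eq z z^≈1 = begin
        ev (p ℕ.^ m) (R (suc l)) z
          ≈⟨ ev-cong (p ℕ.^ m) z (λ s s< → fold x-vanishes l m eq s s<) ⟩
        ev (p ℕ.^ m) (λ s → Σℤ p (λ k → V l m (s ℕ.+ k ℕ.* p ℕ.^ m))) z
          ≈⟨ ev-fold p (p ℕ.^ m) (V l m) z z^≈1 ⟨
        ev (p ℕ.^ suc m) (V l m) z
          ≈⟨ ev-V l m eq z ⟩
        evG (suc m) z + ev (p ℕ.^ suc m) (R l) z ∎

    -- Each `fold-step` splits off one level of `G`, until the empty sum `R 0` is reached at level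
    -- n. The hypothesis on z passes to all higher levels.
    ev-R : ∀ l m → l ℕ.+ m ≡ n → ∀ z → z ^ (p ℕ.^ m) ≈ 1# → ev (p ℕ.^ m) (R l) z ≈ Σ< l (λ i → evG (n ∸ i) z)
    ev-R zero    m eq z _ = ev-0 (p ℕ.^ m) z (λ _ _ → ≡.refl)
    ev-R (suc l) m eq z z^≈1 = begin
      ev (p ℕ.^ m) (R (suc l)) z
        ≈⟨ fold-step l m eq′ z z^≈1 ⟩
      evG (suc m) z + ev (p ℕ.^ suc m) (R l) z
        ≈⟨ +-comm _ _ ⟩
      ev (p ℕ.^ suc m) (R l) z + evG (suc m) z
        ≈⟨ +-cong (ev-R l (suc m) eq′ z z^p^≈1) (reflexive (cong (λ k → evG k z) (≡.sym n∸l))) ⟩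
      Σ< l (λ i → evG (n ∸ i) z) + evG (n ∸ l) z
        ≈⟨ Σ<-last l _ ⟨
      Σ< (suc l) (λ i → evG (n ∸ i) z) ∎
      where
      eq′ : l ℕ.+ suc m ≡ n
      eq′ = ≡.trans (ℕ.+-suc l m) eq
      n∸l : n ∸ l ≡ suc m
      n∸l = ≡.trans (cong (_∸ l) (≡.sym eq′)) (ℕ.m+n∸m≡n l (suc m))
      z^p^≈1 : z ^ (p ℕ.^ suc m) ≈ 1#
      z^p^≈1 = trans (^-congʳ z (ℕ.*-comm p (p ℕ.^ m)))
        (trans (sym (^-assocʳ z (p ℕ.^ m) p)) (trans (^-congˡ p z^≈1) (1^ p)))

    -- At its own level m ≥ 1, x may be replaced by `V`, since the added top part vanishes at z. At
    -- level 0 there is no top part, in accordance with the first clause of `G`.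
    ev-x : ∀ l m → l ℕ.+ m ≡ n → ∀ z → CyclotomicAt m z → ev (D m) (x m) z ≈ Σ< (suc l) (λ i → evG (n ∸ i) z)
    ev-x l m eq z (z^≈1 , Ση≈0) = begin
      ev (D m) (x m) z                         ≈⟨ split m eq Ση≈0 ⟩
      evG m z + ev (p ℕ.^ m) (R l) z           ≈⟨ +-cong (reflexive (cong (λ k → evG k z) (≡.sym n∸l))) (ev-R l m eq z z^≈1) ⟩
      evG (n ∸ l) z + Σ< l (λ i → evG (n ∸ i) z) ≈⟨ +-comm _ _ ⟩
      Σ< l (λ i → evG (n ∸ i) z) + evG (n ∸ l) z ≈⟨ Σ<-last l _ ⟨
      Σ< (suc l) (λ i → evG (n ∸ i) z)         ∎
      where
      n∸l : n ∸ l ≡ m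
      n∸l = ≡.trans (cong (_∸ l) (≡.sym eq)) (ℕ.m+n∸m≡n l m)
      split : ∀ m → l ℕ.+ m ≡ n → (∀ k → suc k ≡ m → Σ< p ((z ^ (p ℕ.^ k)) ^_) ≈ 0#) →
              ev (D m) (x m) z ≈ evG m z + ev (p ℕ.^ m) (R l) z
      split zero eq _ = trans (ev-cong 1 z (λ t _ → ≡.sym (cancel (x 0 t) (≡.sym (≡.trans (≡.sym eq) (ℕ.+-identityʳ l))) t)))
                        (ev-+ 1 (G 0) (R l) z)
        where
        cancel : ∀ a {k} → l ≡ k → ∀ t → a ℤ.- R k t ℤ.+ R l t ≡ a
        cancel a ≡.refl t = ≡.trans (ℤ.+-assoc a _ _) (≡.trans (cong (λ b → a ℤ.+ b) (ℤ.+-inverseˡ (R l t))) (ℤ.+-identityʳ a))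
      split (suc m) eq Ση≈0 = begin
        ev (D (suc m)) (x (suc m)) z
          ≈⟨ ev-D m (x (suc m)) z (λ t D≤t _ → x-vanishes (suc m) t D≤t) ⟨
        ev (p ℕ.^ suc m) (x (suc m)) z
          ≈⟨ trans (+-congˡ (ev-top m (R l) z (Ση≈0 m ≡.refl))) (+-identityʳ _) ⟨
        ev (p ℕ.^ suc m) (x (suc m)) z + ev (p ℕ.^ suc m) (λ s → R l (top m s)) z
          ≈⟨ ev-+ (p ℕ.^ suc m) (x (suc m)) (λ s → R l (top m s)) z ⟨
        ev (p ℕ.^ suc m) (V l m) z
          ≈⟨ ev-V l m eq z ⟩
        evG (suc m) z + ev (p ℕ.^ suc m) (R l) z ∎

-- Discrete logarithms and characters of a finite cyclic group

module CyclicGroup {g ℓ} (C : Group g ℓ) {N : ℕ} (0<N : 0 < N) (order : HasOrder C N)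
  (c₀ : Group.Carrier C) (generates : Generates C c₀) where

  open Group C
  open Inverse order using (strictlyInverseˡ; strictlyInverseʳ) renaming (to to index; to-cong to index-cong; from to element)
  open import Algebra.Properties.Group C using (∙-cancelˡ; \\-leftDividesʳ; \\-leftDividesˡ)
  open import Algebra.Properties.Monoid.Mult monoid using () renaming (×-homo-+ to power-homo)
  private module CR where
    open import Relation.Binary.Reasoning.Setoid setoid public

  private
    instance
      N-nonZero : NonZero N
      N-nonZero = ℕ.>-nonZero 0<N

  pow : ℕ → Carrier
  pow = power C c₀

  pow-+ : ∀ a b → pow (a ℕ.+ b) ≈ pow a ∙ pow b
  pow-+ = power-homo c₀

  index-injective : ∀ {x y} → index x ≡ index y → x ≈ y
  index-injective {x} {y} eq = let open CR in begin
    x                   ≈⟨ strictlyInverseʳ x ⟨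
    element (index x)   ≡⟨ cong element eq ⟩
    element (index y)   ≈⟨ strictlyInverseʳ y ⟩
    y                   ∎

  pow-difference : ∀ {a b} → a ≤ b → pow a ≈ pow b → pow (b ∸ a) ≈ ε
  pow-difference {a} {b} a≤b eq = ∙-cancelˡ (pow a) (pow (b ∸ a)) ε (let open CR in begin
    pow a ∙ pow (b ∸ a)   ≈⟨ pow-+ a (b ∸ a) ⟨
    pow (a ℕ.+ (b ∸ a))   ≡⟨ cong pow (ℕ.m+[n∸m]≡n a≤b) ⟩
    pow b                 ≈⟨ eq ⟨
    pow a                 ≈⟨ identityʳ (pow a) ⟨
    pow a ∙ ε             ∎)

  pow-* : ∀ {d} k → pow d ≈ ε → pow (k ℕ.* d) ≈ ε
  pow-* zero    eq = refl
  pow-* {d} (suc k) eq = trans (pow-+ d (k ℕ.* d)) (trans (∙-cong eq (pow-* k eq)) (identityʳ ε))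

  pow-% : ∀ d .{{_ : NonZero d}} → pow d ≈ ε → ∀ k → pow (k % d) ≈ pow k
  pow-% d eq k = let open CR in begin
    pow (k % d)                        ≈⟨ identityʳ _ ⟨
    pow (k % d) ∙ ε                    ≈⟨ ∙-congˡ (pow-* (k / d) eq) ⟨
    pow (k % d) ∙ pow (k / d ℕ.* d)    ≈⟨ pow-+ (k % d) _ ⟨
    pow (k % d ℕ.+ k / d ℕ.* d)        ≡⟨ cong pow (m≡m%n+[m/n]*n k d) ⟨
    pow k                              ∎

  private
    log₀ : Carrier → ℕ
    log₀ y = proj₁ (generates y)

    pow-log₀ : ∀ y → pow (log₀ y) ≈ y
    pow-log₀ y = proj₂ (generates y)

  -- If d < N, two distinct elements have exponents with the same residue modulo d, and those
  -- residues determine the elements.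
  order-minimal : ∀ d → 0 < d → pow d ≈ ε → N ≤ d
  order-minimal d@(suc _) _ eq = ℕ.≮⇒≥ λ d<N →
    let (i , j , i<j , r≡) = Fin.pigeonhole d<N (λ i → fromℕ< (m%n<n (log₀ (element i)) d)) in
    Fin.<⇒≢ i<j (≡.trans (≡.sym (strictlyInverseˡ i)) (≡.trans
      (index-cong (same (element i) (element j) (Fin.fromℕ<-injective _ _ _ _ r≡)))
      (strictlyInverseˡ j)))
    where
    same : ∀ x y → log₀ x % d ≡ log₀ y % d → x ≈ y
    same x y r≡ = let open CR in begin
      x                   ≈⟨ trans (pow-% d eq (log₀ x)) (pow-log₀ x) ⟨
      pow (log₀ x % d)    ≡⟨ cong pow r≡ ⟩
      pow (log₀ y % d)    ≈⟨ trans (pow-% d eq (log₀ y)) (pow-log₀ y) ⟩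
      y                   ∎

  -- Among the powers with exponents 0, ..., N two coincide. Their difference is a period of at most
  -- N, and `order-minimal` forces it to be N.
  pow-N : pow N ≈ ε
  pow-N =
    let (i , j , i<j , eq) = Fin.pigeonhole (ℕ.n<1+n N) (λ i → index (pow (toℕ i))) in
    from-coincidence (toℕ i) (toℕ j) i<j (ℕ.s≤s⁻¹ (Fin.toℕ<n j)) (index-injective eq)
    where
    from-coincidence : ∀ a b → a < b → b ≤ N → pow a ≈ pow b → pow N ≈ ε
    from-coincidence a b a<b b≤N eq = ≡.subst (λ d → pow d ≈ ε) d≡N trivial
      where
      trivial : pow (b ∸ a) ≈ ε
      trivial = pow-difference (ℕ.<⇒≤ a<b) eq
      d≡N : b ∸ a ≡ N
      d≡N = ℕ.≤-antisym (ℕ.≤-trans (ℕ.m∸n≤m b a) b≤N) (order-minimal (b ∸ a) (ℕ.m<n⇒0<n∸m a<b) trivial)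

  pow-injective : ∀ {a b} → a < N → b < N → pow a ≈ pow b → a ≡ b
  pow-injective {a} {b} a<N b<N eq with ℕ.<-cmp a b
  ... | tri≈ _ a≡b _ = a≡b
  ... | tri< a<b _ _ = contradiction (ℕ.≤-trans (s≤s (ℕ.m∸n≤m b a)) b<N)
        (ℕ.≤⇒≯ (order-minimal (b ∸ a) (ℕ.m<n⇒0<n∸m a<b) (pow-difference (ℕ.<⇒≤ a<b) eq)))
  ... | tri> _ _ b<a = contradiction (ℕ.≤-trans (s≤s (ℕ.m∸n≤m a b)) a<N)
        (ℕ.≤⇒≯ (order-minimal (a ∸ b) (ℕ.m<n⇒0<n∸m b<a) (pow-difference (ℕ.<⇒≤ b<a) (sym eq))))

  -- The exponent supplied by `generates` is arbitrary and need not respect equality in the group;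
  -- its residue modulo N does.
  log : Carrier → ℕ
  log y = log₀ y % N

  log<N : ∀ y → log y < N
  log<N y = m%n<n (log₀ y) N

  pow-log : ∀ y → pow (log y) ≈ y
  pow-log y = trans (pow-% N pow-N (log₀ y)) (pow-log₀ y)

  log-unique : ∀ {t y} → t < N → pow t ≈ y → log y ≡ t
  log-unique {t} {y} t<N eq = pow-injective (log<N y) t<N (trans (pow-log y) (sym eq))

  log-cong : ∀ {x y} → x ≈ y → log x ≡ log y
  log-cong {x} {y} x≈y = log-unique (log<N y) (trans (pow-log y) (sym x≈y))

  log-pow : ∀ k → log (pow k) ≡ k % N
  log-pow k = log-unique (m%n<n k N) (pow-% N pow-N k)

  private
    powers : HasOrder C N
    powers = record
      { to        = λ y → fromℕ< (log<N y)
      ; from      = λ i → pow (toℕ i)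
      ; to-cong   = λ x≈y → Fin.fromℕ<-cong _ _ (log-cong x≈y) _ _
      ; from-cong = λ { ≡.refl → refl }
      ; inverse   =
          (λ {i} {y} y≈ → Fin.toℕ-injective (≡.trans (Fin.toℕ-fromℕ< (log<N y)) (log-unique (Fin.toℕ<n i) (sym y≈))))
        , (λ { {y} ≡.refl → trans (reflexive (cong pow (Fin.toℕ-fromℕ< (log<N y)))) (pow-log y) })
      }

    translated : Carrier → HasOrder C N
    translated h = record
      { to        = λ y → fromℕ< (log<N (h ⁻¹ ∙ y))
      ; from      = λ i → h ∙ pow (toℕ i)
      ; to-cong   = λ x≈y → Fin.fromℕ<-cong _ _ (log-cong (∙-congˡ x≈y)) _ _
      ; from-cong = λ { ≡.refl → refl }
      ; inverse   =
          (λ {i} {y} y≈ → Fin.toℕ-injective (≡.trans (Fin.toℕ-fromℕ< _) (log-unique (Fin.toℕ<n i)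
             (trans (sym (\\-leftDividesʳ h (pow (toℕ i)))) (∙-congˡ (sym y≈))))))
        , (λ { {y} ≡.refl → trans (∙-congˡ (trans (reflexive (cong pow (Fin.toℕ-fromℕ< (log<N (h ⁻¹ ∙ y))))) (pow-log _)))
                                  (\\-leftDividesˡ h y) })
      }

  module _ {a ℓ′} (M : CommutativeMonoid a ℓ′) where

    private module M = CommutativeMonoid M
    open NatSum M using (Σ<; sum≡Σ<)
    open import Algebra.Properties.CommutativeMonoid.Sum M using (sum; sum-cong-≋; sum-permute)

    module _ (F : Carrier → M.Carrier) (F-cong : ∀ {x y} → x ≈ y → F x M.≈ F y) where

      private
        -- Two enumerations of the group differ by a permutation. Translation invariance of sums is
        -- the case where one enumeration is `translated h`.
        reindex : (I J : HasOrder C N) → sum (λ i → F (Inverse.from I i)) M.≈ sum (λ i → F (Inverse.from J i))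
        reindex I J = M.trans (sum-permute (λ i → F (I.from i)) π)
          (sum-cong-≋ (λ i → F-cong (I.strictlyInverseʳ (J.from i))))
          where
          module I = Inverse I
          module J = Inverse J
          π : Permutation N N
          π = permutation (λ i → I.to (J.from i)) (λ i → J.to (I.from i))
            (λ i → ≡.trans (I.to-cong (J.strictlyInverseʳ (I.from i))) (I.strictlyInverseˡ i))
            (λ i → ≡.trans (J.to-cong (I.strictlyInverseʳ (J.from i))) (J.strictlyInverseˡ i))

      sum-over-powers : sum (λ i → F (element i)) M.≈ Σ< N (λ t → F (pow t))
      sum-over-powers = M.trans (reindex order powers) (M.reflexive (sum≡Σ< N (λ t → F (pow t))))

      sum-translate : ∀ h → Σ< N (λ t → F (h ∙ pow t)) M.≈ Σ< N (λ t → F (pow t))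
      sum-translate h = M.trans (M.reflexive (≡.sym (sum≡Σ< N (λ t → F (h ∙ pow t)))))
        (M.trans (reindex (translated h) powers) (M.reflexive (sum≡Σ< N (λ t → F (pow t)))))

  open GroupRing C order using (ℤG; [_]) renaming (rawRing to ℤC)
  private module ℤC = RawRing ℤC

  module Character {c ℓ₁} (K : CommutativeRing c ℓ₁) (z : CommutativeRing.Carrier K) where

    private module K = CommutativeRing K
    open K using (_+_; _*_; -_; 0#; 1#) renaming (Carrier to 𝕂; _≈_ to _≈ᴷ_)
    open IntegerEmbedding K
    open import Algebra.Properties.Semiring.Exp K.semiring
      using (_^_; ^-homo-*; ^-assocʳ; ^-congˡ; ^-congʳ)
    private module KR where
      open import Relation.Binary.Reasoning.Setoid K.setoid public

    evalG : ℤG → 𝕂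
    evalG u = Σ< N (λ t → ι (u ⟨$⟩ pow t) * z ^ t)

    evalG-+ : ∀ u v → evalG (u ℤC.+ v) ≈ᴷ evalG u + evalG v
    evalG-+ u v = K.trans (Σ<-cong′ N (λ t → K.trans (K.*-congʳ (ι-+ (u ⟨$⟩ pow t) (v ⟨$⟩ pow t))) (K.distribʳ _ _ _)))
                          (Σ<-distrib N _ _)

    evalG-0 : evalG ℤC.0# ≈ᴷ 0#
    evalG-0 = Σ<-zero N (λ _ _ → K.zeroˡ _)

    evalG-neg : ∀ u → evalG (ℤC.- u) ≈ᴷ - evalG u
    evalG-neg u = K.trans (Σ<-cong′ N (λ t → K.trans (K.*-congʳ (K.trans (ι-neg (u ⟨$⟩ pow t)) (K.sym (-1*x≈-x _)))) (K.*-assoc _ _ _)))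
      (K.trans (K.sym (Σ<-*ˡ N (- 1#) _)) (-1*x≈-x _))
      where open import Algebra.Properties.Ring K.ring using (-1*x≈-x)

    evalG-cong : ∀ {u v} → u ℤC.≈ v → evalG u ≈ᴷ evalG v
    evalG-cong u≈v = Σ<-cong′ N (λ t → K.*-congʳ (ι-≡ (u≈v (pow t))))

    module _ (z^N≈1 : z ^ N ≈ᴷ 1#) where

      χ : Carrier → 𝕂
      χ y = z ^ log y

      χ-cong : ∀ {x y} → x ≈ y → χ x ≈ᴷ χ y
      χ-cong x≈y = ^-congʳ z (log-cong x≈y)

      χ-pow : ∀ k → χ (pow k) ≈ᴷ z ^ k
      χ-pow k = K.sym (begin
        z ^ k                             ≈⟨ ^-congʳ z (m≡m%n+[m/n]*n k N) ⟩
        z ^ (k % N ℕ.+ k / N ℕ.* N)       ≈⟨ ^-homo-* z (k % N) _ ⟩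
        z ^ (k % N) * z ^ (k / N ℕ.* N)   ≈⟨ K.*-congˡ one ⟩
        z ^ (k % N) * 1#                  ≈⟨ K.*-identityʳ _ ⟩
        z ^ (k % N)                       ≈⟨ ^-congʳ z (≡.sym (log-pow k)) ⟩
        χ (pow k)                         ∎)
        where
        open KR
        one : z ^ (k / N ℕ.* N) ≈ᴷ 1#
        one = K.trans (^-congʳ z (ℕ.*-comm (k / N) N)) (K.trans (K.sym (^-assocʳ z N (k / N)))
                (K.trans (^-congˡ (k / N) z^N≈1) (1^ (k / N))))

      χ-∙ : ∀ x y → χ (x ∙ y) ≈ᴷ χ x * χ y
      χ-∙ x y = K.trans (χ-cong (trans (∙-cong (sym (pow-log x)) (sym (pow-log y))) (sym (pow-+ (log x) (log y)))))
                  (K.trans (χ-pow (log x ℕ.+ log y)) (^-homo-* z (log x) (log y)))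

      evalG-[] : ∀ y → evalG [ y ] ≈ᴷ χ y
      evalG-[] y = K.trans
        (Σ<-single N (log y) _ (log<N y) (λ t t<N t≢ → K.trans (K.*-congʳ (ι-≡
          (cong (λ b → if b then 1ℤ else 0ℤ) (dec-false (index y Fin.≟ index (pow t))
            (λ eq → t≢ (≡.sym (log-unique t<N (index-injective (≡.sym eq)))))))))
          (K.zeroˡ _)))
        (K.trans (K.*-congʳ (K.trans (ι-≡ (cong (λ b → if b then 1ℤ else 0ℤ)
          (dec-true (index y Fin.≟ index (pow (log y))) (index-cong (sym (pow-log y)))))) ι-1)) (K.*-identityˡ _))

      -- Multiplicativity of χ separates the two factors of the convolution; for fixed s the
      -- substitution y ↦ (c₀ˢ)⁻¹ y is then absorbed by `sum-translate`.
      evalG-* : ∀ u v → evalG (u ℤC.* v) ≈ᴷ evalG u * evalG v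
      evalG-* u v = begin
        Σ< N (λ t → ι ((u ℤC.* v) ⟨$⟩ pow t) * z ^ t)
          ≈⟨ Σ<-cong′ N (λ t → K.*-cong (convolve t) (K.sym (χ-pow t))) ⟩
        Σ< N (λ t → Σ< N (λ s → ι (u ⟨$⟩ pow s) * ι (v ⟨$⟩ (pow s ⁻¹ ∙ pow t))) * χ (pow t))
          ≈⟨ Σ<-cong′ N (λ t → K.trans (Σ<-*ʳ N (χ (pow t)) _) (Σ<-cong′ N (λ s → rearrange s t))) ⟩
        Σ< N (λ t → Σ< N (λ s → ι (u ⟨$⟩ pow s) * χ (pow s) * F (pow s ⁻¹ ∙ pow t)))
          ≈⟨ Σ<-swap N N _ ⟩
        Σ< N (λ s → Σ< N (λ t → ι (u ⟨$⟩ pow s) * χ (pow s) * F (pow s ⁻¹ ∙ pow t)))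
          ≈⟨ Σ<-cong′ N (λ s → K.trans (K.sym (Σ<-*ˡ N _ _)) (K.*-congˡ (sum-translate K.+-commutativeMonoid F F-cong (pow s ⁻¹)))) ⟩
        Σ< N (λ s → ι (u ⟨$⟩ pow s) * χ (pow s) * Σ< N (λ t → F (pow t)))
          ≈⟨ Σ<-*ʳ N _ _ ⟨
        Σ< N (λ s → ι (u ⟨$⟩ pow s) * χ (pow s)) * Σ< N (λ t → F (pow t))
          ≈⟨ K.*-cong (Σ<-cong′ N (λ s → K.*-congˡ (χ-pow s))) (Σ<-cong′ N (λ t → K.*-congˡ (χ-pow t))) ⟩
        evalG u * evalG v ∎
        where
        open KR
        F : Carrier → 𝕂
        F y = ι (v ⟨$⟩ y) * χ y
        F-cong : ∀ {x y} → x ≈ y → F x ≈ᴷ F y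
        F-cong x≈y = K.*-cong (ι-≡ (Func.cong v x≈y)) (χ-cong x≈y)
        convolve : ∀ t → ι ((u ℤC.* v) ⟨$⟩ pow t) ≈ᴷ Σ< N (λ s → ι (u ⟨$⟩ pow s) * ι (v ⟨$⟩ (pow s ⁻¹ ∙ pow t)))
        convolve t = K.trans
          (ι-≡ (sum-over-powers ℤ.+-0-commutativeMonoid (λ y → (u ⟨$⟩ y) ℤ.* (v ⟨$⟩ (y ⁻¹ ∙ pow t)))
             (λ x≈y → ≡.cong₂ ℤ._*_ (Func.cong u x≈y) (Func.cong v (∙-congʳ (⁻¹-cong x≈y))))))
          (K.trans (ι-Σ< N _) (Σ<-cong′ N (λ s → ι-* (u ⟨$⟩ pow s) (v ⟨$⟩ (pow s ⁻¹ ∙ pow t)))))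
        rearrange : ∀ s t → ι (u ⟨$⟩ pow s) * ι (v ⟨$⟩ (pow s ⁻¹ ∙ pow t)) * χ (pow t)
                              ≈ᴷ ι (u ⟨$⟩ pow s) * χ (pow s) * F (pow s ⁻¹ ∙ pow t)
        rearrange s t = K.trans (K.*-congˡ (K.trans (χ-cong (sym (\\-leftDividesˡ (pow s) (pow t)))) (χ-∙ (pow s) _)))
          (solve 4 (λ u v x y → (u :* v) :* (x :* y) := (u :* x) :* (v :* y)) K.refl
             (ι (u ⟨$⟩ pow s)) (ι (v ⟨$⟩ (pow s ⁻¹ ∙ pow t))) (χ (pow s)) (χ (pow s ⁻¹ ∙ pow t)))

-- Lexicographic enumeration of the basis indices

module FlatIndex {p : ℕ} (p-prime : Prime p) where

  open PrimeLevels p-prime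
  open ≡ using (refl; sym; trans)

  private
    applyUpTo-cong : ∀ {A : Set} {f g : ℕ → A} N → (∀ t → t < N → f t ≡ g t) → applyUpTo f N ≡ applyUpTo g N
    applyUpTo-cong zero    _   = refl
    applyUpTo-cong (suc N) f≡g = cong₂ _∷_ (f≡g 0 (s≤s z≤n)) (applyUpTo-cong N (λ t t<N → f≡g (suc t) (s≤s t<N)))

    applyUpTo-+ : ∀ {A : Set} (f : ℕ → A) M N → applyUpTo f (M ℕ.+ N) ≡ applyUpTo f M ++ applyUpTo (λ t → f (M ℕ.+ t)) N
    applyUpTo-+ f zero    N = refl
    applyUpTo-+ f (suc M) N = cong (f 0 ∷_) (applyUpTo-+ (f ∘ suc) M N)

    applyUpTo-const : ∀ {A : Set} (a : A) N → applyUpTo (λ _ → a) N ≡ replicate N a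
    applyUpTo-const a zero    = refl
    applyUpTo-const a (suc N) = cong (a ∷_) (applyUpTo-const a N)

    concatMap-applyUpTo : ∀ {A B : Set} (F : B → List A) (f : ℕ → B) N →
                          concatMap F (applyUpTo f N) ≡ concatMap (F ∘ f) (upTo N)
    concatMap-applyUpTo F f zero    = refl
    concatMap-applyUpTo F f (suc N) = cong (F (f 0) ++_)
      (trans (concatMap-applyUpTo F (f ∘ suc) N) (sym (concatMap-applyUpTo (F ∘ f) suc N)))

  -- The pairs (c , j) with c ∈ [0 , n] and j ∈ [0 , D (n - c) - 1] are listed lexicographically;
  -- offset n c = pⁿ - pⁿ⁻ᶜ is the number of pairs before (c , 0).
  split : ℕ → ℕ → ℕ × ℕ
  split zero    t = 0 , t
  split (suc n) t with t ℕ.<? D (suc n)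
  ... | yes _ = 0 , t
  ... | no _  = map₁ suc (split n (t ∸ D (suc n)))

  offset : ℕ → ℕ → ℕ
  offset n       zero    = 0
  offset zero    (suc c) = 0
  offset (suc n) (suc c) = D (suc n) ℕ.+ offset n c

  split-< : ∀ n t → t < D (suc n) → split (suc n) t ≡ (0 , t)
  split-< n t t<D with t ℕ.<? D (suc n)
  ... | yes _ = refl
  ... | no t≮D = contradiction t<D t≮D

  split-+ : ∀ n t → split (suc n) (D (suc n) ℕ.+ t) ≡ map₁ suc (split n t)
  split-+ n t with D (suc n) ℕ.+ t ℕ.<? D (suc n)
  ... | yes lt = contradiction (ℕ.m≤m+n (D (suc n)) t) (ℕ.<⇒≱ lt)
  ... | no _   = cong (λ k → map₁ suc (split n k)) (ℕ.m+n∸m≡n (D (suc n)) t)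

  split-offset : ∀ n c j → c ≤ n → j < D (n ∸ c) → split n (offset n c ℕ.+ j) ≡ (c , j)
  split-offset zero    zero    j _ _ = refl
  split-offset (suc n) zero    j _ j<D = split-< n j j<D
  split-offset (suc n) (suc c) j (s≤s c≤n) j<D = begin
    split (suc n) (D (suc n) ℕ.+ offset n c ℕ.+ j)   ≡⟨ cong (split (suc n)) (ℕ.+-assoc (D (suc n)) (offset n c) j) ⟩
    split (suc n) (D (suc n) ℕ.+ (offset n c ℕ.+ j)) ≡⟨ split-+ n (offset n c ℕ.+ j) ⟩
    map₁ suc (split n (offset n c ℕ.+ j))            ≡⟨ cong (map₁ suc) (split-offset n c j c≤n j<D) ⟩
    suc c , j ∎
    where open ≡.≡-Reasoning

  ∸D<p^ : ∀ n t → D (suc n) ≤ t → t < p ℕ.^ suc n → t ∸ D (suc n) < p ℕ.^ n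
  ∸D<p^ n t D≤t t<p^ = ℕ.+-cancelˡ-< (D (suc n)) _ _ (ℕ.≤-trans (s≤s (ℕ.≤-reflexive (ℕ.m+[n∸m]≡n D≤t)))
    (ℕ.≤-trans t<p^ (ℕ.≤-reflexive (sym (D+p^ n)))))

  split-bounds : ∀ n t → t < p ℕ.^ n → proj₁ (split n t) ≤ n × proj₂ (split n t) < D (n ∸ proj₁ (split n t))
  split-bounds zero    t t<1 = z≤n , t<1
  split-bounds (suc n) t t<p^ with t ℕ.<? D (suc n)
  ... | yes t<D = z≤n , t<D
  ... | no t≮D  = let (c≤n , j<D) = split-bounds n (t ∸ D (suc n)) (∸D<p^ n t (ℕ.≮⇒≥ t≮D) t<p^) in s≤s c≤n , j<D

  offset-split : ∀ n t → t < p ℕ.^ n → offset n (proj₁ (split n t)) ℕ.+ proj₂ (split n t) ≡ t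
  offset-split zero    t _ = refl
  offset-split (suc n) t t<p^ with t ℕ.<? D (suc n)
  ... | yes _  = refl
  ... | no t≮D = trans (ℕ.+-assoc (D (suc n)) _ _)
    (trans (cong (D (suc n) ℕ.+_) (offset-split n (t ∸ D (suc n)) (∸D<p^ n t (ℕ.≮⇒≥ t≮D) t<p^))) (ℕ.m+[n∸m]≡n (ℕ.≮⇒≥ t≮D)))

  offset-suc : ∀ n c → c < n → offset n (suc c) ≡ offset n c ℕ.+ D (n ∸ c)
  offset-suc (suc n) zero    _ = ℕ.+-identityʳ (D (suc n))
  offset-suc (suc n) (suc c) (s≤s c<n) = trans (cong (D (suc n) ℕ.+_) (offset-suc n c c<n))
    (sym (ℕ.+-assoc (D (suc n)) (offset n c) _))

  offset-< : ∀ n c j → c ≤ n → j < p ℕ.^ (n ∸ c) → offset n c ℕ.+ j < p ℕ.^ n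
  offset-< n       zero    j _ j< = j<
  offset-< (suc n) (suc c) j (s≤s c≤n) j< = ℕ.≤-trans (s≤s (ℕ.≤-reflexive (ℕ.+-assoc (D (suc n)) (offset n c) j)))
    (ℕ.≤-trans (ℕ.+-monoʳ-< (D (suc n)) (offset-< n c j c≤n j<)) (ℕ.≤-reflexive (D+p^ n)))

  split-suc-mono : ∀ n t → proj₁ (split n t) ≤ proj₁ (split n (suc t))
  split-suc-mono zero    t = z≤n
  split-suc-mono (suc n) t with t ℕ.<? D (suc n) | suc t ℕ.<? D (suc n)
  ... | yes _  | _      = z≤n
  ... | no t≮D | yes t<D = contradiction (ℕ.<⇒≤ t<D) t≮D
  ... | no t≮D | no _   = s≤s (≡.subst (λ k → proj₁ (split n (t ∸ D (suc n))) ≤ proj₁ (split n k))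
                                 (sym (ℕ.+-∸-assoc 1 (ℕ.≮⇒≥ t≮D))) (split-suc-mono n (t ∸ D (suc n))))

  module _ {a ℓ} (M : CommutativeMonoid a ℓ) where

    private module M = CommutativeMonoid M
    open NatSum M

    Σ<-flat : ∀ n (f : ℕ → M.Carrier) →
              Σ< (p ℕ.^ n) f M.≈ Σ< (suc n) (λ c → Σ< (D (n ∸ c)) (λ j → f (offset n c ℕ.+ j)))
    Σ<-flat zero    f = M.sym (M.identityʳ _)
    Σ<-flat (suc n) f = M.trans (M.reflexive (cong (λ N → Σ< N f) (sym (D+p^ n))))
      (M.trans (Σ<-split (D (suc n)) (p ℕ.^ n) f)
        (M.∙-congˡ (M.trans (Σ<-flat n (λ t → f (D (suc n) ℕ.+ t)))
          (Σ<-cong′ (suc n) (λ c → Σ<-cong′ (D (n ∸ c)) (λ j →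
            M.reflexive (cong f (sym (ℕ.+-assoc (D (suc n)) (offset n c) j)))))))))

  private
    -- An arbitrary d stands in for c ↦ pᶜ, because the induction on n replaces d by `d ∘ suc`.
    blocks : ∀ n (d : ℕ → ℕ) → concatMap (λ c → replicate (φ (p ℕ.^ (n ∸ c))) (d c)) (upTo (suc n))
                                 ≡ applyUpTo (λ t → d (proj₁ (split n t))) (p ℕ.^ n)
    blocks zero    d = refl
    blocks (suc n) d = begin
      replicate (φ (p ℕ.^ suc n)) (d 0) ++ concatMap F (applyUpTo suc (suc n))
        ≡⟨ cong₂ _++_ (cong (λ k → replicate k (d 0)) (φ≡D (suc n))) (concatMap-applyUpTo F suc (suc n)) ⟩
      replicate (D (suc n)) (d 0) ++ concatMap (F ∘ suc) (upTo (suc n))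
        ≡⟨ cong₂ _++_
             (trans (sym (applyUpTo-const (d 0) (D (suc n))))
                    (applyUpTo-cong (D (suc n)) (λ t t<D → cong (d ∘ proj₁) (sym (split-< n t t<D)))))
             (trans (blocks n (d ∘ suc)) (applyUpTo-cong (p ℕ.^ n) (λ t _ → cong (d ∘ proj₁) (sym (split-+ n t))))) ⟩
      applyUpTo h (D (suc n)) ++ applyUpTo (λ t → h (D (suc n) ℕ.+ t)) (p ℕ.^ n)
        ≡⟨ applyUpTo-+ h (D (suc n)) (p ℕ.^ n) ⟨
      applyUpTo h (D (suc n) ℕ.+ p ℕ.^ n)
        ≡⟨ cong (applyUpTo h) (D+p^ n) ⟩
      applyUpTo h (p ℕ.^ suc n) ∎
      where
      open ≡.≡-Reasoning
      F : ℕ → List ℕ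
      F c = replicate (φ (p ℕ.^ (suc n ∸ c))) (d c)
      h : ℕ → ℕ
      h t = d (proj₁ (split (suc n) t))

  divisor : ℕ → ℕ → ℕ
  divisor n t = p ℕ.^ proj₁ (split n t)

  prescribedDivisors≡ : ∀ n → prescribedDivisors p n ≡ applyUpTo (divisor n) (p ℕ.^ n)
  prescribedDivisors≡ n = blocks n (p ℕ.^_)

  divisors-linked : ∀ n → Linked _∣_ (applyUpTo (divisor n) (p ℕ.^ n))
  divisors-linked n = Linked.applyUpTo⁺₂ (divisor n) (p ℕ.^ n) (λ t → p^∣p^ (split-suc-mono n t))
    where
    p^∣p^ : ∀ {a b} → a ≤ b → p ℕ.^ a ∣ p ℕ.^ b
    p^∣p^ {a} {b} a≤b = ≡.subst (p ℕ.^ a ∣_)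
      (trans (sym (ℕ.^-distribˡ-+-* p a (b ∸ a))) (cong (p ℕ.^_) (ℕ.m+[n∸m]≡n a≤b))) (m∣m*n _)

-- Combinations of the e′_{c,j} in the product of the ℤ[ζᵢ]

module WedderburnLattice {c ℓ} (R : CommutativeRing c ℓ) (char0 : CharacteristicZero R)
  (domain : ∀ {a x} → ¬ CommutativeRing._≈_ R a (CommutativeRing.0# R) →
            CommutativeRing._≈_ R (CommutativeRing._*_ R a x) (CommutativeRing.0# R) →
            CommutativeRing._≈_ R x (CommutativeRing.0# R))
  {p : ℕ} (p-prime : Prime p) (n : ℕ) (ζ : Fin (suc n) → CommutativeRing.Carrier R)
  (ζ-primitive : ∀ i → IsPrimitiveRootOfUnity R (p ℕ.^ toℕ i) (ζ i)) where

  open CommutativeRing R hiding (zero)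
  open PrimeArithmetic p-prime
  open IntegerEmbedding R
  open CyclotomicIntegers R using (S)
  open Cyclotomic R char0 domain p-prime
  open PrimeLevels p-prime
  open Evaluation R p-prime
  open import Algebra.Properties.Semiring.Exp semiring using (_^_; ^-assocʳ; ^-congˡ; ^-congʳ)
  open import Relation.Binary.Reasoning.Setoid setoid

  i≤n : (i : Fin (suc n)) → toℕ i ≤ n
  i≤n i = ℕ.s≤s⁻¹ (Fin.toℕ<n i)

  ζ^≈1 : ∀ i → ζ i ^ (p ℕ.^ toℕ i) ≈ 1#
  ζ^≈1 i = proj₁ (ζ-primitive i)

  ^p^-mono : ∀ {z} m k → m ≤ k → z ^ (p ℕ.^ m) ≈ 1# → z ^ (p ℕ.^ k) ≈ 1#
  ^p^-mono {z} m k m≤k eq = trans (^-congʳ z (≡.trans (cong (p ℕ.^_) (≡.sym (ℕ.m+[n∸m]≡n m≤k))) (ℕ.^-distribˡ-+-* p m (k ∸ m))))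
    (trans (sym (^-assocʳ z (p ℕ.^ m) (p ℕ.^ (k ∸ m)))) (trans (^-congˡ (p ℕ.^ (k ∸ m)) eq) (1^ (p ℕ.^ (k ∸ m)))))

  ζ^p^n≈1 : ∀ i → ζ i ^ (p ℕ.^ n) ≈ 1#
  ζ^p^n≈1 i = ^p^-mono (toℕ i) n (i≤n i) (ζ^≈1 i)

  ζ^≉1 : ∀ i m → m < toℕ i → ¬ ζ i ^ (p ℕ.^ m) ≈ 1#
  ζ^≉1 i m m<i = proj₂ (ζ-primitive i) (p ℕ.^ m) (0<p^ m) (ℕ.^-monoʳ-< p prime>1 m<i)

  ζ-cyclotomic : ∀ i → CyclotomicAt (toℕ i) (ζ i)
  ζ-cyclotomic i = ζ^≈1 i , λ k k+1≡i → cyclotomic-relation (ζ i) k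
    (≡.subst (λ m → ζ i ^ (p ℕ.^ m) ≈ 1#) (≡.sym k+1≡i) (ζ^≈1 i)) (ζ^≉1 i k (ℕ.≤-reflexive k+1≡i))

  ζ-span : ∀ i {x} → S (ζ i) x → ∃ λ f → x ≈ ev (D (toℕ i)) f (ζ i)
  ζ-span i {x} x∈ = ≡.subst (λ N → ∃ λ f → x ≈ ev N f (ζ i)) (φ≡D (toℕ i)) (powers-span (toℕ i) (ζ i) (ζ-primitive i) x∈)

  ev-neg : ∀ N f z → ev N (λ t → ℤ.- f t) z ≈ - ev N f z
  ev-neg N f z = trans (Σ<-cong′ N (λ t → trans (*-congʳ (ι-neg (f t)))
      (solve 2 (λ a b → (:- a) :* b := (:- con 1ℤ) :* (a :* b)) refl (ι (f t)) (z ^ t))))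
    (trans (sym (Σ<-*ˡ N (- ι 1ℤ) _)) (trans (*-congʳ (-‿cong ι-1))
      (trans (solve 2 (λ e x → (:- e) :* x := :- (e :* x)) refl 1# (ev N f z)) (-‿cong (*-identityˡ _)))))

  ζ-independent : ∀ i f g → ev (D (toℕ i)) f (ζ i) ≈ ev (D (toℕ i)) g (ζ i) → ∀ t → t < D (toℕ i) → f t ≡ g t
  ζ-independent i f g eq t t<D = ℤ.i-j≡0⇒i≡j (f t) (g t)
    (≡.subst (λ N → ev N h (ζ i) ≈ 0# → ∀ t → t < N → h t ≡ 0ℤ) (φ≡D (toℕ i))
      (powers-independent (toℕ i) (ζ i) (ζ-primitive i) h) difference t t<D)
    where
    h : ℕ → ℤ
    h t = f t ℤ.- g t
    difference : ev (D (toℕ i)) h (ζ i) ≈ 0#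
    difference = trans (ev-+ (D (toℕ i)) f (λ t → ℤ.- g t) (ζ i))
      (trans (+-cong eq (ev-neg (D (toℕ i)) g (ζ i))) (-‿inverseʳ _))

  -- The i-th component of the combination with coefficients a of the elements e′_{c,j},
  -- where e′_{c,j} has i-th component ζᵢʲ for i ≤ n - c and 0 otherwise.
  comb : (ℕ → ℕ → ℤ) → Fin (suc n) → Carrier
  comb a i = Σ< (suc (n ∸ toℕ i)) (λ c → ev (D (n ∸ c)) (a c) (ζ i))

  codegree≤ : ∀ (i : Fin (suc n)) {c} → c < suc (n ∸ toℕ i) → c ≤ n
  codegree≤ i c< = ℕ.≤-trans (ℕ.s≤s⁻¹ c<) (ℕ.m∸n≤m n (toℕ i))

  comb-cong : ∀ {a b} → (∀ c → c ≤ n → ∀ j → j < D (n ∸ c) → a c j ≡ b c j) → ∀ i → comb a i ≈ comb b i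
  comb-cong a≡b i = Σ<-cong (suc (n ∸ toℕ i)) (λ c c< → ev-cong (D (n ∸ c)) (ζ i) (a≡b c (codegree≤ i c<)))

  -- The component i = n - c involves only codegrees up to c, and its last block is a combination of
  -- independent powers of ζᵢ. Course-of-values induction on c removes the earlier blocks.
  comb-independent : ∀ {a b} → (∀ i → comb a i ≈ comb b i) → ∀ c → c ≤ n → ∀ j → j < D (n ∸ c) → a c j ≡ b c j
  comb-independent {a} {b} eq c c≤n = below (suc c) c (ℕ.n<1+n c) c≤n
    where
    below : ∀ k c → c < k → c ≤ n → ∀ j → j < D (n ∸ c) → a c j ≡ b c j
    below (suc k) c c<k c≤n j j<D = ζ-independent i (a c) (b c) top-equal j (≡.subst (λ m → j < D m) (≡.sym toℕ-i) j<D)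
      where
      i : Fin (suc n)
      i = fromℕ< (s≤s (ℕ.m∸n≤m n c))
      toℕ-i : toℕ i ≡ n ∸ c
      toℕ-i = Fin.toℕ-fromℕ< (s≤s (ℕ.m∸n≤m n c))
      n∸i : n ∸ toℕ i ≡ c
      n∸i = ≡.trans (cong (n ∸_) toℕ-i) (ℕ.m∸[m∸n]≡n c≤n)
      T : (ℕ → ℕ → ℤ) → ℕ → Carrier
      T a c = ev (D (n ∸ c)) (a c) (ζ i)
      comb-last : ∀ a → comb a i ≈ Σ< c (T a) + ev (D (toℕ i)) (a c) (ζ i)
      comb-last a = trans (reflexive (cong (λ k → Σ< (suc k) (T a)) n∸i)) (trans (Σ<-last c (T a))
        (+-congˡ (reflexive (cong (λ m → ev (D m) (a c) (ζ i)) (≡.sym toℕ-i)))))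
      lower-equal : Σ< c (T a) ≈ Σ< c (T b)
      lower-equal = Σ<-cong c (λ c′ c′<c → ev-cong (D (n ∸ c′)) (ζ i)
        (below k c′ (ℕ.≤-trans c′<c (ℕ.s≤s⁻¹ c<k)) (ℕ.≤-trans (ℕ.<⇒≤ c′<c) c≤n)))
      top-equal : ev (D (toℕ i)) (a c) (ζ i) ≈ ev (D (toℕ i)) (b c) (ζ i)
      top-equal = +-cancelˡ (Σ< c (T a)) _ _ (begin
        Σ< c (T a) + ev (D (toℕ i)) (a c) (ζ i)   ≈⟨ comb-last a ⟨
        comb a i                                  ≈⟨ eq i ⟩
        comb b i                                  ≈⟨ comb-last b ⟩
        Σ< c (T b) + ev (D (toℕ i)) (b c) (ζ i)   ≈⟨ +-congʳ lower-equal ⟨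
        Σ< c (T a) + ev (D (toℕ i)) (b c) (ζ i)   ∎)
        where open import Algebra.Properties.Group +-group using () renaming (∙-cancelˡ to +-cancelˡ)

  module _ (x : ℕ → ℕ → ℤ) (x-vanishes : ∀ m j → D m ≤ j → x m j ≡ 0ℤ) where

    open Folding n x using (G)

    ev-family : ∀ i → ev (D (toℕ i)) (x (toℕ i)) (ζ i) ≈ comb (λ c → G (n ∸ c)) i
    ev-family i = ev-x n x x-vanishes (n ∸ toℕ i) (toℕ i) (ℕ.m∸n+n≡m (i≤n i)) (ζ i) (ζ-cyclotomic i)

  scaled : (ℕ → ℕ → ℤ) → ℕ → ℕ → ℤ
  scaled a c j = + (p ℕ.^ c) ℤ.* a c j

  scaled-injective : ∀ {a b} c j → scaled a c j ≡ scaled b c j → a c j ≡ b c j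
  scaled-injective {a} {b} c j = ℤ.*-cancelˡ-≡ (+ (p ℕ.^ c)) (a c j) (b c j) {{ℕ.m^n≢0 p c {{p-nonZero}}}}

  -- The sum over the subgroup of order pᶜ at the i-th character: θ, the value at a generator of
  -- this subgroup, is 1 for i ≤ n - c and a nontrivial root of unity otherwise.
  geometric-ζ : ∀ i c → c ≤ n →
    (c < suc (n ∸ toℕ i) → Σ< (p ℕ.^ c) ((ζ i ^ (p ℕ.^ (n ∸ c))) ^_) ≈ ι (+ (p ℕ.^ c))) ×
    (suc (n ∸ toℕ i) ≤ c → Σ< (p ℕ.^ c) ((ζ i ^ (p ℕ.^ (n ∸ c))) ^_) ≈ 0#)
  geometric-ζ i c c≤n = full , vanishing
    where
    θ = ζ i ^ (p ℕ.^ (n ∸ c))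
    full : c < suc (n ∸ toℕ i) → Σ< (p ℕ.^ c) (θ ^_) ≈ ι (+ (p ℕ.^ c))
    full c< = geometric-1 (p ℕ.^ c) (^p^-mono (toℕ i) (n ∸ c)
      (≡.subst (_≤ n ∸ c) (ℕ.m∸[m∸n]≡n (i≤n i)) (ℕ.∸-monoʳ-≤ n (ℕ.s≤s⁻¹ c<))) (ζ^≈1 i))
    vanishing : suc (n ∸ toℕ i) ≤ c → Σ< (p ℕ.^ c) (θ ^_) ≈ 0#
    vanishing <c = domain θ-1≉0 (trans (geometric (p ℕ.^ c) θ) (trans (+-congʳ θ^≈1) (-‿inverseʳ 1#)))
      where
      n∸c<i : n ∸ c < toℕ i
      n∸c<i = ℕ.≤-trans (ℕ.∸-monoʳ-< <c c≤n) (ℕ.≤-reflexive (ℕ.m∸[m∸n]≡n (i≤n i)))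
      θ-1≉0 : ¬ θ - 1# ≈ 0#
      θ-1≉0 eq = ζ^≉1 i (n ∸ c) n∸c<i (trans (solve 2 (λ x e → x := e :+ (x :- e)) refl θ 1#) (trans (+-congˡ eq) (+-identityʳ _)))
      θ^≈1 : θ ^ (p ℕ.^ c) ≈ 1#
      θ^≈1 = trans (^-assocʳ (ζ i) (p ℕ.^ (n ∸ c)) (p ℕ.^ c)) (trans (^-congʳ (ζ i)
        (≡.trans (≡.sym (ℕ.^-distribˡ-+-* p (n ∸ c) c)) (cong (p ℕ.^_) (ℕ.m∸n+n≡m c≤n)))) (ζ^p^n≈1 i))

-- The basis e_{c,j} of the group ring

module GroupLattice {g ℓ} {p : ℕ} (p-prime : Prime p) (n : ℕ) (C : Group g ℓ) (order : HasOrder C (p ℕ.^ n))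
  (c₀ : Group.Carrier C) (generates : Generates C c₀) where

  open PrimeLevels p-prime
  open FlatIndex p-prime
  open CyclicGroup C (0<p^ n) order c₀ generates public
  open GroupRing C order using (ℤG) renaming (rawRing to ℤC)
  private
    module C = Group C
    module ℤC = RawRing ℤC

  mod-<p^ : ∀ t m → [ t ]mod m < p ℕ.^ m
  mod-<p^ t m = m%n<n t (p ℕ.^ m) {{ℕ.m^n≢0 p m {{p-nonZero}}}}

  mod-mod : ∀ t {k m} → k ≤ m → [ [ t ]mod m ]mod k ≡ [ t ]mod k
  mod-mod t {k} {m} k≤m = m∣n⇒o%n%m≡o%m (p ℕ.^ k) (p ℕ.^ m) t
    {{ℕ.m^n≢0 p k {{p-nonZero}}}} {{ℕ.m^n≢0 p m {{p-nonZero}}}}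
    (≡.subst (p ℕ.^ k ∣_) (≡.trans (≡.sym (ℕ.^-distribˡ-+-* p k (m ∸ k))) (cong (p ℕ.^_) (ℕ.m+[n∸m]≡n k≤m))) (m∣m*n _))

  -- The elements e_{c,j} = Σ_k c₀^(j + k pⁿ⁻ᶜ).
  e : ℕ → ℕ → ℤG
  e c j = record
    { to   = λ y → δ ([ log y ]mod (n ∸ c)) j
    ; cong = λ x≈y → cong (λ t → δ ([ t ]mod (n ∸ c)) j) (log-cong x≈y)
    }

  value : (ℕ → ℕ → ℤ) → ℕ → ℤ
  value a t = Σℤ (suc n) (λ c → Σℤ (D (n ∸ c)) (λ j → a c j ℤ.* δ ([ t ]mod (n ∸ c)) j))

  -- The combination Σ a_{c,j} e_{c,j}, given by its values in order to avoid sums inside the group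
  -- ring.
  U : (ℕ → ℕ → ℤ) → ℤG
  U a = record { to = λ y → value a (log y) ; cong = λ x≈y → cong (value a) (log-cong x≈y) }

  U-cong : ∀ {a b} → (∀ c → c ≤ n → ∀ j → j < D (n ∸ c) → a c j ≡ b c j) → U a ℤC.≈ U b
  U-cong a≡b y = Σℤ-cong (suc n) (λ c c≤n → Σℤ-cong (D (n ∸ c)) (λ j j<D →
    cong (λ k → k ℤ.* δ ([ log y ]mod (n ∸ c)) j) (a≡b c (ℕ.s≤s⁻¹ c≤n) j j<D)))

  module _ (u : ℤG) where

    private
      -- For c ≤ n these are the values of u at the last pⁿ⁻ᶜ powers of c₀. The value 0 at c = n + 1
      -- terminates the telescoping sum in `U-coordinates`.
      v : ℕ → ℕ → ℤ
      v c j = if does (c ℕ.≤? n) then (u ⟨$⟩ pow (offset n c ℕ.+ j)) else 0ℤ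

    -- Extend each `v c` periodically modulo pⁿ⁻ᶜ. For c = 0 this is u, so u is the telescoping sum
    -- of the differences for consecutive c. On the residues j ≥ D (n - c) the two extensions agree,
    -- hence the c-th difference is a combination of the e_{c,j} with j < D (n - c).
    coordinates : ℕ → ℕ → ℤ
    coordinates c j = v c j ℤ.- v (suc c) ([ j ]mod (n ∸ suc c))

    private
      coordinates-vanish : ∀ c r → c ≤ n → D (n ∸ c) ≤ r → r < p ℕ.^ (n ∸ c) → coordinates c r ≡ 0ℤ
      coordinates-vanish c r c≤n D≤r r< with ℕ.m≤n⇒m<n∨m≡n c≤n
      -- For c = n the only residue is 0, and it lies below D 0 = 1.
      ... | inj₂ ≡.refl = contradiction (≡.subst (λ k → r < p ℕ.^ k) (ℕ.n∸n≡0 n) r<)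
                            (ℕ.≤⇒≯ (≡.subst (λ k → D k ≤ r) (ℕ.n∸n≡0 n) D≤r))
      ... | inj₁ c<n = ℤ.i≡j⇒i-j≡0 (≡.trans
          (cong (λ b → if b then (u ⟨$⟩ pow (offset n c ℕ.+ r)) else 0ℤ)
             (≡.trans (dec-true (c ℕ.≤? n) c≤n) (≡.sym (dec-true (suc c ℕ.≤? n) c<n))))
          (cong (λ k → if does (suc c ℕ.≤? n) then (u ⟨$⟩ pow k) else 0ℤ) (≡.sym index≡)))
        where
        m = n ∸ suc c
        n∸c : n ∸ c ≡ suc m
        n∸c = ≡.trans (ℕ.+-∸-assoc 1 c<n) ≡.refl
        index≡ : offset n (suc c) ℕ.+ [ r ]mod m ≡ offset n c ℕ.+ r
        index≡ = begin
          offset n (suc c) ℕ.+ [ r ]mod m              ≡⟨ cong (ℕ._+ [ r ]mod m) (offset-suc n c c<n) ⟩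
          offset n c ℕ.+ D (n ∸ c) ℕ.+ [ r ]mod m      ≡⟨ ℕ.+-assoc (offset n c) _ _ ⟩
          offset n c ℕ.+ (D (n ∸ c) ℕ.+ [ r ]mod m)    ≡⟨ cong (offset n c ℕ.+_) (≡.trans (ℕ.+-comm (D (n ∸ c)) _) (cong (λ k → [ r ]mod m ℕ.+ D k) n∸c)) ⟩
          offset n c ℕ.+ top m r                       ≡⟨ cong (offset n c ℕ.+_) (top-fixed m r
                                                            (≡.subst (λ k → D k ≤ r) n∸c D≤r) (≡.subst (λ k → r < p ℕ.^ k) n∸c r<)) ⟩
          offset n c ℕ.+ r                             ∎
          where open ≡.≡-Reasoning

      pick : ∀ N (f : ℕ → ℤ) r → (N ≤ r → f r ≡ 0ℤ) → Σℤ N (λ j → f j ℤ.* δ r j) ≡ f r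
      pick N f r f≡0 with r ℕ.<? N
      ... | yes r<N = ≡.trans (Σℤ-single N r (λ j → f j ℤ.* δ r j) r<N
              (λ k _ k≢r → ≡.trans (cong (λ d → f k ℤ.* d) (δ-≢ (λ r≡k → k≢r (≡.sym r≡k)))) (ℤ.*-zeroʳ (f k))))
              (≡.trans (cong (λ d → f r ℤ.* d) (δ-refl r)) (ℤ.*-identityʳ (f r)))
      ... | no r≮N = ≡.trans (Σℤ-zero N (λ k k<N → ≡.trans (cong (λ d → f k ℤ.* d)
              (δ-≢ (λ r≡k → r≮N (≡.subst (_< N) (≡.sym r≡k) k<N)))) (ℤ.*-zeroʳ (f k))))
              (≡.sym (f≡0 (ℕ.≮⇒≥ r≮N)))

      telescope : ∀ N (w : ℕ → ℤ) → Σℤ N (λ c → w c ℤ.- w (suc c)) ≡ w 0 ℤ.- w N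
      telescope zero    w = ≡.sym (ℤ.+-inverseʳ (w 0))
      telescope (suc N) w = ≡.trans (cong (λ a → w 0 ℤ.- w 1 ℤ.+ a) (telescope N (λ c → w (suc c)))) (cancel (w 0) (w 1) (w (suc N)))
        where
        cancel : ∀ a b d → a ℤ.- b ℤ.+ (b ℤ.- d) ≡ a ℤ.- d
        cancel = ℤ-solve 3 (λ a b d → a ℤ:- b ℤ:+ (b ℤ:- d) ℤ:= a ℤ:- d) ≡.refl

    U-coordinates : U coordinates ℤC.≈ u
    U-coordinates y = begin
      value coordinates t
        ≡⟨ Σℤ-cong (suc n) (λ c c≤n → pick (D (n ∸ c)) (coordinates c) ([ t ]mod (n ∸ c))
             (λ D≤r → coordinates-vanish c _ (ℕ.s≤s⁻¹ c≤n) D≤r (mod-<p^ t (n ∸ c)))) ⟩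
      Σℤ (suc n) (λ c → coordinates c ([ t ]mod (n ∸ c)))
        ≡⟨ Σℤ-cong′ (suc n) (λ c → cong (λ r → v c ([ t ]mod (n ∸ c)) ℤ.- v (suc c) r) (mod-mod t (ℕ.∸-monoʳ-≤ n (ℕ.n≤1+n c)))) ⟩
      Σℤ (suc n) (λ c → w c ℤ.- w (suc c))
        ≡⟨ telescope (suc n) w ⟩
      w 0 ℤ.- w (suc n)
        ≡⟨ cong₂ ℤ._-_ (cong (λ k → u ⟨$⟩ pow k) (mod-< {n} (log<N y)))
                       (cong (λ b → if b then (u ⟨$⟩ pow (offset n (suc n) ℕ.+ [ t ]mod (n ∸ suc n))) else 0ℤ) (dec-false (suc n ℕ.≤? n) (ℕ.n≮n n))) ⟩
      (u ⟨$⟩ pow t) ℤ.- 0ℤ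
        ≡⟨ ℤ.+-identityʳ _ ⟩
      u ⟨$⟩ pow t
        ≡⟨ Func.cong u (pow-log y) ⟩
      u ⟨$⟩ y ∎
      where
      open ≡.≡-Reasoning
      t = log y
      w : ℕ → ℤ
      w c = v c ([ t ]mod (n ∸ c))

-- Values of group ring elements at the roots of unity

module ImageLattice {g ℓ c ℓ₁} {p : ℕ} (p-prime : Prime p) (n : ℕ) (C : Group g ℓ) (order : HasOrder C (p ℕ.^ n))
  (c₀ : Group.Carrier C) (generates : Generates C c₀)
  (R : CommutativeRing c ℓ₁) (char0 : CharacteristicZero R)
  (domain : ∀ {a x} → ¬ CommutativeRing._≈_ R a (CommutativeRing.0# R) →
            CommutativeRing._≈_ R (CommutativeRing._*_ R a x) (CommutativeRing.0# R) →
            CommutativeRing._≈_ R x (CommutativeRing.0# R))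
  (ζ : Fin (suc n) → CommutativeRing.Carrier R)
  (ζ-primitive : ∀ i → IsPrimitiveRootOfUnity R (p ℕ.^ toℕ i) (ζ i)) where

  open CommutativeRing R hiding (zero)
  open IntegerEmbedding R
  open PrimeLevels p-prime
  open Evaluation R p-prime
  open GroupLattice p-prime n C order c₀ generates
  open WedderburnLattice R char0 domain p-prime n ζ ζ-primitive
  open GroupRing C order using () renaming (rawRing to ℤC)
  open import Algebra.Properties.Semiring.Exp semiring using (_^_)
  open import Relation.Binary.Reasoning.Setoid setoid

  module At (i : Fin (suc n)) = Character R (ζ i)

  γ : Fin (suc n) → ℕ → Carrier
  γ i c = Σ< (p ℕ.^ c) ((ζ i ^ (p ℕ.^ (n ∸ c))) ^_)

  ev-indicator : ∀ i c j → c ≤ n → j < D (n ∸ c) →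
                 ev (p ℕ.^ n) (λ t → δ ([ t ]mod (n ∸ c)) j) (ζ i) ≈ γ i c * ζ i ^ j
  ev-indicator i c j c≤n j<D = begin
    ev (p ℕ.^ n) f z
      ≡⟨ cong (λ N → ev N f z) p^n ⟩
    ev (p ℕ.^ c ℕ.* Q) f z
      ≈⟨ ev-blocks (p ℕ.^ c) Q f z ⟩
    Σ< Q (λ s → Σ< (p ℕ.^ c) (λ k → ι (f (s ℕ.+ k ℕ.* Q)) * (z ^ Q) ^ k) * z ^ s)
      ≈⟨ Σ<-cong Q (λ s s<Q → *-congʳ (trans
           (Σ<-cong′ (p ℕ.^ c) (λ k → *-congʳ (ι-≡ (cong (λ r → δ r j) (mod-+k* (n ∸ c) s k s<Q)))))
           (sym (Σ<-*ˡ (p ℕ.^ c) (ι (δ s j)) _)))) ⟩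
    Σ< Q (λ s → ι (δ s j) * γ i c * z ^ s)
      ≈⟨ Σ<-single Q j _ (ℕ.≤-trans j<D (D≤p^ (n ∸ c)))
           (λ s _ s≢j → trans (*-congʳ (trans (*-congʳ (ι-≡ (δ-≢ s≢j))) (zeroˡ _))) (zeroˡ _)) ⟩
    ι (δ j j) * γ i c * z ^ j
      ≈⟨ *-congʳ (trans (*-congʳ (trans (ι-≡ (δ-refl j)) ι-1)) (*-identityˡ _)) ⟩
    γ i c * z ^ j ∎
    where
    z = ζ i
    Q = p ℕ.^ (n ∸ c)
    f : ℕ → ℤ
    f t = δ ([ t ]mod (n ∸ c)) j
    p^n : p ℕ.^ n ≡ p ℕ.^ c ℕ.* Q
    p^n = ≡.trans (cong (p ℕ.^_) (≡.sym (ℕ.m+[n∸m]≡n c≤n))) (ℕ.^-distribˡ-+-* p c (n ∸ c))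

  ι-Σ<Σ<-* : ∀ M (size : ℕ → ℕ) (f : ℕ → ℕ → ℤ) x →
    ι (Σℤ M (λ c → Σℤ (size c) (f c))) * x ≈ Σ< M (λ c → Σ< (size c) (λ j → ι (f c j) * x))
  ι-Σ<Σ<-* M size f x = trans (*-congʳ (trans (ι-Σ< M _) (Σ<-cong′ M (λ c → ι-Σ< (size c) (f c)))))
    (trans (Σ<-*ʳ M x _) (Σ<-cong′ M (λ c → Σ<-*ʳ (size c) x _)))

  evalG-U : ∀ a i → At.evalG i (U a) ≈ comb (scaled a) i
  evalG-U a i = begin
    Σ< N (λ t → ι (value a (log (pow t))) * z ^ t)
      ≈⟨ Σ<-cong N (λ t t<N → expand t (log-unique t<N (Group.refl C))) ⟩
    Σ< N (λ t → Σ< (suc n) (λ c → Σ< (D (n ∸ c)) (λ j → ι (a c j) * (ι (δ ([ t ]mod (n ∸ c)) j) * z ^ t))))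
      ≈⟨ Σ<-swap N (suc n) (λ t c → Σ< (D (n ∸ c)) (λ j → ι (a c j) * (ι (δ ([ t ]mod (n ∸ c)) j) * z ^ t))) ⟩
    Σ< (suc n) (λ c → Σ< N (λ t → Σ< (D (n ∸ c)) (λ j → ι (a c j) * (ι (δ ([ t ]mod (n ∸ c)) j) * z ^ t))))
      ≈⟨ Σ<-cong (suc n) (λ c c≤n → trans (Σ<-swap N (D (n ∸ c)) _) (trans
           (Σ<-cong (D (n ∸ c)) (λ j j<D → trans (sym (Σ<-*ˡ N (ι (a c j)) _))
             (trans (*-congˡ (ev-indicator i c j (ℕ.s≤s⁻¹ c≤n) j<D))
                    (solve 3 (λ a g x → a :* (g :* x) := g :* (a :* x)) refl (ι (a c j)) (γ i c) (z ^ j)))))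
           (sym (Σ<-*ˡ (D (n ∸ c)) (γ i c) _)))) ⟩
    Σ< (suc n) T
      -- The sum is cut after c = n - i: up to there γ equals pᶜ, beyond it γ vanishes.
      ≡⟨ cong (λ k → Σ< k T) (≡.sym (cong suc (ℕ.m∸n+n≡m (i≤n i)))) ⟩
    Σ< (suc (n ∸ toℕ i) ℕ.+ toℕ i) T
      ≈⟨ Σ<-split (suc (n ∸ toℕ i)) (toℕ i) T ⟩
    Σ< (suc (n ∸ toℕ i)) T + Σ< (toℕ i) (λ k → T (suc (n ∸ toℕ i) ℕ.+ k))
      ≈⟨ +-cong (Σ<-cong (suc (n ∸ toℕ i)) (λ c c< → full c c<))
                (Σ<-zero (toℕ i) (λ k k<i → trans (*-congʳ (proj₂ (geometric-ζ i (suc (n ∸ toℕ i) ℕ.+ k) (upper k k<i))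
                   (ℕ.m≤m+n (suc (n ∸ toℕ i)) k))) (zeroˡ _))) ⟩
    comb (scaled a) i + 0#
      ≈⟨ +-identityʳ _ ⟩
    comb (scaled a) i ∎
    where
    N = p ℕ.^ n
    z = ζ i
    T : ℕ → Carrier
    T c = γ i c * ev (D (n ∸ c)) (a c) z
    upper : ∀ k → k < toℕ i → suc (n ∸ toℕ i) ℕ.+ k ≤ n
    upper k k<i = ℕ.≤-trans (ℕ.≤-reflexive (≡.sym (ℕ.+-suc (n ∸ toℕ i) k)))
      (ℕ.≤-trans (ℕ.+-monoʳ-≤ (n ∸ toℕ i) k<i) (ℕ.≤-reflexive (ℕ.m∸n+n≡m (i≤n i))))
    full : ∀ c → c < suc (n ∸ toℕ i) → T c ≈ ev (D (n ∸ c)) (scaled a c) z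
    full c c< = trans (*-congʳ (proj₁ (geometric-ζ i c (codegree≤ i c<)) c<))
      (trans (Σ<-*ˡ (D (n ∸ c)) (ι (+ (p ℕ.^ c))) _)
        (Σ<-cong′ (D (n ∸ c)) (λ j → trans (sym (*-assoc _ _ _)) (*-congʳ (sym (ι-* (+ (p ℕ.^ c)) (a c j)))))))
    expand : ∀ t {t′} → t′ ≡ t → ι (value a t′) * z ^ t
             ≈ Σ< (suc n) (λ c → Σ< (D (n ∸ c)) (λ j → ι (a c j) * (ι (δ ([ t ]mod (n ∸ c)) j) * z ^ t)))
    expand t ≡.refl = trans (ι-Σ<Σ<-* (suc n) (λ c → D (n ∸ c)) (λ c j → a c j ℤ.* δ ([ t ]mod (n ∸ c)) j) (z ^ t))
      (Σ<-cong′ (suc n) (λ c → Σ<-cong′ (D (n ∸ c)) (λ j →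
         trans (*-congʳ {z ^ t} (ι-* (a c j) (δ ([ t ]mod (n ∸ c)) j))) (*-assoc _ _ (z ^ t)))))

  evalG-coordinates : ∀ u i → At.evalG i u ≈ comb (scaled (coordinates u)) i
  evalG-coordinates u i = trans (At.evalG-cong i {u} {U (coordinates u)} (λ y → ≡.sym (U-coordinates u y))) (evalG-U (coordinates u) i)

  evalG-injective : ∀ u v → (∀ i → At.evalG i u ≈ At.evalG i v) → RawRing._≈_ ℤC u v
  evalG-injective u v eq y = ≡.trans (≡.sym (U-coordinates u y)) (≡.trans
    (U-cong (λ c c≤n j j<D → scaled-injective {coordinates u} {coordinates v} c j
      (comb-independent {scaled (coordinates u)} {scaled (coordinates v)}
        (λ i → trans (sym (evalG-coordinates u i)) (trans (eq i) (evalG-coordinates v i))) c c≤n j j<D)) y)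
    (U-coordinates v y))

-- From the congruences to the coordinates G

module FamilyEntries {p : ℕ} (p-prime : Prime p) (n : ℕ) where

  open PrimeLevels p-prime
  open Coefficients p n {{prime⇒nonZero p-prime}}

  entry-in-range : ∀ x {m j} (m< : m < suc n) (j< : j < φ (p ℕ.^ toℕ (fromℕ< m<))) →
                   entry x m j ≡ x (fromℕ< m<) (fromℕ< j<)
  entry-in-range x {m} {j} m< j< with m ℕ.<? suc n
  ... | no m≮ = contradiction m< m≮
  ... | yes m<′ with j ℕ.<? φ (p ℕ.^ toℕ (fromℕ< m<′))
  ...   | no j≮ = contradiction j< j≮
  ...   | yes _ = ≡.refl

  entry-toℕ : ∀ x i (k : Fin (φ (p ℕ.^ toℕ i))) → entry x (toℕ i) (toℕ k) ≡ x i k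
  entry-toℕ x i k = ≡.trans (entry-in-range x i< k<) (transport (fromℕ< i<) i≡ k<)
    where
    i< : toℕ i < suc n
    i< = Fin.toℕ<n i
    i≡ : fromℕ< i< ≡ i
    i≡ = Fin.fromℕ<-toℕ i i<
    k< : toℕ k < φ (p ℕ.^ toℕ (fromℕ< i<))
    k< = ≡.subst (λ i′ → toℕ k < φ (p ℕ.^ toℕ i′)) (≡.sym i≡) (Fin.toℕ<n k)
    transport : ∀ i′ → i′ ≡ i → (k<′ : toℕ k < φ (p ℕ.^ toℕ i′)) → x i′ (fromℕ< k<′) ≡ x i k
    transport i′ ≡.refl k<′ = cong (x i) (Fin.fromℕ<-toℕ k k<′)

  entry-vanishes : ∀ x m j → D m ≤ j → entry x m j ≡ 0ℤ
  entry-vanishes x m j D≤j with m ℕ.<? suc n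
  ... | no _ = ≡.refl
  ... | yes m< with j ℕ.<? φ (p ℕ.^ toℕ (fromℕ< m<))
  ...   | no _ = ≡.refl
  ...   | yes j< = contradiction D≤j (ℕ.<⇒≱ (≡.subst (j <_)
            (≡.trans (φ≡D (toℕ (fromℕ< m<))) (cong D (Fin.toℕ-fromℕ< m<))) j<))

  module _ (x : Family) where

    open Folding n (entry x)

    private
      inner′ : ℕ → ℕ → ℕ → ℤ
      inner′ l j i = Σℤ (p ∸ 1) (λ k → entry x (n ∸ i)
        (([ j ]mod (n ∸ l ∸ 1) ℕ.+ suc k ℕ.* p ℕ.^ (n ∸ 1 ∸ i)) ∸ p ℕ.^ (n ∸ l ∸ 1)))

      -- The second double sum as it stands in the congruences. It is identified with `R` at the top
      -- only for l < n; for l = n its exponent is truncated, but it is multiplied by 0.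
      R′ : ℕ → ℕ → ℤ
      R′ l j = Σℤ l (λ i → + (p ℕ.^ (l ∸ 1 ∸ i)) ℤ.* inner′ l j i)

      rhs : ℕ → ℕ → ℤ
      rhs l j = ∑[ 0 , l ∸ 1 ] (λ i →
          + (p ℕ.^ (l ∸ 1 ∸ i)) ℤ.*
          ∑[ 1 , p ∸ 1 ] (λ k →
            entry x (n ∸ i) ((j ℕ.+ k ℕ.* p ℕ.^ (n ∸ 1 ∸ i)) ∸ p ℕ.^ (n ∸ l))
            ℤ.- (1ℤ ℤ.- δ l n) ℤ.*
              entry x (n ∸ i)
                (([ j ]mod-p^ (n ∸ l ∸ 1) ℕ.+ k ℕ.* p ℕ.^ (n ∸ 1 ∸ i)) ∸ p ℕ.^ (n ∸ l ∸ 1))))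

      Σℤ-linear : ∀ N e (f h : ℕ → ℤ) → Σℤ N (λ k → f k ℤ.- e ℤ.* h k) ≡ Σℤ N f ℤ.- e ℤ.* Σℤ N h
      Σℤ-linear zero    e f h = ≡.sym (cong (λ a → 0ℤ ℤ.- a) (ℤ.*-zeroʳ e))
      Σℤ-linear (suc N) e f h = ≡.trans (cong (λ a → f 0 ℤ.- e ℤ.* h 0 ℤ.+ a) (Σℤ-linear N e (λ k → f (suc k)) (λ k → h (suc k))))
        (regroup (f 0) e (h 0) (Σℤ N (λ k → f (suc k))) (Σℤ N (λ k → h (suc k))))
        where
        regroup : ∀ f e h F H → f ℤ.- e ℤ.* h ℤ.+ (F ℤ.- e ℤ.* H) ≡ f ℤ.+ F ℤ.- e ℤ.* (h ℤ.+ H)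
        regroup = ℤ-solve 5 (λ f e h F H → f ℤ:- e ℤ:* h ℤ:+ (F ℤ:- e ℤ:* H) ℤ:= f ℤ:+ F ℤ:- e ℤ:* (h ℤ:+ H)) ≡.refl

      rhs≡ : ∀ l j → 1 ≤ l → rhs l j ≡ R l j ℤ.- (1ℤ ℤ.- δ l n) ℤ.* R′ l j
      rhs≡ l@(suc l′) j _ = begin
        rhs l j
          ≡⟨ ℤΣ.sum≡Σ< (suc l′) (λ i → + (p ℕ.^ (l′ ∸ i)) ℤ.* ∑[ 1 , p ∸ 1 ] (λ k → A i k ℤ.- e ℤ.* B i k)) ⟩
        Σℤ l (λ i → + (p ℕ.^ (l′ ∸ i)) ℤ.* ∑[ 1 , p ∸ 1 ] (λ k → A i k ℤ.- e ℤ.* B i k))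
          ≡⟨ Σℤ-cong′ l (λ i → ≡.trans (cong (λ a → + (p ℕ.^ (l′ ∸ i)) ℤ.* a)
               (≡.trans (ℤΣ.sum≡Σ< (p ∸ 1) (λ k → A i (suc k) ℤ.- e ℤ.* B i (suc k)))
                        (Σℤ-linear (p ∸ 1) e (λ k → A i (suc k)) (λ k → B i (suc k)))))
               (pull (+ (p ℕ.^ (l′ ∸ i))) (inner l j i) e (inner′ l j i))) ⟩
        Σℤ l (λ i → + (p ℕ.^ (l′ ∸ i)) ℤ.* inner l j i ℤ.- e ℤ.* (+ (p ℕ.^ (l′ ∸ i)) ℤ.* inner′ l j i))
          ≡⟨ Σℤ-linear l e (λ i → + (p ℕ.^ (l′ ∸ i)) ℤ.* inner l j i) (λ i → + (p ℕ.^ (l′ ∸ i)) ℤ.* inner′ l j i) ⟩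
        R l j ℤ.- e ℤ.* R′ l j ∎
        where
        open ≡.≡-Reasoning
        e = 1ℤ ℤ.- δ l n
        A B : ℕ → ℕ → ℤ
        A i k = entry x (n ∸ i) ((j ℕ.+ k ℕ.* p ℕ.^ (n ∸ 1 ∸ i)) ∸ p ℕ.^ (n ∸ l))
        B i k = entry x (n ∸ i) (([ j ]mod-p^ (n ∸ l ∸ 1) ℕ.+ k ℕ.* p ℕ.^ (n ∸ 1 ∸ i)) ∸ p ℕ.^ (n ∸ l ∸ 1))
        pull : ∀ P a e b → P ℤ.* (a ℤ.- e ℤ.* b) ≡ P ℤ.* a ℤ.- e ℤ.* (P ℤ.* b)
        pull = ℤ-solve 4 (λ P a e b → P ℤ:* (a ℤ:- e ℤ:* b) ℤ:= P ℤ:* a ℤ:- e ℤ:* (P ℤ:* b)) ≡.refl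

      R′≡R-top : ∀ l m j → n ∸ l ≡ suc m → R′ l j ≡ R l (top m j)
      R′≡R-top l m j n∸l = Σℤ-cong′ l (λ i → cong (λ a → + (p ℕ.^ (l ∸ 1 ∸ i)) ℤ.* a)
        (Σℤ-cong′ (p ∸ 1) (λ k → cong (entry x (n ∸ i)) (≡.trans
          (cong₂ (λ m m′ → ([ j ]mod m ℕ.+ suc k ℕ.* p ℕ.^ (n ∸ 1 ∸ i)) ∸ p ℕ.^ m′) m≡ m≡)
          (≡.trans (shift-index m ([ j ]mod m) (suc k ℕ.* p ℕ.^ (n ∸ 1 ∸ i)))
            (cong (λ a → (top m j ℕ.+ suc k ℕ.* p ℕ.^ (n ∸ 1 ∸ i)) ∸ p ℕ.^ a) (≡.sym n∸l)))))))
        where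
        m≡ : n ∸ l ∸ 1 ≡ m
        m≡ = cong (_∸ 1) n∸l

    x-rhs≡G : ∀ l j → 1 ≤ l → l ≤ n → entry x (n ∸ l) j ℤ.- rhs l j ≡ G (n ∸ l) j
    x-rhs≡G l j 1≤l l≤n with ℕ.m≤n⇒m<n∨m≡n l≤n
    ... | inj₂ ≡.refl = ≡.trans (cong (λ a → entry x (n ∸ n) j ℤ.- a) (≡.trans (rhs≡ n j 1≤l) drop)) (at-zero (n ∸ n) (ℕ.n∸n≡0 n))
      where
      drop : R n j ℤ.- (1ℤ ℤ.- δ n n) ℤ.* R′ n j ≡ R n j
      drop = ≡.trans (cong (λ d → R n j ℤ.- (1ℤ ℤ.- d) ℤ.* R′ n j) (δ-refl n)) (ℤ.+-identityʳ (R n j))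
      at-zero : ∀ m → m ≡ 0 → entry x m j ℤ.- R n j ≡ G m j
      at-zero m ≡.refl = ≡.refl
    ... | inj₁ l<n = ≡.trans (cong (λ a → entry x (n ∸ l) j ℤ.- a) (≡.trans (rhs≡ l j 1≤l) keep))
                             (at-suc (n ∸ l) n∸l (ℕ.m∸[m∸n]≡n l≤n))
      where
      m = n ∸ suc l
      n∸l : n ∸ l ≡ suc m
      n∸l = ℕ.+-∸-assoc 1 l<n
      keep : R l j ℤ.- (1ℤ ℤ.- δ l n) ℤ.* R′ l j ≡ R l j ℤ.- R l (top m j)
      keep = ≡.trans (cong (λ d → R l j ℤ.- (1ℤ ℤ.- d) ℤ.* R′ l j) (δ-≢ (ℕ.<⇒≢ l<n)))
        (cong (λ a → R l j ℤ.- a) (≡.trans (ℤ.*-identityˡ (R′ l j)) (R′≡R-top l m j n∸l)))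
      at-suc : ∀ m′ → m′ ≡ suc m → n ∸ m′ ≡ l → entry x m′ j ℤ.- (R l j ℤ.- R l (top m j)) ≡ G m′ j
      at-suc m′ ≡.refl eq = cong (λ k → entry x (suc m) j ℤ.- (R k j ℤ.- R k (top m j))) (≡.sym eq)

    congruences⇔ : Congruences x ⇔ (∀ c → c ≤ n → ∀ j → j < D (n ∸ c) → + (p ℕ.^ c) ℤ∣.∣ G (n ∸ c) j)
    congruences⇔ = mk⇔ to from
      where
      to : Congruences x → ∀ c → c ≤ n → ∀ j → j < D (n ∸ c) → + (p ℕ.^ c) ℤ∣.∣ G (n ∸ c) j
      -- `Congruences` starts at l = 1; for c = 0 divisibility by p⁰ is automatic.
      to _ zero _ j _ = ℤ∣.divides (G n j) (≡.sym (ℤ.*-identityʳ (G n j)))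
      to x≡ c@(suc _) c≤n j j<D = ≡.subst (+ (p ℕ.^ c) ℤ∣.∣_) (x-rhs≡G c j (s≤s z≤n) c≤n)
        (ℤ∣.∣ᵤ⇒∣ (x≡ c (s≤s z≤n) c≤n j (≡.subst (j <_) (≡.sym (φ≡D (n ∸ c))) j<D)))
      from : (∀ c → c ≤ n → ∀ j → j < D (n ∸ c) → + (p ℕ.^ c) ℤ∣.∣ G (n ∸ c) j) → Congruences x
      from ∣G l 1≤l l≤n j j<φ = ℤ∣.∣⇒∣ᵤ (≡.subst (+ (p ℕ.^ l) ℤ∣.∣_) (≡.sym (x-rhs≡G l j 1≤l l≤n))
        (∣G l l≤n j (≡.subst (j <_) (φ≡D (n ∸ l)) j<φ)))

ext : ∀ {r} → (Fin r → ℤ) → ℕ → ℤ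
ext {r} s t with t ℕ.<? r
... | yes t<r = s (fromℕ< t<r)
... | no _    = 0ℤ

ext-toℕ : ∀ {r} (s : Fin r → ℤ) k → s k ≡ ext s (toℕ k)
ext-toℕ {r} s k with toℕ k ℕ.<? r
... | yes k<r = cong s (≡.sym (Fin.fromℕ<-toℕ k k<r))
... | no k≮r  = contradiction (Fin.toℕ<n k) k≮r

private
  module ℤEmbedding = IntegerEmbedding ℤ.+-*-commutativeRing

ι-ℤ : ∀ k → ℤEmbedding.ι k ≡ k
ι-ℤ (+ k) = ×1 k
  where
  ×1 : ∀ k → ℤEmbedding.ι (+ k) ≡ + k
  ×1 zero    = ≡.refl
  ×1 (suc k) = cong (λ a → 1ℤ ℤ.+ a) (×1 k)
ι-ℤ (-[1+ k ]) = cong ℤ.-_ (ι-ℤ (+ suc k))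

-- By tightness it suffices to refute that x is apart from 0; otherwise x would be invertible and a
-- would be 0.
heyting-domain : ∀ {c ℓ₁ ℓ₂} (K : HeytingField c ℓ₁ ℓ₂) → let open HeytingField K in
                 ∀ {a x} → ¬ a ≈ 0# → a * x ≈ 0# → x ≈ 0#
heyting-domain K {a} {x} a≉0 ax≈0 = proj₁ (tight x 0#) λ x#0 →
  let (y , _ , [x-0]y≈1) = #⇒invertible x#0 in
  a≉0 (begin
    a                   ≈⟨ *-identityʳ a ⟨
    a * 1#              ≈⟨ *-congˡ [x-0]y≈1 ⟨
    a * ((x - 0#) * y)  ≈⟨ *-assoc a _ y ⟨
    a * (x - 0#) * y    ≈⟨ *-congʳ (*-congˡ (trans (+-congˡ -0#≈0#) (+-identityʳ x))) ⟩
    a * x * y           ≈⟨ *-congʳ ax≈0 ⟩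
    0# * y              ≈⟨ zeroˡ y ⟩
    0#                  ∎)
  where
  open HeytingField K
  𝕂 = HeytingCommutativeRing.commutativeRing heytingCommutativeRing
  open import Algebra.Properties.Ring (CommutativeRing.ring 𝕂) using (-0#≈0#)
  open import Relation.Binary.Reasoning.Setoid (CommutativeRing.setoid 𝕂)

open import Data.Nat.Base using (_^_)

-- The assertions on the Wedderburn embedding

module AbsoluteWedderburn {g ℓ c ℓ₁} {p : ℕ} (p-prime : Prime p) (n : ℕ)
  (C : Group g ℓ) (order : HasOrder C (p ^ n)) (c₀ : Group.Carrier C) (generates : Generates C c₀)
  (R : CommutativeRing c ℓ₁) (char0 : CharacteristicZero R)
  (domain : ∀ {a x} → ¬ CommutativeRing._≈_ R a (CommutativeRing.0# R) →
            CommutativeRing._≈_ R (CommutativeRing._*_ R a x) (CommutativeRing.0# R) →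
            CommutativeRing._≈_ R x (CommutativeRing.0# R))
  (ζ : Fin (suc n) → CommutativeRing.Carrier R)
  (ζ-primitive : ∀ i → IsPrimitiveRootOfUnity R (p ^ toℕ i) (ζ i)) where

  open CommutativeRing R hiding (zero)
  open IntegerEmbedding R
  open PrimeLevels p-prime
  open FlatIndex p-prime
  open GroupLattice p-prime n C order c₀ generates
  open WedderburnLattice R char0 domain p-prime n ζ ζ-primitive
  open ImageLattice p-prime n C order c₀ generates R char0 domain ζ ζ-primitive
  open FamilyEntries p-prime n
  open Coefficients p n {{prime⇒nonZero p-prime}}
  open Wedderburn p n {{prime⇒nonZero p-prime}} C order c₀ R ζ
  open import Algebra.Properties.Semiring.Exp semiring using () renaming (_^_ to _^ᴿ_)
  open import Algebra.Properties.CommutativeMonoid.Sum +-commutativeMonoid using (sum-cong-≋; sum)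
  open import Relation.Binary.Reasoning.Setoid setoid

  sum-ι : ∀ {r} (s : Fin r → ℤ) (h : Fin r → Carrier) (a : ℕ → ℤ) (b : ℕ → Carrier) →
          (∀ k → s k ≡ a (toℕ k)) → (∀ k → h k ≈ b (toℕ k)) →
          sum (λ k → ι (s k) * h k) ≈ Σ< r (λ t → ι (a t) * b t)
  sum-ι {r} s h a b s≡a h≈b = trans (sum-cong-≋ (λ k → *-cong (ι-≡ (s≡a k)) (h≈b k)))
    (reflexive (sum≡Σ< r (λ t → ι (a t) * b t)))

  module Component (i : Fin (suc n)) where

    ℤ[ζᵢ] : RawRing _ _
    ℤ[ζᵢ] = ℤ[_] R (ζ i)

    open RawSemiringDefs (RawRing.rawSemiring ℤ[ζᵢ]) using () renaming (_^_ to pow′) public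

    proj-pow : ∀ t → proj₁ (pow′ (ζ-tuple i) t) ≈ ζ i ^ᴿ t
    proj-pow zero    = refl
    proj-pow (suc t) = *-congˡ (proj-pow t)

    proj-combination : ∀ {r} (s : Fin r → ℤ) e (a : ℕ → ℤ) (b : ℕ → Carrier) →
      (∀ k → s k ≡ a (toℕ k)) → (∀ k → proj₁ (e k) ≈ b (toℕ k)) →
      proj₁ (FreeModule.combination (RawRing.+-rawGroup ℤ[ζᵢ]) s e) ≈ Σ< r (λ t → ι (a t) * b t)
    proj-combination s e a b s≡a e≈b = trans
      (h-combination (RawRing.+-rawGroup ℤ[ζᵢ]) proj₁ (λ _ _ → refl) refl (λ _ → refl) s e)
      (sum-ι s (λ k → proj₁ (e k)) a b s≡a e≈b)

  open Component

  ω≈ : ∀ u i → proj₁ (ω u i) ≈ At.evalG i u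
  ω≈ u i = proj-combination i {p ^ n} (λ k → u ⟨$⟩ pow (toℕ k)) (λ k → pow′ i (ζ-tuple i) (toℕ k)) (λ t → u ⟨$⟩ pow t) (ζ i ^ᴿ_) (λ _ → ≡.refl) (λ k → proj-pow i (toℕ k))

  fromCoefficients≈ : ∀ x i → proj₁ (fromCoefficients x i) ≈ ev (D (toℕ i)) (entry x (toℕ i)) (ζ i)
  fromCoefficients≈ x i = trans
    (proj-combination i (x i) (λ k → pow′ i (ζ-tuple i) (toℕ k)) (entry x (toℕ i)) (ζ i ^ᴿ_) (λ k → ≡.sym (entry-toℕ x i k)) (λ k → proj-pow i (toℕ k)))
    (reflexive (cong (λ N → ev N (entry x (toℕ i)) (ζ i)) (φ≡D (toℕ i))))

  ω-monomorphism : RingMorphisms.IsRingMonomorphism ℤC ∏ℤ[ζ] ω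
  ω-monomorphism = record
    { isRingHomomorphism = record
      { isSemiringHomomorphism = record
        { isNearSemiringHomomorphism = record
          { +-isMonoidHomomorphism = record
            { isMagmaHomomorphism = record
              { isRelHomomorphism = record { cong = λ {u} {v} u≈v i → trans (ω≈ u i) (trans (At.evalG-cong i {u} {v} u≈v) (sym (ω≈ v i))) }
              ; homo = λ u v i → trans (ω≈ (u ℤC.+ v) i) (trans (At.evalG-+ i u v) (sym (+-cong (ω≈ u i) (ω≈ v i))))
              }
            ; ε-homo = λ i → trans (ω≈ ℤC.0# i) (At.evalG-0 i)
            }
          ; *-homo = λ u v i → trans (ω≈ (u ℤC.* v) i) (trans (At.evalG-* i (ζ^p^n≈1 i) u v) (sym (*-cong (ω≈ u i) (ω≈ v i))))
          }
        ; 1#-homo = λ i → trans (ω≈ ℤC.1# i) (trans (At.evalG-[] i (ζ^p^n≈1 i) (Group.ε C))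
            (trans (At.χ-cong i (ζ^p^n≈1 i) (Group.refl C)) (At.χ-pow i (ζ^p^n≈1 i) 0)))
        }
      ; -‿homo = λ u i → trans (ω≈ (ℤC.- u) i) (trans (At.evalG-neg i u) (-‿cong (sym (ω≈ u i))))
      }
    ; injective = λ {u} {v} eq → evalG-injective u v (λ i → trans (sym (ω≈ u i)) (trans (eq i) (ω≈ v i)))
    }

  ω-generator : ω [ c₀ ] ∏ℤ[ζ].≈ ζ-tuple
  ω-generator i = trans (ω≈ [ c₀ ] i) (trans (At.evalG-[] i (ζ^p^n≈1 i) c₀)
    (trans (At.χ-cong i (ζ^p^n≈1 i) (Group.sym C (Group.identityʳ C c₀)))
      (trans (At.χ-pow i (ζ^p^n≈1 i) 1) (*-identityʳ _))))

  coefficients-unique-exist : ∀ y → ∃! _≐_ (λ x → fromCoefficients x ∏ℤ[ζ].≈ y)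
  coefficients-unique-exist y = x , x≈y , unique
    where
    f : Fin (suc n) → ℕ → ℤ
    f i = proj₁ (ζ-span i (proj₂ (y i)))
    x : Family
    x i k = f i (toℕ k)
    x≈y : fromCoefficients x ∏ℤ[ζ].≈ y
    x≈y i = trans
      (proj-combination i (x i) (λ k → pow′ i (ζ-tuple i) (toℕ k)) (f i) (ζ i ^ᴿ_) (λ _ → ≡.refl) (λ k → proj-pow i (toℕ k)))
      (trans (reflexive (cong (λ N → ev N (f i) (ζ i)) (φ≡D (toℕ i)))) (sym (proj₂ (ζ-span i (proj₂ (y i))))))
    unique : ∀ {x′} → fromCoefficients x′ ∏ℤ[ζ].≈ y → x ≐ x′
    unique {x′} x′≈y i k = ≡.trans (≡.sym (entry-toℕ x i k)) (≡.trans
      (ζ-independent i (entry x (toℕ i)) (entry x′ (toℕ i))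
        (trans (sym (fromCoefficients≈ x i)) (trans (x≈y i) (trans (sym (x′≈y i)) (fromCoefficients≈ x′ i))))
        (toℕ k) (≡.subst (toℕ k <_) (φ≡D (toℕ i)) (Fin.toℕ<n k)))
      (entry-toℕ x′ i k))

  coordinatesOf : Family → ℕ → ℕ → ℤ
  coordinatesOf x c = Folding.G n (entry x) (n ∸ c)

  fromCoefficients≈comb : ∀ x i → proj₁ (fromCoefficients x i) ≈ comb (coordinatesOf x) i
  fromCoefficients≈comb x i = trans (fromCoefficients≈ x i) (ev-family (entry x) (entry-vanishes x) i)

  image-characterisation : ∀ x → InImage (fromCoefficients x) ⇔ Congruences x
  image-characterisation x = mk⇔ (λ inImage → Equivalence.from (congruences⇔ x) (divisible inImage))
                                 (λ congruent → preimage (Equivalence.to (congruences⇔ x) congruent))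
    where
    Divisible : Set
    Divisible = ∀ c → c ≤ n → ∀ j → j < D (n ∸ c) → + (p ^ c) ℤ∣.∣ coordinatesOf x c j

    divisible : InImage (fromCoefficients x) → Divisible
    divisible (u , ωu≈x) c c≤n j j<D = ℤ∣.divides (coordinates u c j) (≡.trans
      (comb-independent {coordinatesOf x} {scaled (coordinates u)}
        (λ i → trans (sym (fromCoefficients≈comb x i)) (trans (sym (ωu≈x i)) (trans (ω≈ u i) (evalG-coordinates u i)))) c c≤n j j<D)
      (ℤ.*-comm (+ (p ^ c)) (coordinates u c j)))

    preimage : Divisible → InImage (fromCoefficients x)
    preimage div = U a , λ i → trans (ω≈ (U a) i) (trans (evalG-U a i)
      (trans (comb-cong {scaled a} {coordinatesOf x} scaled-a i) (sym (fromCoefficients≈comb x i))))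
      where
      a : ℕ → ℕ → ℤ
      a c j with c ℕ.≤? n | j ℕ.<? D (n ∸ c)
      ... | yes c≤n | yes j<D = ℤ∣.quotient (div c c≤n j j<D)
      ... | _       | _       = 0ℤ
      scaled-a : ∀ c → c ≤ n → ∀ j → j < D (n ∸ c) → scaled a c j ≡ coordinatesOf x c j
      scaled-a c c≤n j j<D with c ℕ.≤? n | j ℕ.<? D (n ∸ c)
      ... | yes c≤n′ | yes j<D′ = ≡.trans (ℤ.*-comm (+ (p ^ c)) _) (≡.sym (ℤ∣._∣_.equality (div c c≤n′ j j<D′)))
      ... | yes _    | no j≮D   = contradiction j<D j≮D
      ... | no c≰n   | _        = contradiction c≤n c≰n

  unflat : (ℕ → ℤ) → ℕ → ℕ → ℤ
  unflat s c j = s (offset n c ℕ.+ j)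

  flat : (ℕ → ℕ → ℤ) → ℕ → ℤ
  flat a t = a (proj₁ (split n t)) (proj₂ (split n t))

  unflat-flat : ∀ a c → c ≤ n → ∀ j → j < D (n ∸ c) → unflat (flat a) c j ≡ a c j
  unflat-flat a c c≤n j j<D = cong (λ cj → a (proj₁ cj) (proj₂ cj)) (split-offset n c j c≤n j<D)

  -- The rank is the length of a list of divisors, which equals pⁿ only propositionally. A variable
  -- r avoids transporting families along this equation.
  module Bases (r : ℕ) (r≡p^n : r ≡ p ^ n) where

    t<p^n : ∀ (k : Fin r) → toℕ k < p ^ n
    t<p^n k = ≡.subst (toℕ k <_) r≡p^n (Fin.toℕ<n k)

    ext-unflat-injective : ∀ (s s′ : Fin r → ℤ) →
      (∀ c → c ≤ n → ∀ j → j < D (n ∸ c) → unflat (ext s) c j ≡ unflat (ext s′) c j) → ∀ k → s k ≡ s′ k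
    ext-unflat-injective s s′ eq k = ≡.trans (ext-toℕ s k) (≡.trans at-k (≡.sym (ext-toℕ s′ k)))
      where
      cj = split n (toℕ k)
      bounds = split-bounds n (toℕ k) (t<p^n k)
      at-k : ext s (toℕ k) ≡ ext s′ (toℕ k)
      at-k = ≡.subst (λ t → ext s t ≡ ext s′ t) (offset-split n (toℕ k) (t<p^n k))
        (eq (proj₁ cj) (proj₁ bounds) (proj₂ cj) (proj₂ bounds))

    ext-flat : ∀ a c → c ≤ n → ∀ j → j < D (n ∸ c) → unflat (ext {r} (λ k → flat a (toℕ k))) c j ≡ a c j
    ext-flat a c c≤n j j<D = ≡.trans (ext≡ (offset n c ℕ.+ j)
        (≡.subst (offset n c ℕ.+ j <_) (≡.sym r≡p^n) (offset-< n c j c≤n (ℕ.≤-trans j<D (D≤p^ (n ∸ c))))))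
      (unflat-flat a c c≤n j j<D)
      where
      ext≡ : ∀ t → t < r → ext {r} (λ k → flat a (toℕ k)) t ≡ flat a t
      ext≡ t t<r with t ℕ.<? r
      ... | yes t<r′ = cong (flat a) (Fin.toℕ-fromℕ< t<r′)
      ... | no t≮r = contradiction t<r t≮r

    basis′ : ℕ → ℕ → ∏ℤ[ζ].Carrier
    basis′ c j i = if does (c ℕ.<? suc (n ∸ toℕ i)) then pow′ i (ζ-tuple i) j else RawRing.0# (ℤ[ζᵢ] i)

    e′ : Fin r → ∏ℤ[ζ].Carrier
    e′ k = basis′ (proj₁ (split n (toℕ k))) (proj₂ (split n (toℕ k)))

    basis′-low : ∀ i {c} j → c < suc (n ∸ toℕ i) → proj₁ (basis′ c j i) ≈ ζ i ^ᴿ j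
    basis′-low i {c} j c< = trans
      (reflexive (cong (λ b → proj₁ (if b then pow′ i (ζ-tuple i) j else RawRing.0# (ℤ[ζᵢ] i))) (dec-true (c ℕ.<? suc (n ∸ toℕ i)) c<)))
      (proj-pow i j)

    basis′-high : ∀ i {c} j → suc (n ∸ toℕ i) ≤ c → proj₁ (basis′ c j i) ≈ 0#
    basis′-high i {c} j <c =
      reflexive (cong (λ b → proj₁ (if b then pow′ i (ζ-tuple i) j else RawRing.0# (ℤ[ζᵢ] i))) (dec-false (c ℕ.<? suc (n ∸ toℕ i)) (ℕ.≤⇒≯ <c)))

    proj∏ : Fin (suc n) → ∏ℤ[ζ].Carrier → Carrier
    proj∏ i y = proj₁ (y i)

    e′-combination : ∀ s i → proj∏ i (FreeModule.combination ∏ℤ[ζ].+-rawGroup s e′) ≈ comb (unflat (ext s)) i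
    e′-combination s i = begin
      proj∏ i (FreeModule.combination ∏ℤ[ζ].+-rawGroup s e′)
        ≈⟨ h-combination ∏ℤ[ζ].+-rawGroup (proj∏ i) (λ _ _ → refl) refl (λ _ → refl) s e′ ⟩
      sum (λ k → ι (s k) * proj∏ i (e′ k))
        ≈⟨ sum-ι s (λ k → proj∏ i (e′ k)) (ext s) b (ext-toℕ s) (λ _ → refl) ⟩
      Σ< r (λ t → ι (ext s t) * b t)
        ≡⟨ cong (λ N → Σ< N (λ t → ι (ext s t) * b t)) r≡p^n ⟩
      Σ< (p ^ n) (λ t → ι (ext s t) * b t)
        ≈⟨ Σ<-flat +-commutativeMonoid n (λ t → ι (ext s t) * b t) ⟩
      Σ< (suc n) (λ c → Σ< (D (n ∸ c)) (λ j → ι (unflat (ext s) c j) * b (offset n c ℕ.+ j)))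
        ≈⟨ Σ<-cong (suc n) (λ c c≤n → Σ<-cong (D (n ∸ c)) (λ j j<D → *-congˡ {ι (unflat (ext s) c j)} (reflexive
             (cong (λ cj → proj∏ i (basis′ (proj₁ cj) (proj₂ cj))) (split-offset n c j (ℕ.s≤s⁻¹ c≤n) j<D))))) ⟩
      Σ< (suc n) T
        ≡⟨ cong (λ k → Σ< k T) (≡.sym (cong suc (ℕ.m∸n+n≡m (i≤n i)))) ⟩
      Σ< (suc (n ∸ toℕ i) ℕ.+ toℕ i) T
        ≈⟨ Σ<-split (suc (n ∸ toℕ i)) (toℕ i) T ⟩
      Σ< (suc (n ∸ toℕ i)) T + Σ< (toℕ i) (λ k → T (suc (n ∸ toℕ i) ℕ.+ k))
        ≈⟨ +-cong (Σ<-cong (suc (n ∸ toℕ i)) (λ c c< → Σ<-cong′ (D (n ∸ c)) (λ j → *-congˡ {ι (unflat (ext s) c j)} (basis′-low i {c} j c<))))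
                  (Σ<-zero (toℕ i) (λ k _ → Σ<-zero (D (n ∸ (suc (n ∸ toℕ i) ℕ.+ k))) (λ j _ →
                    trans (*-congˡ {ι (unflat (ext s) (suc (n ∸ toℕ i) ℕ.+ k) j)} (basis′-high i j (ℕ.m≤m+n (suc (n ∸ toℕ i)) k))) (zeroʳ _)))) ⟩
      comb (unflat (ext s)) i + 0#
        ≈⟨ +-identityʳ _ ⟩
      comb (unflat (ext s)) i ∎
      where
      b : ℕ → Carrier
      b t = proj∏ i (basis′ (proj₁ (split n t)) (proj₂ (split n t)))
      T : ℕ → Carrier
      T c = Σ< (D (n ∸ c)) (λ j → ι (unflat (ext s) c j) * proj∏ i (basis′ c j))

    -- The base change from the standard coordinates is already explicit: it is `G`.
    e′-basis : FreeModule.IsBasis ∏ℤ[ζ].+-rawGroup e′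
    e′-basis y = s , expand , unique
      where
      existence = coefficients-unique-exist y
      x : Family
      x = proj₁ existence
      s : Fin r → ℤ
      s k = flat (coordinatesOf x) (toℕ k)
      y≈comb : ∀ i → proj₁ (y i) ≈ comb (coordinatesOf x) i
      y≈comb i = trans (sym (proj₁ (proj₂ existence) i)) (fromCoefficients≈comb x i)
      expand : y ∏ℤ[ζ].≈ FreeModule.combination ∏ℤ[ζ].+-rawGroup s e′
      expand i = trans (y≈comb i) (trans (comb-cong {coordinatesOf x} {unflat (ext s)}
        (λ c c≤n j j<D → ≡.sym (ext-flat (coordinatesOf x) c c≤n j j<D)) i) (sym (e′-combination s i)))
      unique : ∀ {s′} → y ∏ℤ[ζ].≈ FreeModule.combination ∏ℤ[ζ].+-rawGroup s′ e′ → ∀ k → s k ≡ s′ k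
      unique {s′} y≈ = ext-unflat-injective s s′ (comb-independent {unflat (ext s)} {unflat (ext s′)}
        (λ i → trans (sym (e′-combination s i)) (trans (sym (expand i)) (trans (y≈ i) (e′-combination s′ i)))))

    eᶜ : Fin r → ℤG
    eᶜ k = e (proj₁ (split n (toℕ k))) (proj₂ (split n (toℕ k)))

    eᶜ-combination : ∀ s → FreeModule.combination ℤC.+-rawGroup s eᶜ ℤC.≈ U (unflat (ext s))
    eᶜ-combination s y = ≡.trans
      (ℤEmbedding.h-combination ℤC.+-rawGroup (_⟨$⟩ y) (λ _ _ → ≡.refl) ≡.refl (λ _ → ≡.refl) s eᶜ)
      (≡.trans (sum-cong-≗ (λ k → cong₂ ℤ._*_ (≡.trans (ι-ℤ (s k)) (ext-toℕ s k)) ≡.refl))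
      (≡.trans (ℤΣ.sum≡Σ< r (λ t → ext s t ℤ.* b t))
      (≡.trans (cong (λ N → Σℤ N (λ t → ext s t ℤ.* b t)) r≡p^n)
      (≡.trans (Σ<-flat ℤ.+-0-commutativeMonoid n (λ t → ext s t ℤ.* b t))
        (Σℤ-cong (suc n) (λ c c≤n → Σℤ-cong (D (n ∸ c)) (λ j j<D → cong (λ cj → unflat (ext s) c j ℤ.* (e (proj₁ cj) (proj₂ cj) ⟨$⟩ y))
           (split-offset n c j (ℕ.s≤s⁻¹ c≤n) j<D))))))))
      where
      open import Algebra.Properties.CommutativeMonoid.Sum ℤ.+-0-commutativeMonoid using (sum-cong-≗)
      b : ℕ → ℤ
      b t = e (proj₁ (split n t)) (proj₂ (split n t)) ⟨$⟩ y

    -- Uniqueness is read off after evaluation, where the coefficients reappear multiplied by pᶜ in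
    -- front of the independent e′_{c,j}, and pᶜ can be cancelled.
    eᶜ-basis : FreeModule.IsBasis ℤC.+-rawGroup eᶜ
    eᶜ-basis u = s , expand , unique
      where
      s : Fin r → ℤ
      s k = flat (coordinates u) (toℕ k)
      expand : u ℤC.≈ FreeModule.combination ℤC.+-rawGroup s eᶜ
      expand y = ≡.trans (≡.sym (U-coordinates u y)) (≡.trans
        (U-cong {coordinates u} {unflat (ext s)} (λ c c≤n j j<D → ≡.sym (ext-flat (coordinates u) c c≤n j j<D)) y)
        (≡.sym (eᶜ-combination s y)))
      evalG-combination : ∀ s′ → u ℤC.≈ FreeModule.combination ℤC.+-rawGroup s′ eᶜ →
                          ∀ i → At.evalG i u ≈ comb (scaled (unflat (ext s′))) i
      evalG-combination s′ u≈ i = trans (At.evalG-cong i {u} {U (unflat (ext s′))} (λ y → ≡.trans (u≈ y) (eᶜ-combination s′ y)))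
        (evalG-U (unflat (ext s′)) i)
      unique : ∀ {s′} → u ℤC.≈ FreeModule.combination ℤC.+-rawGroup s′ eᶜ → ∀ k → s k ≡ s′ k
      unique {s′} u≈ = ext-unflat-injective s s′ (λ c c≤n j j<D →
        scaled-injective {unflat (ext s)} {unflat (ext s′)} c j
          (comb-independent {scaled (unflat (ext s))} {scaled (unflat (ext s′))}
            (λ i → trans (sym (evalG-combination s expand i)) (evalG-combination s′ u≈ i)) c c≤n j j<D))

    ω-diagonal : ∀ k → ω (eᶜ k) ∏ℤ[ζ].≈ FreeModule._·_ ∏ℤ[ζ].+-rawGroup (+ divisor n (toℕ k)) (e′ k)
    ω-diagonal k i = begin
      proj₁ (ω (eᶜ k) i)                          ≈⟨ ω≈ (eᶜ k) i ⟩
      At.evalG i (e cₖ jₖ)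
        ≈⟨ Σ<-cong (p ^ n) (λ t t<N → *-congʳ (ι-≡ (cong (λ t′ → δ ([ t′ ]mod (n ∸ cₖ)) jₖ) (log-unique t<N (Group.refl C))))) ⟩
      ev (p ^ n) (λ t → δ ([ t ]mod (n ∸ cₖ)) jₖ) (ζ i)
        ≈⟨ ev-indicator i cₖ jₖ (proj₁ bounds) (proj₂ bounds) ⟩
      γ i cₖ * ζ i ^ᴿ jₖ                          ≈⟨ compare ⟩
      ι (+ (p ^ cₖ)) * proj∏ i (e′ k)
        ≈⟨ h-· ∏ℤ[ζ].+-rawGroup (proj∏ i) (λ _ _ → refl) refl (λ _ → refl) (+ (p ^ cₖ)) (e′ k) ⟨
      proj∏ i (FreeModule._·_ ∏ℤ[ζ].+-rawGroup (+ divisor n (toℕ k)) (e′ k)) ∎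
      where
      cₖ = proj₁ (split n (toℕ k))
      jₖ = proj₂ (split n (toℕ k))
      bounds = split-bounds n (toℕ k) (t<p^n k)
      compare : γ i cₖ * ζ i ^ᴿ jₖ ≈ ι (+ (p ^ cₖ)) * proj∏ i (e′ k)
      compare with cₖ ℕ.<? suc (n ∸ toℕ i)
      ... | yes c< = *-cong (proj₁ (geometric-ζ i cₖ (proj₁ bounds)) c<) (sym (basis′-low i jₖ c<))
      ... | no c≮  = trans (*-congʳ (proj₂ (geometric-ζ i cₖ (proj₁ bounds)) (ℕ.≮⇒≥ c≮)))
                       (trans (zeroˡ _) (sym (trans (*-congˡ (basis′-high i jₖ (ℕ.≮⇒≥ c≮))) (zeroʳ _))))

  elementary-divisors : ElementaryDivisors ℤC.+-rawGroup ∏ℤ[ζ].+-rawGroup ω (prescribedDivisors p n)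
  elementary-divisors = ≡.subst (ElementaryDivisors ℤC.+-rawGroup ∏ℤ[ζ].+-rawGroup ω) (≡.sym (prescribedDivisors≡ n))
    ( divisors-linked n , eᶜ , e′ , eᶜ-basis , e′-basis
    , λ k → ≡.subst (λ d → ω (eᶜ k) ∏ℤ[ζ].≈ FreeModule._·_ ∏ℤ[ζ].+-rawGroup (+ d) (e′ k))
              (≡.sym (lookup-applyUpTo (divisor n) (p ^ n) k)) (ω-diagonal k))
    where open Bases (length (applyUpTo (divisor n) (p ^ n))) (length-applyUpTo (divisor n) (p ^ n))

theorem5p14 : ∀ {g ℓ c ℓ₁ ℓ₂ : Level}
    (p n : ℕ) (p-prime : Prime p)
    (C : Group g ℓ) (order : HasOrder C (p ^ n))
    (c₀ : Group.Carrier C) → Generates C c₀ →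
    (K : HeytingField c ℓ₁ ℓ₂) →
    let 𝕂 = HeytingCommutativeRing.commutativeRing (HeytingField.heytingCommutativeRing K) in
    CharacteristicZero 𝕂 →
    (ζ : Fin (suc n) → CommutativeRing.Carrier 𝕂) →
    (∀ i → IsPrimitiveRootOfUnity 𝕂 (p ^ toℕ i) (ζ i)) →
    let open Coefficients p n {{prime⇒nonZero p-prime}}
        open Wedderburn p n {{prime⇒nonZero p-prime}} C order c₀ 𝕂 ζ in
    RingMorphisms.IsRingMonomorphism ℤC ∏ℤ[ζ] ω
    × (ω [ c₀ ] ∏ℤ[ζ].≈ ζ-tuple)
    × (∀ y → ∃! _≐_ (λ x → fromCoefficients x ∏ℤ[ζ].≈ y))
    × (∀ x → InImage (fromCoefficients x) ⇔ Congruences x)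
    × ElementaryDivisors ℤC.+-rawGroup ∏ℤ[ζ].+-rawGroup ω (prescribedDivisors p n)
theorem5p14 p n p-prime C order c₀ generates K char0 ζ ζ-primitive =
  ω-monomorphism , ω-generator , coefficients-unique-exist , image-characterisation , elementary-divisors
  where
  open AbsoluteWedderburn p-prime n C order c₀ generates
    (HeytingCommutativeRing.commutativeRing (HeytingField.heytingCommutativeRing K)) char0 (heyting-domain K) ζ ζ-primitive
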